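{- Let $\delta\in\mathbb{N}$. For all $k,\ell\in\mathbb{N}_{>0}$: (1) $\mathrm{NBP}(\mathrm{ISA}_{k,\ell}),\ \oplus\mathrm{BP}(\mathrm{ISA}_{k,\ell})\le 3\cdot 2^{k+\ell/2}+2^\ell$; (2) $\mathrm{LNBP}_\delta(\mathrm{ISA}_{k,\ell})\le 12\cdot 2^k\max\{\frac{2^{\ell-\delta}}{\ell-\delta},\ell\}+\frac{2^{2\ell-\delta}}{\ell-\delta}$ if $\ell>\delta$, and $\mathrm{LNBP}_\delta(\mathrm{ISA}_{k,\ell})\le 2^k(3\ell+1)+2\cdot 2^\ell$ if $\ell\le\delta$; (3) $\mathrm{BP}(\mathrm{ISA}_{k,\ell})\le 9\cdot\frac{2^{k+\ell}}{\ell}+\frac{2^{2\ell}}{\ell}$; (4) $\mathrm{LNBF}_\delta(\mathrm{ISA}_{k,\ell})\le 12\cdot 2^k\cdot\max\{2^{\ell-\delta},\ell\}+3\cdot 2^\ell$; (5) $\mathrm{BF}(\mathrm{ISA}_{k,\ell})\le 7\cdot 2^k\cdot 2^\ell$.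
   Context: For $k,\ell\in\mathbb{N}_{>0}$, $\mathrm{ISA}_{k,\ell}\colon\{0,1\}^{k+2^k\ell+2^\ell}\to\{0,1\}$ (Indirect Storage Access) is defined as follows: on input $a$, let $\alpha$ be the number with big-endian binary representation $a_1\cdots a_k$, let $\beta$ be the number with big-endian binary representation given by the $\ell$ bits of $a$ starting at position $k+1+\ell\alpha$, and output the bit of $a$ at position $k+1+\ell 2^k+\beta$. A branching program (BP) on variable set $V$ is a tuple $(X,s,t_0,t_1,A_0,A_1,\mathrm{var})$: finite vertex set $X$, start vertex $s$, two distinct sinks $t_0,t_1$, arc sets $A_0,A_1\subseteq (X\setminus\{t_0,t_1\})\times(X\setminus\{s\})$ (arcs labelled $0$, resp. $1$), and $\mathrm{var}\colon X\setminus\{t_0,t_1\}\to V$. For $a\in\{0,1\}^V$ let $A[a]$ be the set of arcs $(u,v)\in A_c$ with $a_{\mathrm{var}(u)}=c$. As an NBP it computes $f(a)=1$ iff $(X,A[a])$ has a path from $s$ to $t_1$; as a parity BP ($\oplus$BP) it computes $f(a)=1$ iff the number of such paths is odd. It is deterministic if $(X,A_0\cup A_1)$ is acyclic and each of $A_0$, $A_1$ contains exactly one out-arc of every non-sink vertex. A $\delta$-limited nondeterministic BP ($\delta$-LNBP) for $f\colon\{0,1\}^V\to\{0,1\}$ is a deterministic BP computing some $f'\colon\{0,1\}^{V'}\to\{0,1\}$ with $V\subseteq V'$, $|V'\setminus V|=\delta$, such that $f(a)=\bigvee_{b\in\{0,1\}^{V'\setminus V}}f'(a,b)$. Size of a BP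 = number of non-sink vertices. $\mathrm{NBP}(f),\oplus\mathrm{BP}(f),\mathrm{LNBP}_\delta(f),\mathrm{BP}(f)$ are the minimum sizes of an NBP, $\oplus$BP, $\delta$-LNBP, deterministic BP computing $f$. A Boolean binary formula (BF) on $\{0,1\}^n$ is a rooted binary tree whose internal nodes each have exactly two children and are labelled by arbitrary functions $g\colon\{0,1\}^2\to\{0,1\}$, and whose leaves are labelled by one of $0,1,x_1,\dots,x_n,\neg x_1,\dots,\neg x_n$; it computes a function by composition. A $\delta$-limited nondeterministic binary formula ($\delta$-LNBF) on $\{0,1\}^n$ is a BF $\varphi'$ on $\{0,1\}^{n+\delta}$ and computes $f(a)=\bigvee_{b\in\{0,1\}^\delta}f_{\varphi'}(a,b)$. Size of a formula = number of leaves not labelled by a constant; $\mathrm{BF}(f)$, $\mathrm{LNBF}_\delta(f)$ are the minimum sizes of a BF, resp. $\delta$-LNBF, computing $f$. -}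

module Defs where

open import Data.Nat using (ℕ; zero; suc; _+_; _*_; _∸_; _^_; _≤_; _<_; _<?_)
open import Data.Nat using (_%_)
open import Data.Bool using (Bool; true; false; not)
open import Data.Fin using (Fin; fromℕ<)
open import Data.List using (List; []; _∷_; length)
open import Data.List.Membership.Propositional using (_∈_)
open import Data.List.Relation.Unary.Unique.Propositional using (Unique)
open import Data.Product using (Σ; _×_; _,_; ∃)
open import Data.Sum using (_⊎_)
open import Data.Empty using (⊥)
open import Relation.Binary.PropositionalEquality using (_≡_; _≢_)
open import Relation.Nullary using (yes; no)
open import Function.Bundles using (_⇔_)
import Data.Vec.Functional as VF

isaN : ℕ → ℕ → ℕ
isaN k ℓ = k + 2 ^ k * ℓ + 2 ^ ℓ

-- bit at 0-based position i (false if out of range; never used out of range)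
bitAt : ∀ {n} → (Fin n → Bool) → ℕ → Bool
bitAt {n} a i with i <? n
... | yes p = a (fromℕ< p)
... | no _  = false

b2n : Bool → ℕ
b2n true  = 1
b2n false = 0

bigEndian : ∀ {n} → (Fin n → Bool) → ℕ → ℕ → ℕ
bigEndian a start zero      = 0
bigEndian a start (suc len) = 2 * bigEndian a start len + b2n (bitAt a (start + len))

-- ISA_{k,ℓ}, with the paper's 1-based positions shifted to 0-based ones
ISA : (k ℓ : ℕ) → (Fin (isaN k ℓ) → Bool) → Bool
ISA k ℓ a = bitAt a (k + ℓ * 2 ^ k + β)
  where
  α = bigEndian a 0 k
  β = bigEndian a (k + ℓ * α) ℓ

record BP (nv : ℕ) : Set where
  field
    N      : ℕ
    s t₀ t₁ : Fin N
    A₀ A₁  : Fin N → Fin N → Bool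
    var    : Fin N → Fin nv            -- values at the sinks are irrelevant
    t₀≢t₁  : t₀ ≢ t₁
    A₀-ok  : ∀ u v → A₀ u v ≡ true → (u ≢ t₀) × (u ≢ t₁) × (v ≢ s)
    A₁-ok  : ∀ u v → A₁ u v ≡ true → (u ≢ t₀) × (u ≢ t₁) × (v ≢ s)

open BP public

-- size = number of non-sink vertices
size : ∀ {nv} → BP nv → ℕ
size P = N P ∸ 2

data Walk {N : ℕ} (E : Fin N → Fin N → Set) : Fin N → Fin N → List (Fin N) → Set where
  here : ∀ {u} → Walk E u u (u ∷ [])
  step : ∀ {u v t vs} → E u v → Walk E v t vs → Walk E u t (u ∷ vs)

IsPath : ∀ {N} → (Fin N → Fin N → Set) → Fin N → Fin N → List (Fin N) → Set
IsPath E u t vs = Walk E u t vs × Unique vs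

Arc : ∀ {nv} (P : BP nv) → (Fin nv → Bool) → Fin (N P) → Fin (N P) → Set
Arc P a u v =
  (A₀ P u v ≡ true × a (var P u) ≡ false) ⊎ (A₁ P u v ≡ true × a (var P u) ≡ true)

AllArc : ∀ {nv} (P : BP nv) → Fin (N P) → Fin (N P) → Set
AllArc P u v = (A₀ P u v ≡ true) ⊎ (A₁ P u v ≡ true)

Accepts : ∀ {nv} → BP nv → (Fin nv → Bool) → Set
Accepts P a = ∃ λ vs → IsPath (Arc P a) (s P) (t₁ P) vs

OddPaths : ∀ {nv} → BP nv → (Fin nv → Bool) → Set
OddPaths P a = Σ (List (List (Fin (N P)))) λ ps →
  Unique ps × (∀ vs → (vs ∈ ps) ⇔ IsPath (Arc P a) (s P) (t₁ P) vs) × length ps % 2 ≡ 1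

Deterministic : ∀ {nv} → BP nv → Set
Deterministic P =
  (∀ u v vs → AllArc P u v → Walk (AllArc P) v u vs → ⊥)
  × (∀ u → u ≢ t₀ P → u ≢ t₁ P →
       Σ (Fin (N P)) λ v → A₀ P u v ≡ true × (∀ w → A₀ P u w ≡ true → w ≡ v))
  × (∀ u → u ≢ t₀ P → u ≢ t₁ P →
       Σ (Fin (N P)) λ v → A₁ P u v ≡ true × (∀ w → A₁ P u w ≡ true → w ≡ v))


NBPComputes : ∀ {nv} → BP nv → ((Fin nv → Bool) → Bool) → Set
NBPComputes P f = ∀ a → (f a ≡ true) ⇔ Accepts P a

ParityComputes : ∀ {nv} → BP nv → ((Fin nv → Bool) → Bool) → Set
ParityComputes P f = ∀ a → (f a ≡ true) ⇔ OddPaths P a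

-- δ-LNBP for f : deterministic BP on variables Fin (nv + δ) (the first nv being V)
LNBPComputes : ∀ {nv} (δ : ℕ) → BP (nv + δ) → ((Fin nv → Bool) → Bool) → Set
LNBPComputes δ P f =
  Deterministic P × (∀ a → (f a ≡ true) ⇔ (∃ λ (b : Fin δ → Bool) → Accepts P (a VF.++ b)))

DetComputes : ∀ {nv} → BP nv → ((Fin nv → Bool) → Bool) → Set
DetComputes P f = Deterministic P × NBPComputes P f

-- "measure(f) ≤ bound": some program computing f has size satisfying the
-- predicate B (B is a size bound, possibly stated after clearing denominators)
HasNBP : ∀ {nv} → ((Fin nv → Bool) → Bool) → (ℕ → Set) → Set
HasNBP {nv} f B = Σ (BP nv) λ P → NBPComputes P f × B (size P)

Has⊕BP : ∀ {nv} → ((Fin nv → Bool) → Bool) → (ℕ → Set) → Set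
Has⊕BP {nv} f B = Σ (BP nv) λ P → ParityComputes P f × B (size P)

HasLNBP : ∀ {nv} → ℕ → ((Fin nv → Bool) → Bool) → (ℕ → Set) → Set
HasLNBP {nv} δ f B = Σ (BP (nv + δ)) λ P → LNBPComputes δ P f × B (size P)

HasBP : ∀ {nv} → ((Fin nv → Bool) → Bool) → (ℕ → Set) → Set
HasBP {nv} f B = Σ (BP nv) λ P → DetComputes P f × B (size P)

data BF (n : ℕ) : Set where
  const : Bool → BF n
  pos   : Fin n → BF n
  neg   : Fin n → BF n
  node  : (Bool → Bool → Bool) → BF n → BF n → BF n

evalBF : ∀ {n} → BF n → (Fin n → Bool) → Bool
evalBF (const c)    a = c
evalBF (pos i)      a = a i
evalBF (neg i)      a = not (a i)
evalBF (node g l r) a = g (evalBF l a) (evalBF r a)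

sizeBF : ∀ {n} → BF n → ℕ
sizeBF (const _)    = 0
sizeBF (pos _)      = 1
sizeBF (neg _)      = 1
sizeBF (node _ l r) = sizeBF l + sizeBF r

HasBF : ∀ {n} → ((Fin n → Bool) → Bool) → (ℕ → Set) → Set
HasBF {n} f B = Σ (BF n) λ φ → (∀ a → evalBF φ a ≡ f a) × B (sizeBF φ)

HasLNBF : ∀ {n} → ℕ → ((Fin n → Bool) → Bool) → (ℕ → Set) → Set
HasLNBF {n} δ f B = Σ (BF (n + δ)) λ φ →
  (∀ a → (f a ≡ true) ⇔ (∃ λ (b : Fin δ → Bool) → evalBF φ (a VF.++ b) ≡ true))
  × B (sizeBF φ)

module Submission where

-- The constructions are then: 'NondeterministicProgram' (part 1) reads the
-- high half of the pointer and guesses and verifies the low half backwards;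
-- 'Formulas' (parts 4, 5) is "the guessed high pointer bits are right ∧ the
-- addressed data bit is 1"; 'DeterministicProgram' (parts 2, 3) compares γ
-- pointer bits with γ extra variables, reads a block of 2^t data bits and
-- selects from it by binary search.  'Estimates' and 'DeterministicBounds'
-- choose t and derive the size bounds, and 'theorem5p1' collects all seven.

open import Defs
open import Data.Nat using (ℕ; _+_; _*_; _∸_; _^_; _≤_; _<_; _⊔_)
open import Data.Product using (_×_; _,_)

module Prelude where

  open import Data.Nat using (zero; suc; z≤n; s≤s; _<ᵇ_; _≡ᵇ_)
  open import Data.Nat.Properties using (<ᵇ⇒<; <⇒<ᵇ; ≡ᵇ⇒≡; ≡⇒≡ᵇ; ≮⇒≥)
  open import Data.Bool using (true; false; T; _∧_)
  open import Data.List using ([]; _∷_)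
  open import Data.List.Membership.Propositional using (_∈_)
  open import Data.List.Relation.Unary.Any using (Any; here)
  open import Data.List.Relation.Unary.Any.Properties using (singleton⁺; singleton⁻)
  open import Data.Empty using (⊥)
  open import Relation.Binary.PropositionalEquality
  open import Function.Bundles using (_⇔_; mk⇔; mk↣)
  import Function.Properties.Equivalence as ⇔
  open import Data.Product.Function.NonDependent.Propositional public using (_×-⇔_)
  open import Data.Product.Properties using (≡-dec)
  open import Data.Maybe using (Maybe; just)
  open import Data.Maybe.Properties using (just-injective)
  open import Relation.Binary using (DecidableEquality)
  open import Relation.Nullary.Decidable using (via-injection)
  import Data.Nat as ℕ

  infixr 2 _⟨⇔⟩_
  _⟨⇔⟩_ : ∀ {A B C : Set} → A ⇔ B → B ⇔ C → A ⇔ C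
  _⟨⇔⟩_ = ⇔.trans

  ⇔-sym : ∀ {A B : Set} → A ⇔ B → B ⇔ A
  ⇔-sym = ⇔.sym

  ⇔-refl : ∀ {A : Set} → A ⇔ A
  ⇔-refl = ⇔.refl

  ≡⇒⇔ : ∀ {A B : Set} → A ≡ B → A ⇔ B
  ≡⇒⇔ refl = ⇔-refl

  any-singleton : ∀ {A : Set} {P : A → Set} {x : A} → Any P (x ∷ []) ⇔ P x
  any-singleton = mk⇔ singleton⁻ singleton⁺

  ∈-singleton : ∀ {A : Set} {w v : A} → w ∈ v ∷ [] → w ≡ v
  ∈-singleton (here e) = e

  ∉-[] : ∀ {A : Set} {w : A} → w ∈ [] → ⊥
  ∉-[] ()

  true≢false : ∀ {b} → b ≡ true → b ≡ false → ⊥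
  true≢false refl ()

  <ᵇ-true : ∀ {m n} → (m <ᵇ n) ≡ true → m < n
  <ᵇ-true {m} {n} e = <ᵇ⇒< m n (subst T (sym e) _)

  <⇒<ᵇ-true : ∀ {m n} → m < n → (m <ᵇ n) ≡ true
  <⇒<ᵇ-true {m} {n} lt with m <ᵇ n | <⇒<ᵇ lt
  ... | true | _ = refl

  <ᵇ-false : ∀ {m n} → (m <ᵇ n) ≡ false → n ≤ m
  <ᵇ-false e = ≮⇒≥ λ lt → true≢false (<⇒<ᵇ-true lt) e

  n<ᵇn : ∀ n → (n <ᵇ n) ≡ false
  n<ᵇn zero = refl
  n<ᵇn (suc n) = n<ᵇn n

  ≡ᵇ-true : ∀ {m n} → (m ≡ᵇ n) ≡ true → m ≡ n
  ≡ᵇ-true {m} {n} e = ≡ᵇ⇒≡ m n (subst T (sym e) _)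

  ≡⇒≡ᵇ-true : ∀ {m n} → m ≡ n → (m ≡ᵇ n) ≡ true
  ≡⇒≡ᵇ-true {m} {n} eq with m ≡ᵇ n | ≡⇒≡ᵇ m n eq
  ... | true | _ = refl

  ≡ᵇ-false : ∀ {m n} → (m ≡ᵇ n) ≡ false → m ≢ n
  ≡ᵇ-false e eq with trans (sym e) (≡⇒≡ᵇ-true eq)
  ... | ()

  b2n≤1 : ∀ b → b2n b ≤ 1
  b2n≤1 true = s≤s z≤n
  b2n≤1 false = z≤n

  b2n-injective : ∀ b c → b2n b ≡ b2n c → b ≡ c
  b2n-injective true true _ = refl
  b2n-injective false false _ = refl

  ∧-true : ∀ {p q} → (p ∧ q) ≡ true → (p ≡ true) × (q ≡ true)
  ∧-true {true} {true} refl = refl , refl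

  Code : Set
  Code = ℕ × ℕ × ℕ × ℕ

  decEq-via-code : {V : Set} (code : V → Code) (uncode : Code → Maybe V) →
                   (∀ v → uncode (code v) ≡ just v) → DecidableEquality V
  decEq-via-code code uncode left-inverse =
    via-injection (mk↣ injective) (≡-dec ℕ._≟_ (≡-dec ℕ._≟_ (≡-dec ℕ._≟_ ℕ._≟_)))
    where
    injective : ∀ {u v} → code u ≡ code v → u ≡ v
    injective {u} {v} e = just-injective (trans (sym (left-inverse u)) (trans (cong uncode e) (left-inverse v)))

-- Vertex sets are enumerated as lists built from
-- 'below f n' (the values f i, i < n); membership and length are computed
-- once here, so that the size of each program is a sum of geometric series.
module Enumeration where

  open import Data.Nat using (zero; suc; s≤s)
  open import Data.Nat.Properties
  open import Data.List using (List; []; _∷_; _++_; length)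
  open import Data.List.Properties using (length-++)
  open import Data.List.Membership.Propositional using (_∈_)
  open import Data.List.Membership.Propositional.Properties using (∈-++⁺ˡ; ∈-++⁺ʳ; ∈-++⁻)
  open import Data.List.Relation.Unary.Any using (Any; here; there)
  open import Data.Product using (Σ; _,_)
  open import Data.Sum using (inj₁; inj₂)
  open import Relation.Binary.PropositionalEquality
  open import Function.Bundles using (_⇔_; mk⇔)

  sumBelow : (ℕ → ℕ) → ℕ → ℕ
  sumBelow f zero = 0
  sumBelow f (suc n) = f n + sumBelow f n

  sumBelow-cong : ∀ f g n → (∀ i → f i ≡ g i) → sumBelow f n ≡ sumBelow g n
  sumBelow-cong f g zero e = refl
  sumBelow-cong f g (suc n) e = cong₂ _+_ (e n) (sumBelow-cong f g n e)

  sum-powers2 : ∀ D → sumBelow (2 ^_) D + 1 ≡ 2 ^ D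
  sum-powers2 zero = refl
  sum-powers2 (suc D) = begin
    2 ^ D + sumBelow (2 ^_) D + 1   ≡⟨ +-assoc (2 ^ D) _ 1 ⟩
    2 ^ D + (sumBelow (2 ^_) D + 1) ≡⟨ cong (2 ^ D +_) (sum-powers2 D) ⟩
    2 ^ D + 2 ^ D                   ≡⟨ cong (2 ^ D +_) (sym (+-identityʳ (2 ^ D))) ⟩
    2 ^ suc D                       ∎
    where open ≡-Reasoning

  module _ {A : Set} where

    below : (ℕ → A) → ℕ → List A
    below f zero = []
    below f (suc n) = f n ∷ below f n

    ∈below : ∀ {f i n} → i < n → f i ∈ below f n
    ∈below {f} {i} {suc n} (s≤s i≤n) with m≤n⇒m<n∨m≡n i≤n
    ... | inj₁ i<n = there (∈below i<n)
    ... | inj₂ refl = here refl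

    below∈ : ∀ {f w n} → w ∈ below f n → Σ ℕ λ i → i < n × w ≡ f i
    below∈ {n = suc n} (here e) = n , ≤-refl , e
    below∈ {n = suc n} (there m) with below∈ m
    ... | i , i<n , e = i , m≤n⇒m≤1+n i<n , e

    length-below : ∀ f n → length (below f n) ≡ n
    length-below f zero = refl
    length-below f (suc n) = cong suc (length-below f n)

    any-below : ∀ (P : A → Set) f n → Any P (below f n) ⇔ (Σ ℕ λ i → i < n × P (f i))
    any-below P f n = mk⇔ (to n) (from n)
      where
      to : ∀ n → Any P (below f n) → Σ ℕ λ i → i < n × P (f i)
      to (suc n) (here p) = n , ≤-refl , p
      to (suc n) (there p) with to n p
      ... | i , i<n , q = i , m≤n⇒m≤1+n i<n , q
      from : ∀ n → (Σ ℕ λ i → i < n × P (f i)) → Any P (below f n)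
      from (suc n) (i , s≤s i≤n , p) with m≤n⇒m<n∨m≡n i≤n
      ... | inj₁ i<n = there (from n (i , i<n , p))
      ... | inj₂ refl = here p

    concatBelow : (ℕ → List A) → ℕ → List A
    concatBelow f zero = []
    concatBelow f (suc n) = f n ++ concatBelow f n

    ∈concatBelow : ∀ {f i n w} → i < n → w ∈ f i → w ∈ concatBelow f n
    ∈concatBelow {f} {i} {suc n} (s≤s i≤n) m with m≤n⇒m<n∨m≡n i≤n
    ... | inj₁ i<n = ∈-++⁺ʳ (f n) (∈concatBelow i<n m)
    ... | inj₂ refl = ∈-++⁺ˡ m

    concatBelow∈ : ∀ {f n w} → w ∈ concatBelow f n → Σ ℕ λ i → i < n × w ∈ f i
    concatBelow∈ {f} {suc n} m with ∈-++⁻ (f n) m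
    ... | inj₁ m′ = n , ≤-refl , m′
    ... | inj₂ m′ with concatBelow∈ {f} {n} m′
    ...   | i , i<n , m″ = i , m≤n⇒m≤1+n i<n , m″

    length-concatBelow : ∀ f n → length (concatBelow f n) ≡ sumBelow (λ i → length (f i)) n
    length-concatBelow f zero = refl
    length-concatBelow f (suc n) = trans (length-++ (f n)) (cong (length (f n) +_) (length-concatBelow f n))

    length-concatBelow-const : ∀ f n c → (∀ i → length (f i) ≡ c) → length (concatBelow f n) ≡ n * c
    length-concatBelow-const f n c e = trans (length-concatBelow f n) (trans (sumBelow-cong _ _ n e) (sum-const n))
      where
      sum-const : ∀ n → sumBelow (λ _ → c) n ≡ n * c
      sum-const zero = refl
      sum-const (suc n) = cong (c +_) (sum-const n)

    -- The vertices f j q (j < D, q < 2^j) of a complete binary tree of depth D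
    -- (a "forward tree", read from the root).
    tree : (ℕ → ℕ → A) → ℕ → List A
    tree f D = concatBelow (λ j → below (f j) (2 ^ j)) D

    ∈tree : ∀ {f D j q} → j < D → q < 2 ^ j → f j q ∈ tree f D
    ∈tree j<D q<2^j = ∈concatBelow j<D (∈below q<2^j)

    tree∈ : ∀ {f D w} → w ∈ tree f D → Σ ℕ λ j → Σ ℕ λ q → j < D × q < 2 ^ j × w ≡ f j q
    tree∈ m with concatBelow∈ m
    ... | j , j<D , m′ with below∈ m′
    ...   | q , q<2^j , e = j , q , j<D , q<2^j , e

    length-tree : ∀ f D → length (tree f D) + 1 ≡ 2 ^ D
    length-tree f D =
      trans (cong (_+ 1) (trans (length-concatBelow _ D)
                                (sumBelow-cong _ _ D (λ j → length-below (f j) (2 ^ j)))))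
            (sum-powers2 D)

    -- The vertices f j q (1 ≤ j ≤ D, q < 2^j) of a "backward tree", whose
    -- root level 0 is identified with some other vertex.
    btree : (ℕ → ℕ → A) → ℕ → List A
    btree f D = concatBelow (λ j → below (f (suc j)) (2 ^ suc j)) D

    ∈btree : ∀ {f D j q} → j < D → q < 2 ^ suc j → f (suc j) q ∈ btree f D
    ∈btree j<D q<2^j = ∈concatBelow j<D (∈below q<2^j)

    btree∈ : ∀ {f D w} → w ∈ btree f D → Σ ℕ λ j → Σ ℕ λ q → j < D × q < 2 ^ suc j × w ≡ f (suc j) q
    btree∈ m with concatBelow∈ m
    ... | j , j<D , m′ with below∈ m′
    ...   | q , q<2^j , e = j , q , j<D , q<2^j , e

    length-btree : ∀ f D → length (btree f D) + 2 ≡ 2 ^ suc D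
    length-btree f D = begin
      length (btree f D) + 2
        ≡⟨ cong (_+ 2) (trans (length-concatBelow _ D)
                              (sumBelow-cong _ _ D (λ j → length-below (f (suc j)) (2 ^ suc j)))) ⟩
      sumBelow (λ j → 2 ^ suc j) D + 2     ≡⟨ cong (_+ 2) (doubled D) ⟩
      2 * sumBelow (2 ^_) D + 2            ≡⟨ sym (*-distribˡ-+ 2 (sumBelow (2 ^_) D) 1) ⟩
      2 * (sumBelow (2 ^_) D + 1)          ≡⟨ cong (2 *_) (sum-powers2 D) ⟩
      2 ^ suc D                            ∎
      where
      open ≡-Reasoning
      doubled : ∀ D → sumBelow (λ j → 2 ^ suc j) D ≡ 2 * sumBelow (2 ^_) D
      doubled zero = refl
      doubled (suc D) = trans (cong (2 ^ suc D +_) (doubled D)) (sym (*-distribˡ-+ 2 (2 ^ D) _))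

module BigEndian where

  open import Data.Nat using (zero; suc; z≤n; s≤s; _<?_; NonZero; _/_; _%_)
  open import Data.Nat.Properties
  open import Data.Nat.DivMod
  open import Data.Bool using (Bool)
  open import Data.Fin using (Fin; toℕ; fromℕ<; _↑ˡ_; _↑ʳ_)
  open import Data.Fin.Properties using (toℕ-injective; toℕ-fromℕ<; toℕ<n; toℕ-↑ˡ; toℕ-↑ʳ)
  import Data.Vec.Functional as VF
  open import Data.Vec.Functional.Properties using (lookup-++ˡ; lookup-++ʳ)
  open import Data.Product using (_,_; proj₂)
  open import Data.Empty using (⊥-elim)
  open import Relation.Binary.PropositionalEquality
  open import Relation.Nullary using (yes; no)
  open import Function.Bundles using (_⇔_; mk⇔; Equivalence)
  open import Data.Nat.Solver using (module +-*-Solver)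
  open Prelude

  shiftIn< : ∀ j q c → q < 2 ^ j → 2 * q + b2n c < 2 ^ suc j
  shiftIn< j q c q< = begin-strict
    2 * q + b2n c     ≤⟨ +-monoʳ-≤ (2 * q) (b2n≤1 c) ⟩
    2 * q + 1         <⟨ ≤-refl ⟩
    suc (2 * q + 1)   ≡⟨ cong suc (+-comm (2 * q) 1) ⟩
    2 + 2 * q         ≡⟨ sym (*-distribˡ-+ 2 1 q) ⟩
    2 * suc q         ≤⟨ *-monoʳ-≤ 2 q< ⟩
    2 ^ suc j         ∎
    where open ≤-Reasoning

  halve< : ∀ j q → q < 2 ^ suc j → q / 2 < 2 ^ j
  halve< j q q< = m<n*o⇒m/o<n (subst (q <_) (*-comm 2 (2 ^ j)) q<)

  digits< : ∀ a b H L → H < 2 ^ a → L < 2 ^ b → H * 2 ^ b + L < 2 ^ (a + b)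
  digits< a b H L H< L< = begin-strict
    H * 2 ^ b + L       <⟨ +-monoʳ-< (H * 2 ^ b) L< ⟩
    H * 2 ^ b + 2 ^ b   ≡⟨ +-comm (H * 2 ^ b) _ ⟩
    suc H * 2 ^ b       ≤⟨ *-monoˡ-≤ (2 ^ b) H< ⟩
    2 ^ a * 2 ^ b       ≡⟨ sym (^-distribˡ-+-* 2 a b) ⟩
    2 ^ (a + b)         ∎
    where open ≤-Reasoning

  div-digits : ∀ H L X .{{_ : NonZero X}} → L < X → (H * X + L) / X ≡ H
  div-digits H L X L<X =
    trans (cong (_/ X) (+-comm (H * X) L))
          (trans (+-distrib-/ L (H * X) small) (cong₂ _+_ (m<n⇒m/n≡0 L<X) (m*n/n≡m H X)))
    where
    small : L % X + (H * X) % X < X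
    small = subst (λ z → L % X + z < X) (sym (m*n%n≡0 H X))
                  (subst (_< X) (sym (trans (+-identityʳ _) (m<n⇒m%n≡m L<X))) L<X)

  mod-digits : ∀ H L X .{{_ : NonZero X}} → L < X → (H * X + L) % X ≡ L
  mod-digits H L X L<X =
    trans (cong (_% X) (+-comm (H * X) L)) (trans ([m+kn]%n≡m%n L H X) (m<n⇒m%n≡m L<X))

  lastBit⇔ : ∀ b q e → b ≤ 1 → ((b ≡ q % 2) × (e ≡ q / 2)) ⇔ (2 * e + b ≡ q)
  lastBit⇔ b q e b≤1 = mk⇔ to from
    where
    to : (b ≡ q % 2) × (e ≡ q / 2) → 2 * e + b ≡ q
    to (refl , refl) =
      sym (trans (m≡m%n+[m/n]*n q 2) (trans (+-comm (q % 2) _) (cong (_+ q % 2) (*-comm (q / 2) 2))))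
    swap : 2 * e + b ≡ e * 2 + b
    swap = cong (_+ b) (*-comm 2 e)
    from : 2 * e + b ≡ q → (b ≡ q % 2) × (e ≡ q / 2)
    from refl = sym (trans (cong (_% 2) swap) (mod-digits e b 2 (s≤s b≤1))) ,
                sym (trans (cong (_/ 2) swap) (div-digits e b 2 (s≤s b≤1)))

  bigEndian-split : ∀ {n} (x : Fin n → Bool) st m p →
                    bigEndian x st (m + p) ≡ bigEndian x st m * 2 ^ p + bigEndian x (st + m) p
  bigEndian-split x st m zero =
    trans (cong (bigEndian x st) (+-identityʳ m)) (sym (trans (+-identityʳ _) (*-identityʳ _)))
  bigEndian-split x st m (suc p) = begin
    bigEndian x st (m + suc p)                                ≡⟨ cong (bigEndian x st) (+-suc m p) ⟩
    2 * bigEndian x st (m + p) + b2n (bitAt x (st + (m + p)))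
      ≡⟨ cong₂ (λ u v → 2 * u + b2n (bitAt x v)) (bigEndian-split x st m p) (sym (+-assoc st m p)) ⟩
    2 * (A * 2 ^ p + B) + c
      ≡⟨ solve 4 (λ A B c P → con 2 :* (A :* P :+ B) :+ c := A :* (con 2 :* P) :+ (con 2 :* B :+ c))
               refl A B c (2 ^ p) ⟩
    A * 2 ^ suc p + (2 * B + c)                               ∎
    where
    open ≡-Reasoning
    open +-*-Solver
    A = bigEndian x st m
    B = bigEndian x (st + m) p
    c = b2n (bitAt x (st + m + p))

  bigEndian-head : ∀ {n} (x : Fin n → Bool) st m →
                   bigEndian x st (suc m) ≡ b2n (bitAt x st) * 2 ^ m + bigEndian x (suc st) m
  bigEndian-head x st m =
    trans (bigEndian-split x st 1 m)
          (cong₂ (λ u v → u * 2 ^ m + bigEndian x v m)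
                 (cong b2n (cong (bitAt x) (+-identityʳ st))) (+-comm st 1))

  bigEndian< : ∀ {n} (x : Fin n → Bool) st m → bigEndian x st m < 2 ^ m
  bigEndian< x st zero = s≤s z≤n
  bigEndian< x st (suc m) = shiftIn< m _ (bitAt x (st + m)) (bigEndian< x st m)

  bigEndian-ext : ∀ {n} (x : Fin n → Bool) s₁ s₂ len →
                  (∀ j → j < len → bitAt x (s₁ + j) ≡ bitAt x (s₂ + j)) →
                  bigEndian x s₁ len ≡ bigEndian x s₂ len
  bigEndian-ext x s₁ s₂ zero h = refl
  bigEndian-ext x s₁ s₂ (suc len) h =
    cong₂ (λ u v → 2 * u + b2n v) (bigEndian-ext x s₁ s₂ len (λ j j< → h j (m≤n⇒m≤1+n j<))) (h len ≤-refl)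

  bigEndian-agree : ∀ {m n} (x : Fin n → Bool) (a : Fin m → Bool) →
                    (∀ p → p < m → bitAt x p ≡ bitAt a p) →
                    ∀ st len → st + len ≤ m → bigEndian x st len ≡ bigEndian a st len
  bigEndian-agree x a ag st zero _ = refl
  bigEndian-agree x a ag st (suc len) end =
    cong₂ (λ u v → 2 * u + b2n v)
          (bigEndian-agree x a ag st len (≤-trans (+-monoʳ-≤ st (n≤1+n len)) end))
          (ag (st + len) (≤-trans (+-monoʳ-< st ≤-refl) end))

  forwardTree : ∀ {n} (x : Fin n → Bool) st D (R : ℕ → ℕ → Set) →
                (∀ j q → j < D → R j q ⇔ R (suc j) (2 * q + b2n (bitAt x (st + j)))) →
                R 0 0 ⇔ R D (bigEndian x st D)
  forwardTree x st D R advance =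
    subst (λ z → R 0 0 ⇔ R D z) (cong (λ v → bigEndian x v D) (+-identityʳ st)) (remaining D 0 0 refl)
    where
    open +-*-Solver
    remaining : ∀ m j q → j + m ≡ D → R j q ⇔ R D (q * 2 ^ m + bigEndian x (st + j) m)
    remaining zero j q e =
      ≡⇒⇔ (cong₂ R (trans (sym (+-identityʳ j)) e) (sym (trans (+-identityʳ _) (*-identityʳ q))))
    remaining (suc m) j q e =
      advance j q j<D ⟨⇔⟩ remaining m (suc j) _ (trans (sym (+-suc j m)) e) ⟨⇔⟩ ≡⇒⇔ (cong (R D) regroup)
      where
      j<D : j < D
      j<D = subst (j <_) e (subst (_≤ j + suc m) (+-comm j 1) (+-monoʳ-≤ j (s≤s z≤n)))
      b = b2n (bitAt x (st + j))
      regroup : (2 * q + b) * 2 ^ m + bigEndian x (st + suc j) m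
              ≡ q * 2 ^ suc m + bigEndian x (st + j) (suc m)
      regroup = begin
        (2 * q + b) * 2 ^ m + bigEndian x (st + suc j) m
          ≡⟨ cong (λ v → (2 * q + b) * 2 ^ m + bigEndian x v m) (+-suc st j) ⟩
        (2 * q + b) * 2 ^ m + bigEndian x (suc (st + j)) m
          ≡⟨ solve 4 (λ q b P B → (con 2 :* q :+ b) :* P :+ B := q :* (con 2 :* P) :+ (b :* P :+ B))
                   refl q b (2 ^ m) _ ⟩
        q * 2 ^ suc m + (b * 2 ^ m + bigEndian x (suc (st + j)) m)
          ≡⟨ cong (q * 2 ^ suc m +_) (sym (bigEndian-head x (st + j) m)) ⟩
        q * 2 ^ suc m + bigEndian x (st + j) (suc m) ∎
        where open ≡-Reasoning

  backwardTree : ∀ {n} (x : Fin n → Bool) st D (R : ℕ → ℕ → Set) (L : Set) →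
                 (R 0 0 ⇔ L) →
                 (∀ j q → j < D → R (suc j) q ⇔ ((b2n (bitAt x (st + j)) ≡ q % 2) × R j (q / 2))) →
                 ∀ j q → j ≤ D → q < 2 ^ j → R j q ⇔ ((bigEndian x st j ≡ q) × L)
  backwardTree x st D R L base advance zero .0 _ (s≤s z≤n) = base ⟨⇔⟩ mk⇔ (λ l → refl , l) proj₂
  backwardTree x st D R L base advance (suc j) q j<D q< =
    advance j q j<D ⟨⇔⟩ (⇔-refl ×-⇔ backwardTree x st D R L base advance j (q / 2) (<⇒≤ j<D) (halve< j q q<))
    ⟨⇔⟩ mk⇔ (λ (e₁ , e₂ , l) → Equivalence.to (lastBit⇔ b q _ (b2n≤1 _)) (e₁ , e₂) , l)
            (λ (e , l) → let (e₁ , e₂) = Equivalence.from (lastBit⇔ b q _ (b2n≤1 _)) e in e₁ , e₂ , l)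
    where
    b = b2n (bitAt x (st + j))

  -- The variable at a position (a fixed default beyond the last position).
  varAt : ∀ {n} → 0 < n → ℕ → Fin n
  varAt {n} n>0 p with p <? n
  ... | yes p<n = fromℕ< p<n
  ... | no _ = fromℕ< n>0

  varAt-bitAt : ∀ {n} (n>0 : 0 < n) (x : Fin n → Bool) p → p < n → x (varAt n>0 p) ≡ bitAt x p
  varAt-bitAt {n} n>0 x p p<n with p <? n
  ... | yes _ = refl
  ... | no p≮n = ⊥-elim (p≮n p<n)

  bitAt-toℕ : ∀ {n} (x : Fin n → Bool) p (i : Fin n) → toℕ i ≡ p → bitAt x p ≡ x i
  bitAt-toℕ {n} x p i e with p <? n
  ... | yes p<n = cong x (toℕ-injective (trans (toℕ-fromℕ< p<n) (sym e)))
  ... | no p≮n = ⊥-elim (p≮n (subst (_< n) e (toℕ<n i)))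

  bitAt-++ˡ : ∀ {m d} (a : Fin m → Bool) (b : Fin d → Bool) p → p < m → bitAt (a VF.++ b) p ≡ bitAt a p
  bitAt-++ˡ {d = d} a b p p<m = begin
    bitAt (a VF.++ b) p          ≡⟨ bitAt-toℕ (a VF.++ b) p (i ↑ˡ d) (trans (toℕ-↑ˡ i d) (toℕ-fromℕ< p<m)) ⟩
    (a VF.++ b) (i ↑ˡ d)         ≡⟨ lookup-++ˡ a b i ⟩
    a i                          ≡⟨ sym (bitAt-toℕ a p i (toℕ-fromℕ< p<m)) ⟩
    bitAt a p                    ∎
    where
    open ≡-Reasoning
    i = fromℕ< p<m

  bitAt-++ʳ : ∀ {m d} (a : Fin m → Bool) (b : Fin d → Bool) i (i<d : i < d) →
              bitAt (a VF.++ b) (m + i) ≡ b (fromℕ< i<d)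
  bitAt-++ʳ {m} a b i i<d =
    trans (bitAt-toℕ (a VF.++ b) (m + i) (m ↑ʳ fromℕ< i<d)
                     (trans (toℕ-↑ʳ m (fromℕ< i<d)) (cong (m +_) (toℕ-fromℕ< i<d))))
          (lookup-++ʳ a b (fromℕ< i<d))

-- A vertex u queries the variable 'label u' and, on value c, may move
-- to any vertex of 'next u c'.  A rank that strictly decreases along moves
-- makes the machine acyclic.  'Compiled.program' numbers the vertices by
-- their first position in the list (other positions become dead vertices
-- pointing to the rejecting sink) and yields a 'BP'.
module Compile where

  open import Data.Nat using (zero; suc; z≤n; s≤s; _≡ᵇ_)
  open import Data.Nat.Properties using (suc-injective; ≤-reflexive; ≤-refl; ≤-trans; <⇒≤; <⇒≢; ≤-<-trans; <⇒≱)
  open import Data.Bool using (Bool; true; false; if_then_else_)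
  open import Data.Bool.ListAction using (any)
  open import Data.Fin as Fin using (Fin; toℕ; fromℕ<)
  open import Data.Fin.Properties using (toℕ-injective; toℕ-fromℕ<)
  open import Data.List using (List; []; _∷_; length; lookup)
  open import Data.List.Membership.Propositional using (_∈_; lose; find)
  open import Data.List.Relation.Unary.Any using (Any; here; there)
  open import Data.List.Relation.Unary.All using (All; []; _∷_)
  import Data.List.Relation.Unary.All as All
  import Data.List.Relation.Unary.AllPairs as AllPairs
  open import Data.List.Relation.Unary.Unique.Propositional using (Unique)
  open import Data.Product using (Σ; _,_)
  open import Data.Sum using (inj₁; inj₂)
  open import Data.Empty using (⊥; ⊥-elim)
  open import Relation.Binary.PropositionalEquality
  open import Relation.Nullary using (yes; no)
  open import Relation.Binary using (DecidableEquality)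
  open import Function.Bundles using (_⇔_; mk⇔; Equivalence)
  open Prelude

  record Machine (nv : ℕ) : Set₁ where
    field
      Vertex : Set
      _≟V_ : DecidableEquality Vertex
      vertices : List Vertex
      start reject accept : Vertex
      reject≢accept : reject ≢ accept
      start≢reject : start ≢ reject
      label : Vertex → Fin nv
      next : Vertex → Bool → List Vertex
      next-reject : ∀ c → next reject c ≡ []
      next-accept : ∀ c → next accept c ≡ []
      rank : Vertex → ℕ
      rank-next : ∀ u c w → w ∈ next u c → rank w < rank u
      start∈ : start ∈ vertices
      reject∈ : reject ∈ vertices
      accept∈ : accept ∈ vertices
      next-closed : ∀ u c w → u ∈ vertices → w ∈ next u c → w ∈ vertices
      next≢start : ∀ u c w → w ∈ next u c → w ≢ start

  module _ {nv : ℕ} (M : Machine nv) where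
    open Machine M

    data Reaches (a : Fin nv → Bool) : Vertex → Set where
      done : Reaches a accept
      go : ∀ {u w} → w ∈ next u (a (label u)) → Reaches a w → Reaches a u

  module ReachesProperties {nv : ℕ} (M : Machine nv) where
    open Machine M

    reaches-next : ∀ a u → u ≢ accept → Reaches M a u ⇔ Any (Reaches M a) (next u (a (label u)))
    reaches-next a u u≢accept = mk⇔ to from
      where
      to : Reaches M a u → Any (Reaches M a) (next u (a (label u)))
      to done = ⊥-elim (u≢accept refl)
      to (go m r) = lose m r
      from : Any (Reaches M a) (next u (a (label u))) → Reaches M a u
      from reach with find reach
      ... | w , m , r = go m r

    reaches-query : ∀ a u (L : Bool → List Vertex) b → u ≢ accept →
                    (∀ c → next u c ≡ L c) → a (label u) ≡ b → Reaches M a u ⇔ Any (Reaches M a) (L b)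
    reaches-query a u L b u≢accept nextL ab =
      reaches-next a u u≢accept ⟨⇔⟩ ≡⇒⇔ (cong (Any (Reaches M a)) (trans (nextL _) (cong L ab)))

    reaches-move : ∀ a u (f : Bool → Vertex) b → u ≢ accept →
                   (∀ c → next u c ≡ f c ∷ []) → a (label u) ≡ b → Reaches M a u ⇔ Reaches M a (f b)
    reaches-move a u f b u≢accept nextf ab =
      reaches-query a u (λ c → f c ∷ []) b u≢accept nextf ab ⟨⇔⟩ any-singleton

    reject-fails : ∀ a → Reaches M a reject → ⊥
    reject-fails a done = reject≢accept refl
    reject-fails a (go {w = w} m r) = ∉-[] (subst (w ∈_) (next-reject _) m)

  module Compiled {nv : ℕ} (M : Machine nv) where
    open Machine M

    position : Vertex → List Vertex → ℕ
    position v [] = 0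
    position v (x ∷ xs) with v ≟V x
    ... | yes _ = 0
    ... | no _ = suc (position v xs)

    position< : ∀ {v} xs → v ∈ xs → position v xs < length xs
    position< {v} (x ∷ xs) v∈ with v ≟V x
    ... | yes _ = s≤s z≤n
    position< {v} (x ∷ xs) (here v≡x) | no v≢x = ⊥-elim (v≢x v≡x)
    position< {v} (x ∷ xs) (there v∈) | no _ = s≤s (position< xs v∈)

    lookup-position : ∀ {v} xs → v ∈ xs → (j : Fin (length xs)) → toℕ j ≡ position v xs → lookup xs j ≡ v
    lookup-position {v} (x ∷ xs) v∈ j e with v ≟V x
    lookup-position {v} (x ∷ xs) v∈ Fin.zero e | yes v≡x = sym v≡x
    lookup-position {v} (x ∷ xs) v∈ (Fin.suc j) () | yes _
    lookup-position {v} (x ∷ xs) (here v≡x) j e | no v≢x = ⊥-elim (v≢x v≡x)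
    lookup-position {v} (x ∷ xs) (there v∈) Fin.zero () | no _
    lookup-position {v} (x ∷ xs) (there v∈) (Fin.suc j) e | no _ =
      lookup-position xs v∈ j (suc-injective e)

    count : ℕ
    count = length vertices

    decode : Fin count → Vertex
    decode = lookup vertices

    index : Vertex → ℕ
    index v = position v vertices

    encode : (v : Vertex) → v ∈ vertices → Fin count
    encode v v∈ = fromℕ< (position< vertices v∈)

    index-encode : ∀ v (v∈ : v ∈ vertices) → toℕ (encode v v∈) ≡ index v
    index-encode v v∈ = toℕ-fromℕ< _

    decode-index : ∀ v (v∈ : v ∈ vertices) (j : Fin count) → toℕ j ≡ index v → decode j ≡ v
    decode-index v v∈ j e = lookup-position vertices v∈ j e

    decode-encode : ∀ v (v∈ : v ∈ vertices) → decode (encode v v∈) ≡ v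
    decode-encode v v∈ = decode-index v v∈ _ (index-encode v v∈)

    decode∈ : ∀ i → decode i ∈ vertices
    decode∈ i = lookup∈ vertices i
      where
      lookup∈ : ∀ (xs : List Vertex) (i : Fin (length xs)) → lookup xs i ∈ xs
      lookup∈ (x ∷ xs) Fin.zero = here refl
      lookup∈ (x ∷ xs) (Fin.suc i) = there (lookup∈ xs i)

    index-injective : ∀ v w → v ∈ vertices → w ∈ vertices → index v ≡ index w → v ≡ w
    index-injective v w v∈ w∈ e =
      trans (sym (decode-encode v v∈)) (decode-index w w∈ (encode v v∈) (trans (index-encode v v∈) e))

    canonical : Fin count → Bool
    canonical i = index (decode i) ≡ᵇ toℕ i

    canonical-index : ∀ w → w ∈ vertices → (j : Fin count) → toℕ j ≡ index w → canonical j ≡ true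
    canonical-index w w∈ j e = ≡⇒≡ᵇ-true (trans (cong index (decode-index w w∈ j e)) (sym e))

    canonical-encode : ∀ v (v∈ : v ∈ vertices) → canonical (encode v v∈) ≡ true
    canonical-encode v v∈ = canonical-index v v∈ _ (index-encode v v∈)

    canonical-decode : ∀ i v (v∈ : v ∈ vertices) → canonical i ≡ true → decode i ≡ v → i ≡ encode v v∈
    canonical-decode i v v∈ c e =
      toℕ-injective (trans (sym (≡ᵇ-true c)) (trans (cong index e) (sym (index-encode v v∈))))

    S T₀ T₁ : Fin count
    S = encode start start∈
    T₀ = encode reject reject∈
    T₁ = encode accept accept∈

    T₀≢T₁ : T₀ ≢ T₁
    T₀≢T₁ e = reject≢accept (trans (sym (decode-encode reject reject∈))
                                   (trans (cong decode e) (decode-encode accept accept∈)))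

    arc : Bool → Fin count → Fin count → Bool
    arc c i j = if canonical i then any (λ w → toℕ j ≡ᵇ index w) (next (decode i) c)
                else (toℕ j ≡ᵇ index reject)

    any-true : ∀ (p : Vertex → Bool) xs → any p xs ≡ true → Σ Vertex λ w → w ∈ xs × p w ≡ true
    any-true p (x ∷ xs) e with p x in px
    ... | true = x , here refl , px
    ... | false with any-true p xs e
    ...   | w , w∈ , pw = w , there w∈ , pw

    true-any : ∀ (p : Vertex → Bool) xs w → w ∈ xs → p w ≡ true → any p xs ≡ true
    true-any p (x ∷ xs) w (here refl) pw rewrite pw = refl
    true-any p (x ∷ xs) w (there w∈) pw with p x
    ... | true = refl
    ... | false = true-any p xs w w∈ pw

    data ArcView (c : Bool) (i j : Fin count) : Set where
      canonicalArc : canonical i ≡ true → (w : Vertex) → w ∈ next (decode i) c → toℕ j ≡ index w →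
                     ArcView c i j
      deadArc : canonical i ≡ false → toℕ j ≡ index reject → ArcView c i j

    arcView : ∀ c i j → arc c i j ≡ true → ArcView c i j
    arcView c i j e with canonical i in ci
    ... | true with any-true _ (next (decode i) c) e
    ...   | w , w∈ , jw = canonicalArc ci w w∈ (≡ᵇ-true jw)
    arcView c i j e | false = deadArc ci (≡ᵇ-true e)

    no-next : ∀ {v c w} → next v c ≡ [] → w ∈ next v c → ⊥
    no-next e w∈ = ∉-[] (subst (_ ∈_) e w∈)

    arc-ok : ∀ c u v → arc c u v ≡ true → (u ≢ T₀) × (u ≢ T₁) × (v ≢ S)
    arc-ok c u v e with arcView c u v e
    ... | canonicalArc cu w w∈ vw =
          (λ u≡ → no-next (next-reject c) (subst (λ z → w ∈ next z c) (trans (cong decode u≡) (decode-encode reject reject∈)) w∈)) ,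
          (λ u≡ → no-next (next-accept c) (subst (λ z → w ∈ next z c) (trans (cong decode u≡) (decode-encode accept accept∈)) w∈)) ,
          λ v≡ → next≢start (decode u) c w w∈
                   (index-injective w start (next-closed (decode u) c w (decode∈ u) w∈) start∈
                     (trans (sym vw) (trans (cong toℕ v≡) (index-encode start start∈))))
    ... | deadArc cu vr =
          (λ u≡ → true≢false (canonical-encode reject reject∈) (subst (λ z → canonical z ≡ false) u≡ cu)) ,
          (λ u≡ → true≢false (canonical-encode accept accept∈) (subst (λ z → canonical z ≡ false) u≡ cu)) ,
          λ v≡ → start≢reject (sym (index-injective reject start reject∈ start∈
                                     (trans (sym vr) (trans (cong toℕ v≡) (index-encode start start∈)))))

    program : BP nv
    program = record
      { N = count ; s = S ; t₀ = T₀ ; t₁ = T₁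
      ; A₀ = arc false ; A₁ = arc true
      ; var = λ i → label (decode i)
      ; t₀≢t₁ = T₀≢T₁
      ; A₀-ok = arc-ok false ; A₁-ok = arc-ok true }

    next∈ : ∀ i {c w} → w ∈ next (decode i) c → w ∈ vertices
    next∈ i {c} {w} w∈ = next-closed (decode i) c w (decode∈ i) w∈

    arc⇒next : ∀ a i j → Arc program a i j → canonical i ≡ true →
               Σ Vertex λ w → w ∈ next (decode i) (a (label (decode i))) × toℕ j ≡ index w
    arc⇒next a i j (inj₁ (e , ai)) ci with arcView false i j e
    ... | canonicalArc _ w w∈ jw = w , subst (λ z → w ∈ next (decode i) z) (sym ai) w∈ , jw
    ... | deadArc di _ = ⊥-elim (true≢false ci di)
    arc⇒next a i j (inj₂ (e , ai)) ci with arcView true i j e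
    ... | canonicalArc _ w w∈ jw = w , subst (λ z → w ∈ next (decode i) z) (sym ai) w∈ , jw
    ... | deadArc di _ = ⊥-elim (true≢false ci di)

    arc-encode : ∀ c u (u∈ : u ∈ vertices) w (w∈ : w ∈ vertices) → w ∈ next u c →
                 arc c (encode u u∈) (encode w w∈) ≡ true
    arc-encode c u u∈ w w∈ m rewrite canonical-encode u u∈ | decode-encode u u∈ =
      true-any _ (next u c) w m (≡⇒≡ᵇ-true (index-encode w w∈))

    next⇒arc : ∀ a u (u∈ : u ∈ vertices) w (w∈ : w ∈ vertices) → w ∈ next u (a (label u)) →
               Arc program a (encode u u∈) (encode w w∈)
    next⇒arc a u u∈ w w∈ m with a (label u) in au
    ... | false = inj₁ (arc-encode false u u∈ w w∈ m , trans (cong (λ z → a (label z)) (decode-encode u u∈)) au)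
    ... | true = inj₂ (arc-encode true u u∈ w w∈ m , trans (cong (λ z → a (label z)) (decode-encode u u∈)) au)

    walk⇒reaches : ∀ a i vs → canonical i ≡ true → Walk (Arc program a) i T₁ vs → Reaches M a (decode i)
    walk⇒reaches a i vs ci here = subst (Reaches M a) (sym (decode-encode accept accept∈)) done
    walk⇒reaches a i (i ∷ vs) ci (step {v = j} ij walk) with arc⇒next a i j ij ci
    ... | w , w∈ , jw =
      go w∈ (subst (Reaches M a) (decode-index w (next∈ i w∈) j jw)
                   (walk⇒reaches a j vs (canonical-index w (next∈ i w∈) j jw) walk))

    -- Conversely a run gives a walk; it is a path since the rank decreases
    -- strictly along it.
    reaches⇒path : ∀ a u (u∈ : u ∈ vertices) → Reaches M a u →
                   Σ (List (Fin count)) λ vs → Walk (Arc program a) (encode u u∈) T₁ vs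
                     × Unique vs × All (λ j → rank (decode j) ≤ rank u) vs
    reaches⇒path a _ u∈ done =
      (T₁ ∷ []) , subst (λ z → Walk (Arc program a) z T₁ (z ∷ [])) (sym same) here ,
      (subst (λ z → Unique (z ∷ [])) (sym same) ([] AllPairs.∷ AllPairs.[])) ,
      (≤-reflexive (cong rank (decode-encode accept accept∈)) ∷ [])
      where
      same : encode accept u∈ ≡ T₁
      same = toℕ-injective (trans (index-encode accept u∈) (sym (index-encode accept accept∈)))
    reaches⇒path a u u∈ (go {w = w} m r) with reaches⇒path a w w∈ r
      where w∈ = next-closed u _ w u∈ m
    ... | vs , walk , unique , ranks =
      (encode u u∈ ∷ vs) , step (next⇒arc a u u∈ w w∈ m) walk ,
      (All.map (λ le eq → <⇒≢ (≤-<-trans le w<u) (trans (cong (λ z → rank (decode z)) (sym eq)) ru)) ranks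
        AllPairs.∷ unique) ,
      (≤-reflexive ru ∷ All.map (λ le → ≤-trans le (<⇒≤ w<u)) ranks)
      where
      w∈ = next-closed u _ w u∈ m
      w<u = rank-next u _ w m
      ru = cong rank (decode-encode u u∈)

    accepts⇔ : ∀ a → Accepts program a ⇔ Reaches M a start
    accepts⇔ a = mk⇔
      (λ (vs , walk , _) → subst (Reaches M a) (decode-encode start start∈)
                                 (walk⇒reaches a S vs (canonical-encode start start∈) walk))
      (λ r → let (vs , walk , unique , _) = reaches⇒path a start start∈ r in vs , walk , unique)

    module Functional (single-next : ∀ u → u ∈ vertices → u ≢ reject → u ≢ accept →
                                     ∀ c → Σ Vertex λ w → next u c ≡ w ∷ []) where

      rank′ : Fin count → ℕ
      rank′ i = if canonical i then rank (decode i) else suc (rank reject)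

      rank-view : ∀ c i j → ArcView c i j → rank′ j < rank′ i
      rank-view c i j (canonicalArc ci w w∈ jw)
        rewrite ci | canonical-index w (next∈ i w∈) j jw | decode-index w (next∈ i w∈) j jw =
        rank-next (decode i) c w w∈
      rank-view c i j (deadArc ci jr)
        rewrite ci | canonical-index reject reject∈ j jr | decode-index reject reject∈ j jr = ≤-refl

      rank-arc : ∀ i j → AllArc program i j → rank′ j < rank′ i
      rank-arc i j (inj₁ e) = rank-view false i j (arcView false i j e)
      rank-arc i j (inj₂ e) = rank-view true i j (arcView true i j e)

      rank-walk : ∀ u v vs → Walk (AllArc program) u v vs → rank′ v ≤ rank′ u
      rank-walk u .u _ here = ≤-refl
      rank-walk u v _ (step {v = j} uj walk) = ≤-trans (rank-walk j v _ walk) (<⇒≤ (rank-arc u j uj))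

      acyclic : ∀ u v vs → AllArc program u v → Walk (AllArc program) v u vs → ⊥
      acyclic u v vs uv walk = <⇒≱ (rank-arc u v uv) (rank-walk v u vs walk)

      unique-arc : ∀ c u → u ≢ T₀ → u ≢ T₁ →
                   Σ (Fin count) λ v → arc c u v ≡ true × (∀ w → arc c u w ≡ true → w ≡ v)
      unique-arc c u u≢T₀ u≢T₁ with canonical u in cu
      ... | false = T₀ , ≡⇒≡ᵇ-true (index-encode reject reject∈) ,
                    λ w e → toℕ-injective (trans (≡ᵇ-true e) (sym (index-encode reject reject∈)))
      ... | true with single-next (decode u) (decode∈ u)
                                  (λ e → u≢T₀ (canonical-decode u reject reject∈ cu e))
                                  (λ e → u≢T₁ (canonical-decode u accept accept∈ cu e)) c
      ...   | w , nu = encode w w∈ , to-w , only-w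
        where
        w∈ : w ∈ vertices
        w∈ = next∈ u (subst (w ∈_) (sym nu) (here refl))
        to-w : any (λ w′ → toℕ (encode w w∈) ≡ᵇ index w′) (next (decode u) c) ≡ true
        to-w = true-any _ (next (decode u) c) w (subst (w ∈_) (sym nu) (here refl))
                        (≡⇒≡ᵇ-true (index-encode w w∈))
        only-w : ∀ v → any (λ w′ → toℕ v ≡ᵇ index w′) (next (decode u) c) ≡ true → v ≡ encode w w∈
        only-w v e with any-true _ (next (decode u) c) e
        ... | w′ , w′∈ , vw′ with subst (w′ ∈_) nu w′∈
        ...   | here refl = toℕ-injective (trans (≡ᵇ-true vw′) (sym (index-encode w w∈)))

      deterministic : Deterministic program
      deterministic = acyclic , unique-arc false , unique-arc true

    -- If on every input at most one successor of each vertex can reach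
    -- acceptance, accepting paths are unique, so the program is also a ⊕BP
    -- for the same function.
    module Unambiguous (a : Fin nv → Bool)
                       (unambiguous : ∀ u w w′ → u ∈ vertices → w ∈ next u (a (label u)) →
                                      w′ ∈ next u (a (label u)) → Reaches M a w → Reaches M a w′ → w ≡ w′) where

      accept-no-arc : ∀ j → Arc program a T₁ j → ⊥
      accept-no-arc j ar with arc⇒next a T₁ j ar (canonical-encode accept accept∈)
      ... | w , w∈ , _ = no-next (next-accept _) (subst (λ z → w ∈ next z (a (label (decode T₁)))) (decode-encode accept accept∈) w∈)

      walk-unique : ∀ i vs ws → canonical i ≡ true →
                    Walk (Arc program a) i T₁ vs → Walk (Arc program a) i T₁ ws → vs ≡ ws
      walk-unique i _ _ ci here here = refl
      walk-unique i _ _ ci here (step {v = j} ar _) = ⊥-elim (accept-no-arc j ar)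
      walk-unique i _ _ ci (step {v = j} ar _) here = ⊥-elim (accept-no-arc j ar)
      walk-unique i (i ∷ vs) (i ∷ ws) ci (step {v = j} ij walk) (step {v = j′} ij′ walk′)
        with arc⇒next a i j ij ci | arc⇒next a i j′ ij′ ci
      ... | w , w∈ , jw | w′ , w′∈ , jw′ =
        cong (i ∷_) (walk-unique j vs ws cj walk (subst (λ z → Walk (Arc program a) z T₁ ws) (sym j≡j′) walk′))
        where
        v∈ = next∈ i w∈
        v′∈ = next∈ i w′∈
        cj = canonical-index w v∈ j jw
        w≡w′ : w ≡ w′
        w≡w′ = unambiguous (decode i) w w′ (decode∈ i) w∈ w′∈
                 (subst (Reaches M a) (decode-index w v∈ j jw) (walk⇒reaches a j vs cj walk))
                 (subst (Reaches M a) (decode-index w′ v′∈ j′ jw′)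
                        (walk⇒reaches a j′ ws (canonical-index w′ v′∈ j′ jw′) walk′))
        j≡j′ : j ≡ j′
        j≡j′ = toℕ-injective (trans jw (trans (cong index w≡w′) (sym jw′)))

      oddPaths⇔ : OddPaths program a ⇔ Reaches M a start
      oddPaths⇔ = mk⇔ to from
        where
        to : OddPaths program a → Reaches M a start
        to ([] , _ , _ , ())
        to ((vs ∷ _) , _ , paths , _) with Equivalence.to (paths vs) (here refl)
        ... | walk , _ = subst (Reaches M a) (decode-encode start start∈)
                               (walk⇒reaches a S vs (canonical-encode start start∈) walk)
        from : Reaches M a start → OddPaths program a
        from r with reaches⇒path a start start∈ r
        ... | vs , walk , unique , _ =
          (vs ∷ []) , ([] AllPairs.∷ AllPairs.[]) ,
          (λ ws → mk⇔ (λ { (here refl) → walk , unique })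
                      (λ (walk′ , _) → here (sym (walk-unique S vs ws (canonical-encode start start∈) walk walk′)))) ,
          refl

module FormulaKit where

  open import Data.Nat using (zero; suc; z≤n; s≤s)
  open import Data.Nat.Properties
  open import Data.Bool using (Bool; true; false; if_then_else_; not; _∧_; _∨_)
  open import Data.Fin using (Fin)
  open import Data.Product using (_,_)
  open import Data.Sum using (inj₁; inj₂)
  open import Relation.Binary.PropositionalEquality
  open import Function.Bundles using (_⇔_; mk⇔)
  open import Data.Nat.Solver using (module +-*-Solver)
  open Prelude
  open BigEndian using (bigEndian-head)

  -- "if s then A else B"; it reads s twice.
  ite : ∀ {n} → BF n → BF n → BF n → BF n
  ite s A B = node _∨_ (node _∧_ s A) (node (λ u v → not u ∧ v) s B)

  eval-ite : ∀ {n} (s A B : BF n) a → evalBF (ite s A B) a ≡ (if evalBF s a then evalBF A a else evalBF B a)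
  eval-ite s A B a with evalBF s a | evalBF A a | evalBF B a
  ... | true | true | _ = refl
  ... | true | false | _ = refl
  ... | false | _ | true = refl
  ... | false | _ | false = refl

  -- The multiplexer: D selector formulas sel 0, …, sel (D-1) (most
  -- significant first) choose among the 2^D formulas leaf 0, …, leaf (2^D - 1).
  mux : ∀ {n} → (ℕ → BF n) → ℕ → (ℕ → BF n) → BF n
  mux sel zero leaf = leaf 0
  mux sel (suc D) leaf = ite (sel 0) (mux (λ i → sel (suc i)) D (λ r → leaf (2 ^ D + r)))
                                     (mux (λ i → sel (suc i)) D leaf)

  selected : ∀ {n} → (ℕ → BF n) → ℕ → (Fin n → Bool) → ℕ
  selected sel zero a = 0
  selected sel (suc D) a = b2n (evalBF (sel 0) a) * 2 ^ D + selected (λ i → sel (suc i)) D a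

  eval-mux : ∀ {n} sel D (leaf : ℕ → BF n) a → evalBF (mux sel D leaf) a ≡ evalBF (leaf (selected sel D a)) a
  eval-mux sel zero leaf a = refl
  eval-mux sel (suc D) leaf a
    rewrite eval-ite (sel 0) (mux (λ i → sel (suc i)) D (λ r → leaf (2 ^ D + r))) (mux (λ i → sel (suc i)) D leaf) a
    with evalBF (sel 0) a
  ... | true = trans (eval-mux (λ i → sel (suc i)) D (λ r → leaf (2 ^ D + r)) a)
                     (cong (λ z → evalBF (leaf (z + selected (λ i → sel (suc i)) D a)) a) (sym (+-identityʳ (2 ^ D))))
  ... | false = eval-mux (λ i → sel (suc i)) D leaf a

  selected< : ∀ {n} sel D (a : Fin n → Bool) → selected sel D a < 2 ^ D
  selected< sel zero a = s≤s z≤n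
  selected< sel (suc D) a = begin-strict
    b * 2 ^ D + selected (λ i → sel (suc i)) D a  <⟨ +-monoʳ-< (b * 2 ^ D) (selected< (λ i → sel (suc i)) D a) ⟩
    b * 2 ^ D + 2 ^ D                            ≤⟨ +-monoˡ-≤ (2 ^ D) (*-monoˡ-≤ (2 ^ D) (b2n≤1 (evalBF (sel 0) a))) ⟩
    1 * 2 ^ D + 2 ^ D                            ≡⟨ cong (_+ 2 ^ D) (*-identityˡ (2 ^ D)) ⟩
    2 ^ D + 2 ^ D                                ≡⟨ cong (2 ^ D +_) (sym (+-identityʳ (2 ^ D))) ⟩
    2 ^ suc D                                    ∎
    where
    open ≤-Reasoning
    b = b2n (evalBF (sel 0) a)

  selected-bigEndian : ∀ {n} sel D (a : Fin n → Bool) st →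
                       (∀ i → i < D → b2n (evalBF (sel i) a) ≡ b2n (bitAt a (st + i))) →
                       selected sel D a ≡ bigEndian a st D
  selected-bigEndian sel zero a st reads = refl
  selected-bigEndian sel (suc D) a st reads = begin
    b2n (evalBF (sel 0) a) * 2 ^ D + selected (λ i → sel (suc i)) D a
      ≡⟨ cong₂ (λ u v → u * 2 ^ D + v)
               (trans (reads 0 (s≤s z≤n)) (cong (λ z → b2n (bitAt a z)) (+-identityʳ st)))
               (selected-bigEndian (λ i → sel (suc i)) D a (suc st)
                 (λ i i<D → trans (reads (suc i) (s≤s i<D)) (cong (λ z → b2n (bitAt a z)) (+-suc st i)))) ⟩
    b2n (bitAt a st) * 2 ^ D + bigEndian a (suc st) D  ≡⟨ sym (bigEndian-head a st D) ⟩
    bigEndian a st (suc D)                            ∎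
    where open ≡-Reasoning

  size-mux : ∀ {n} sel D (leaf : ℕ → BF n) σ λ′ → (∀ i → sizeBF (sel i) ≤ σ) → (∀ c → sizeBF (leaf c) ≤ λ′) →
             sizeBF (mux sel D leaf) + 2 * σ ≤ (2 * σ + λ′) * 2 ^ D
  size-mux sel zero leaf σ λ′ hs hl =
    subst (sizeBF (leaf 0) + 2 * σ ≤_) (trans (+-comm λ′ (2 * σ)) (sym (*-identityʳ _))) (+-monoˡ-≤ (2 * σ) (hl 0))
  size-mux sel (suc D) leaf σ λ′ hs hl = begin
    s₀ + A + (s₀ + B) + 2 * σ   ≤⟨ +-monoˡ-≤ (2 * σ) (+-mono-≤ (+-monoˡ-≤ A (hs 0)) (+-monoˡ-≤ B (hs 0))) ⟩
    σ + A + (σ + B) + 2 * σ     ≡⟨ solve 3 (λ σ A B → σ :+ A :+ (σ :+ B) :+ con 2 :* σ := (A :+ con 2 :* σ) :+ (B :+ con 2 :* σ)) refl σ A B ⟩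
    (A + 2 * σ) + (B + 2 * σ)   ≤⟨ +-mono-≤ (size-mux (λ i → sel (suc i)) D (λ r → leaf (2 ^ D + r)) σ λ′ (λ i → hs (suc i)) (λ c → hl _))
                                            (size-mux (λ i → sel (suc i)) D leaf σ λ′ (λ i → hs (suc i)) hl) ⟩
    (2 * σ + λ′) * 2 ^ D + (2 * σ + λ′) * 2 ^ D  ≡⟨ solve 2 (λ X P → X :* P :+ X :* P := X :* (con 2 :* P)) refl (2 * σ + λ′) (2 ^ D) ⟩
    (2 * σ + λ′) * 2 ^ suc D    ∎
    where
    open ≤-Reasoning
    open +-*-Solver
    s₀ = sizeBF (sel 0)
    A = sizeBF (mux (λ i → sel (suc i)) D (λ r → leaf (2 ^ D + r)))
    B = sizeBF (mux (λ i → sel (suc i)) D leaf)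

  conj : ∀ {n} → ℕ → (ℕ → BF n) → BF n
  conj zero f = const true
  conj (suc m) f = node _∧_ (f m) (conj m f)

  eval-conj : ∀ {n} m (f : ℕ → BF n) a → (evalBF (conj m f) a ≡ true) ⇔ (∀ i → i < m → evalBF (f i) a ≡ true)
  eval-conj m f a = mk⇔ (to m) (from m)
    where
    to : ∀ m → evalBF (conj m f) a ≡ true → ∀ i → i < m → evalBF (f i) a ≡ true
    to (suc m) e i i<m with ∧-true {evalBF (f m) a} e | m≤n⇒m<n∨m≡n (≤-pred i<m)
    ... | _ , rest | inj₁ i<m′ = to m rest i i<m′
    ... | fm , _ | inj₂ refl = fm
    from : ∀ m → (∀ i → i < m → evalBF (f i) a ≡ true) → evalBF (conj m f) a ≡ true
    from zero h = refl
    from (suc m) h rewrite h m ≤-refl = from m (λ i i<m → h i (m≤n⇒m≤1+n i<m))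

  size-conj : ∀ {n} m (f : ℕ → BF n) c → (∀ i → sizeBF (f i) ≤ c) → sizeBF (conj m f) ≤ m * c
  size-conj zero f c h = z≤n
  size-conj (suc m) f c h = +-mono-≤ (h m) (size-conj m f c h)

  equiv : ∀ {n} → BF n → BF n → BF n
  equiv u v = node (λ p q → if p then q else not q) u v

  eval-equiv : ∀ {n} (u v : BF n) a → (evalBF (equiv u v) a ≡ true) ⇔ (evalBF u a ≡ evalBF v a)
  eval-equiv u v a with evalBF u a | evalBF v a
  ... | true | true = mk⇔ (λ _ → refl) (λ _ → refl)
  ... | true | false = mk⇔ (λ ()) (λ ())
  ... | false | true = mk⇔ (λ ()) (λ ())
  ... | false | false = mk⇔ (λ _ → refl) (λ _ → refl)

module Layout (k ℓ : ℕ) where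

  open import Data.Nat using (suc)
  open import Data.Nat.Properties
  open import Relation.Binary.PropositionalEquality

  nv : ℕ
  nv = isaN k ℓ

  nv>0 : 0 < nv
  nv>0 = <-≤-trans (m^n>0 2 ℓ) (m≤n+m (2 ^ ℓ) (k + 2 ^ k * ℓ))

  address<nv : ∀ j → j < k → j < nv
  address<nv j j<k = ≤-trans j<k (≤-trans (m≤m+n k _) (m≤m+n _ _))

  pointerEnd : ∀ α → α < 2 ^ k → k + ℓ * α + ℓ ≤ nv
  pointerEnd α α< = begin
    k + ℓ * α + ℓ      ≡⟨ +-assoc k (ℓ * α) ℓ ⟩
    k + (ℓ * α + ℓ)    ≡⟨ cong (k +_) (trans (+-comm (ℓ * α) ℓ) (sym (*-suc ℓ α))) ⟩
    k + ℓ * suc α      ≤⟨ +-monoʳ-≤ k (*-monoʳ-≤ ℓ α<) ⟩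
    k + ℓ * 2 ^ k      ≡⟨ cong (k +_) (*-comm ℓ (2 ^ k)) ⟩
    k + 2 ^ k * ℓ      ≤⟨ m≤m+n _ _ ⟩
    nv                 ∎
    where open ≤-Reasoning

  pointer<nv : ∀ α i → α < 2 ^ k → i < ℓ → k + ℓ * α + i < nv
  pointer<nv α i α< i<ℓ = <-≤-trans (+-monoʳ-< (k + ℓ * α) i<ℓ) (pointerEnd α α<)

  pointer<nv′ : ∀ α i j → α < 2 ^ k → i + j < ℓ → k + ℓ * α + i + j < nv
  pointer<nv′ α i j α< i+j<ℓ = subst (_< nv) (sym (+-assoc (k + ℓ * α) i j)) (pointer<nv α (i + j) α< i+j<ℓ)

  data<nv : ∀ β → β < 2 ^ ℓ → k + ℓ * 2 ^ k + β < nv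
  data<nv β β< = subst (λ z → k + z + β < nv) (*-comm (2 ^ k) ℓ) (+-monoʳ-< (k + 2 ^ k * ℓ) β<)

-- A nondeterministic program reads the address α and the high
-- h′ = ⌈ℓ/2⌉ bits X of pointer α along trees, then guesses the low h = ⌊ℓ/2⌋
-- bits y and queries data bit X 2^h + y at a vertex 'test X y' shared by all
-- addresses.  If the bit is 1 it guesses the address α′ and checks backwards
-- that the low bits of pointer α′ spell y and that the address is α′.  This
-- gives size 2^ℓ + 2^k (2^h′ + 2^(h+1)) − 3.  A successful guess is unique,
-- so the same program is a ⊕BP.
module NondeterministicProgram (k ℓ : ℕ) (k>0 : 0 < k) where

  open import Data.Nat using (zero; suc; z≤n; s≤s; _<ᵇ_; _≡ᵇ_; _/_; _%_)
  open import Data.Nat.Properties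
  open import Data.Nat.DivMod
  open import Data.Bool using (Bool; true; false; if_then_else_)
  open import Data.Fin using (Fin)
  open import Data.Maybe using (Maybe; just; nothing)
  open import Data.List using (List; []; _∷_; _++_; length)
  open import Data.List.Properties using (length-++)
  open import Data.List.Membership.Propositional using (_∈_)
  open import Data.List.Membership.Propositional.Properties using (∈-++⁺ˡ; ∈-++⁺ʳ; ∈-++⁻)
  open import Data.List.Relation.Unary.Any using (Any; here; there)
  open import Data.Product using (Σ; _,_; proj₁; proj₂)
  open import Data.Sum using (inj₁; inj₂)
  open import Data.Empty using (⊥-elim)
  open import Data.Unit using (⊤; tt)
  open import Relation.Binary.PropositionalEquality
  open import Function.Bundles using (_⇔_; mk⇔; Equivalence)
  open import Data.Nat.Solver using (module +-*-Solver)
  open Prelude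
  open Enumeration
  open BigEndian
  open Compile
  open Layout k ℓ

  h h′ : ℕ
  h = ℓ / 2
  h′ = ℓ ∸ h

  h′+h : h′ + h ≡ ℓ
  h′+h = m∸n+n≡m (m/n≤m ℓ 2)

  h′≤ℓ : h′ ≤ ℓ
  h′≤ℓ = m∸n≤m ℓ h

  data Vertex : Set where
    reject accept : Vertex
    -- j address bits have been read, with value q
    readAddress : (j q : ℕ) → Vertex
    -- j high bits of pointer α have been read, with value q
    readHigh : (α j q : ℕ) → Vertex
    -- query data bit X 2^h + y
    test : (X y : ℕ) → Vertex
    -- (j ≥ 1) the low bits h′ … h′+j-1 of pointer α must spell q
    checkLow : (α j q : ℕ) → Vertex
    -- (j ≥ 1) the address bits 0 … j-1 must spell q
    checkAddress : (j q : ℕ) → Vertex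

  code : Vertex → Code
  code reject = 0 , 0 , 0 , 0
  code accept = 1 , 0 , 0 , 0
  code (readAddress j q) = 2 , 0 , j , q
  code (readHigh α j q) = 3 , α , j , q
  code (test X y) = 4 , X , y , 0
  code (checkLow α j q) = 5 , α , j , q
  code (checkAddress j q) = 6 , 0 , j , q

  uncode : Code → Maybe Vertex
  uncode (0 , _) = just reject
  uncode (1 , _) = just accept
  uncode (2 , _ , j , q) = just (readAddress j q)
  uncode (3 , α , j , q) = just (readHigh α j q)
  uncode (4 , X , y , _) = just (test X y)
  uncode (5 , α , j , q) = just (checkLow α j q)
  uncode (6 , _ , j , q) = just (checkAddress j q)
  uncode _ = nothing

  uncode-code : ∀ v → uncode (code v) ≡ just v
  uncode-code reject = refl
  uncode-code accept = refl
  uncode-code (readAddress j q) = refl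
  uncode-code (readHigh α j q) = refl
  uncode-code (test X y) = refl
  uncode-code (checkLow α j q) = refl
  uncode-code (checkAddress j q) = refl

  afterHigh : ℕ → ℕ → ℕ → List Vertex
  afterHigh α j q = if j <ᵇ h′ then readHigh α j q ∷ [] else below (test q) (2 ^ h)

  afterAddress : ℕ → ℕ → List Vertex
  afterAddress j q = if j <ᵇ k then readAddress j q ∷ [] else afterHigh q 0 0

  checkAddress′ : ℕ → ℕ → Vertex
  checkAddress′ zero q = accept
  checkAddress′ (suc j) q = checkAddress (suc j) q

  checkLow′ : ℕ → ℕ → ℕ → Vertex
  checkLow′ α zero q = checkAddress′ k α
  checkLow′ α (suc j) q = checkLow α (suc j) q

  ifLastBit : Bool → ℕ → Vertex → List Vertex
  ifLastBit c q w = if b2n c ≡ᵇ q % 2 then w ∷ [] else []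

  next : Vertex → Bool → List Vertex
  next (readAddress j q) c = if j <ᵇ k then afterAddress (suc j) (2 * q + b2n c) else []
  next (readHigh α j q) c = if j <ᵇ h′ then afterHigh α (suc j) (2 * q + b2n c) else []
  next (test X y) c = if c then below (λ α → checkLow′ α h y) (2 ^ k) else []
  next (checkLow α (suc j) q) c = ifLastBit c q (checkLow′ α j (q / 2))
  next (checkAddress (suc j) q) c = ifLastBit c q (checkAddress′ j (q / 2))
  next _ c = []

  position : Vertex → ℕ
  position (readAddress j _) = j
  position (readHigh α j _) = k + ℓ * α + j
  position (test X y) = k + ℓ * 2 ^ k + (X * 2 ^ h + y)
  position (checkLow α (suc j) _) = k + ℓ * α + h′ + j
  position (checkAddress (suc j) _) = j
  position _ = 0

  label : Vertex → Fin nv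
  label v = varAt nv>0 (position v)

  rankTop : ℕ
  rankTop = k + h + h′ + 2

  rank : Vertex → ℕ
  rank (readAddress j _) = rankTop + (k ∸ j)
  rank (readHigh _ j _) = k + h + 1 + (h′ ∸ j)
  rank (test _ _) = k + h + 1
  rank (checkLow _ j _) = k + j
  rank (checkAddress j _) = j
  rank _ = 0

  data Valid : Vertex → Set where
    valid-reject : Valid reject
    valid-accept : Valid accept
    valid-readAddress : ∀ {j q} → j < k → q < 2 ^ j → Valid (readAddress j q)
    valid-readHigh : ∀ {α j q} → α < 2 ^ k → j < h′ → q < 2 ^ j → Valid (readHigh α j q)
    valid-test : ∀ {X y} → X < 2 ^ h′ → y < 2 ^ h → Valid (test X y)
    valid-checkLow : ∀ {α j q} → α < 2 ^ k → j < h → q < 2 ^ suc j → Valid (checkLow α (suc j) q)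
    valid-checkAddress : ∀ {j q} → j < k → q < 2 ^ suc j → Valid (checkAddress (suc j) q)

  readAddressList readHighList testList checkLowList checkAddressList : List Vertex
  readAddressList = tree readAddress k
  readHighList = concatBelow (λ α → tree (readHigh α) h′) (2 ^ k)
  testList = concatBelow (λ X → below (test X) (2 ^ h)) (2 ^ h′)
  checkLowList = concatBelow (λ α → btree (checkLow α) h) (2 ^ k)
  checkAddressList = btree checkAddress k

  body : List Vertex
  body = readAddressList ++ (readHighList ++ (testList ++ (checkLowList ++ checkAddressList)))

  vertices : List Vertex
  vertices = reject ∷ accept ∷ body

  valid⇒∈ : ∀ {v} → Valid v → v ∈ vertices
  valid⇒∈ valid-reject = here refl
  valid⇒∈ valid-accept = there (here refl)
  valid⇒∈ (valid-readAddress j< q<) = there (there (∈-++⁺ˡ (∈tree j< q<)))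
  valid⇒∈ (valid-readHigh α< j< q<) =
    there (there (∈-++⁺ʳ readAddressList (∈-++⁺ˡ (∈concatBelow α< (∈tree j< q<)))))
  valid⇒∈ (valid-test X< y<) =
    there (there (∈-++⁺ʳ readAddressList (∈-++⁺ʳ readHighList (∈-++⁺ˡ (∈concatBelow X< (∈below y<))))))
  valid⇒∈ (valid-checkLow α< j< q<) =
    there (there (∈-++⁺ʳ readAddressList (∈-++⁺ʳ readHighList (∈-++⁺ʳ testList
      (∈-++⁺ˡ (∈concatBelow α< (∈btree {f = checkLow _} j< q<)))))))
  valid⇒∈ (valid-checkAddress j< q<) =
    there (there (∈-++⁺ʳ readAddressList (∈-++⁺ʳ readHighList (∈-++⁺ʳ testList
      (∈-++⁺ʳ checkLowList (∈btree {f = checkAddress} j< q<))))))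

  ∈⇒valid : ∀ {v} → v ∈ vertices → Valid v
  ∈⇒valid (here refl) = valid-reject
  ∈⇒valid (there (here refl)) = valid-accept
  ∈⇒valid (there (there v∈)) = inReadAddress v∈
    where
    inCheckAddress : ∀ {v} → v ∈ checkAddressList → Valid v
    inCheckAddress v∈ with btree∈ {f = checkAddress} {D = k} v∈
    ... | j , q , j< , q< , refl = valid-checkAddress j< q<
    inCheckLow : ∀ {v} → v ∈ checkLowList ++ checkAddressList → Valid v
    inCheckLow v∈ with ∈-++⁻ checkLowList v∈
    ... | inj₂ v∈′ = inCheckAddress v∈′
    ... | inj₁ v∈′ with concatBelow∈ {f = λ α → btree (checkLow α) h} {n = 2 ^ k} v∈′
    ...   | α , α< , v∈″ with btree∈ {f = checkLow α} {D = h} v∈″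
    ...     | j , q , j< , q< , refl = valid-checkLow α< j< q<
    inTest : ∀ {v} → v ∈ testList ++ (checkLowList ++ checkAddressList) → Valid v
    inTest v∈ with ∈-++⁻ testList v∈
    ... | inj₂ v∈′ = inCheckLow v∈′
    ... | inj₁ v∈′ with concatBelow∈ {f = λ X → below (test X) (2 ^ h)} {n = 2 ^ h′} v∈′
    ...   | X , X< , v∈″ with below∈ {f = test X} {n = 2 ^ h} v∈″
    ...     | y , y< , refl = valid-test X< y<
    inReadHigh : ∀ {v} → v ∈ readHighList ++ (testList ++ (checkLowList ++ checkAddressList)) → Valid v
    inReadHigh v∈ with ∈-++⁻ readHighList v∈
    ... | inj₂ v∈′ = inTest v∈′
    ... | inj₁ v∈′ with concatBelow∈ {f = λ α → tree (readHigh α) h′} {n = 2 ^ k} v∈′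
    ...   | α , α< , v∈″ with tree∈ {f = readHigh α} {D = h′} v∈″
    ...     | j , q , j< , q< , refl = valid-readHigh α< j< q<
    inReadAddress : ∀ {v} → v ∈ body → Valid v
    inReadAddress v∈ with ∈-++⁻ readAddressList v∈
    ... | inj₂ v∈′ = inReadHigh v∈′
    ... | inj₁ v∈′ with tree∈ {f = readAddress} {D = k} v∈′
    ...   | j , q , j< , q< , refl = valid-readAddress j< q<

  ifLastBit∈ : ∀ {c q v w} → w ∈ ifLastBit c q v → w ≡ v
  ifLastBit∈ {c} {q} w∈ with b2n c ≡ᵇ q % 2
  ... | true = ∈-singleton w∈
  ... | false = ⊥-elim (∉-[] w∈)

  valid-checkAddress′ : ∀ j q → j ≤ k → q < 2 ^ j → Valid (checkAddress′ j q)
  valid-checkAddress′ zero q _ _ = valid-accept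
  valid-checkAddress′ (suc j) q j< q< = valid-checkAddress j< q<

  valid-checkLow′ : ∀ α j q → α < 2 ^ k → j ≤ h → q < 2 ^ j → Valid (checkLow′ α j q)
  valid-checkLow′ α zero q α< _ _ = valid-checkAddress′ k α ≤-refl α<
  valid-checkLow′ α (suc j) q α< j< q< = valid-checkLow α< j< q<

  valid-afterHigh : ∀ α j q w → α < 2 ^ k → j ≤ h′ → q < 2 ^ j → w ∈ afterHigh α j q → Valid w
  valid-afterHigh α j q w α< j≤ q< w∈ with j <ᵇ h′ in e
  ... | true = subst Valid (sym (∈-singleton w∈)) (valid-readHigh α< (<ᵇ-true e) q<)
  ... | false with below∈ {f = test q} {n = 2 ^ h} w∈
  ...   | y , y< , refl = valid-test (subst (λ z → q < 2 ^ z) (≤-antisym j≤ (<ᵇ-false e)) q<) y<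

  valid-afterAddress : ∀ j q w → j ≤ k → q < 2 ^ j → w ∈ afterAddress j q → Valid w
  valid-afterAddress j q w j≤ q< w∈ with j <ᵇ k in e
  ... | true = subst Valid (sym (∈-singleton w∈)) (valid-readAddress (<ᵇ-true e) q<)
  ... | false = valid-afterHigh q 0 0 w (subst (λ z → q < 2 ^ z) (≤-antisym j≤ (<ᵇ-false e)) q<) z≤n (s≤s z≤n) w∈

  valid-next : ∀ u c w → Valid u → w ∈ next u c → Valid w
  valid-next _ c w (valid-readAddress {j} {q} j< q<) w∈ with j <ᵇ k
  ... | true = valid-afterAddress (suc j) _ w j< (shiftIn< j q c q<) w∈
  ... | false = ⊥-elim (∉-[] w∈)
  valid-next _ c w (valid-readHigh {α} {j} {q} α< j< q<) w∈ with j <ᵇ h′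
  ... | true = valid-afterHigh α (suc j) _ w α< j< (shiftIn< j q c q<) w∈
  ... | false = ⊥-elim (∉-[] w∈)
  valid-next _ true w (valid-test {X} {y} X< y<) w∈ with below∈ {f = λ α → checkLow′ α h y} {n = 2 ^ k} w∈
  ... | α , α< , refl = valid-checkLow′ α h y α< ≤-refl y<
  valid-next _ c w (valid-checkLow {α} {j} {q} α< j< q<) w∈ rewrite ifLastBit∈ {c} {q} w∈ =
    valid-checkLow′ α j (q / 2) α< (<⇒≤ j<) (halve< j q q<)
  valid-next _ c w (valid-checkAddress {j} {q} j< q<) w∈ rewrite ifLastBit∈ {c} {q} w∈ =
    valid-checkAddress′ j (q / 2) (<⇒≤ j<) (halve< j q q<)

  next-closed : ∀ u c w → u ∈ vertices → w ∈ next u c → w ∈ vertices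
  next-closed u c w u∈ w∈ = valid⇒∈ (valid-next u c w (∈⇒valid u∈) w∈)

  rank-checkAddress′ : ∀ j q → rank (checkAddress′ j q) ≤ j
  rank-checkAddress′ zero q = z≤n
  rank-checkAddress′ (suc j) q = ≤-refl

  rank-checkLow′ : ∀ α j q → rank (checkLow′ α j q) ≤ k + j
  rank-checkLow′ α zero q = ≤-trans (rank-checkAddress′ k α) (m≤m+n k 0)
  rank-checkLow′ α (suc j) q = ≤-refl

  rank-afterHigh : ∀ α j q w → w ∈ afterHigh α j q → rank w ≤ k + h + 1 + (h′ ∸ j)
  rank-afterHigh α j q w w∈ with j <ᵇ h′
  ... | true rewrite ∈-singleton w∈ = ≤-refl
  ... | false with below∈ {f = test q} {n = 2 ^ h} w∈
  ...   | y , _ , refl = m≤m+n _ _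

  rank-afterAddress : ∀ j q w → w ∈ afterAddress j q → rank w ≤ rankTop + (k ∸ j)
  rank-afterAddress j q w w∈ with j <ᵇ k
  ... | true rewrite ∈-singleton w∈ = ≤-refl
  ... | false = ≤-trans (rank-afterHigh q 0 0 w w∈) (≤-trans below-top (m≤m+n rankTop _))
    where
    open +-*-Solver
    below-top : k + h + 1 + (h′ ∸ 0) ≤ rankTop
    below-top = subst (k + h + 1 + h′ ≤_)
                      (solve 3 (λ a b c → a :+ b :+ con 1 :+ c :+ con 1 := a :+ b :+ c :+ con 2) refl k h h′)
                      (m≤m+n _ 1)

  rank-next : ∀ u c w → w ∈ next u c → rank w < rank u
  rank-next (readAddress j q) c w w∈ with j <ᵇ k in e
  ... | true = ≤-<-trans (rank-afterAddress (suc j) _ w w∈) (+-monoʳ-< rankTop (∸-monoʳ-< {k} {suc j} {j} ≤-refl (<ᵇ-true {j} {k} e)))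
  ... | false = ⊥-elim (∉-[] w∈)
  rank-next (readHigh α j q) c w w∈ with j <ᵇ h′ in e
  ... | true = ≤-<-trans (rank-afterHigh α (suc j) _ w w∈) (+-monoʳ-< (k + h + 1) (∸-monoʳ-< {h′} {suc j} {j} ≤-refl (<ᵇ-true {j} {h′} e)))
  ... | false = ⊥-elim (∉-[] w∈)
  rank-next (test X y) true w w∈ with below∈ {f = λ α → checkLow′ α h y} {n = 2 ^ k} w∈
  ... | α , _ , refl = ≤-<-trans (rank-checkLow′ α h y) (m<m+n (k + h) (s≤s z≤n))
  rank-next (checkLow α (suc j) q) c w w∈ rewrite ifLastBit∈ {c} {q} w∈ =
    ≤-<-trans (rank-checkLow′ α j (q / 2)) (+-monoʳ-< k ≤-refl)
  rank-next (checkAddress (suc j) q) c w w∈ rewrite ifLastBit∈ {c} {q} w∈ = s≤s (rank-checkAddress′ j (q / 2))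

  start : Vertex
  start = readAddress 0 0

  checkAddress′≢start : ∀ j q → checkAddress′ j q ≢ start
  checkAddress′≢start zero q ()
  checkAddress′≢start (suc j) q ()

  checkLow′≢start : ∀ α j q → checkLow′ α j q ≢ start
  checkLow′≢start α zero q = checkAddress′≢start k α
  checkLow′≢start α (suc j) q ()

  afterHigh≢start : ∀ α j q w → w ∈ afterHigh α j q → w ≢ start
  afterHigh≢start α j q w w∈ with j <ᵇ h′
  ... | true rewrite ∈-singleton w∈ = λ ()
  ... | false with below∈ {f = test q} {n = 2 ^ h} w∈
  ...   | y , _ , refl = λ ()

  afterAddress≢start : ∀ j q w → w ∈ afterAddress (suc j) q → w ≢ start
  afterAddress≢start j q w w∈ with suc j <ᵇ k
  ... | true rewrite ∈-singleton w∈ = λ ()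
  ... | false = afterHigh≢start q 0 0 w w∈

  next≢start : ∀ u c w → w ∈ next u c → w ≢ start
  next≢start (readAddress j q) c w w∈ with j <ᵇ k
  ... | true = afterAddress≢start j _ w w∈
  ... | false = ⊥-elim (∉-[] w∈)
  next≢start (readHigh α j q) c w w∈ with j <ᵇ h′
  ... | true = afterHigh≢start α (suc j) _ w w∈
  ... | false = ⊥-elim (∉-[] w∈)
  next≢start (test X y) true w w∈ with below∈ {f = λ α → checkLow′ α h y} {n = 2 ^ k} w∈
  ... | α , _ , refl = checkLow′≢start α h y
  next≢start (checkLow α (suc j) q) c w w∈ rewrite ifLastBit∈ {c} {q} w∈ = checkLow′≢start α j (q / 2)
  next≢start (checkAddress (suc j) q) c w w∈ rewrite ifLastBit∈ {c} {q} w∈ = checkAddress′≢start j (q / 2)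

  machine : Machine nv
  machine = record
    { Vertex = Vertex
    ; _≟V_ = decEq-via-code code uncode uncode-code
    ; vertices = vertices
    ; start = start ; reject = reject ; accept = accept
    ; reject≢accept = λ ()
    ; start≢reject = λ ()
    ; label = label
    ; next = next
    ; next-reject = λ c → refl
    ; next-accept = λ c → refl
    ; rank = rank
    ; rank-next = rank-next
    ; start∈ = valid⇒∈ (valid-readAddress k>0 (s≤s z≤n))
    ; reject∈ = here refl
    ; accept∈ = there (here refl)
    ; next-closed = next-closed
    ; next≢start = next≢start }

  module Semantics (x : Fin nv → Bool) where
    open ReachesProperties machine

    R : Vertex → Set
    R = Reaches machine x

    A : ℕ
    A = bigEndian x 0 k

    A< : A < 2 ^ k
    A< = bigEndian< x 0 k

    pointerA : ℕ
    pointerA = k + ℓ * A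

    ifLastBit-sem : ∀ c q w → Any R (ifLastBit c q w) ⇔ ((b2n c ≡ q % 2) × R w)
    ifLastBit-sem c q w with b2n c ≡ᵇ q % 2 in e
    ... | true = any-singleton ⟨⇔⟩ mk⇔ (λ r → ≡ᵇ-true e , r) proj₂
    ... | false = mk⇔ (λ ()) (λ (e′ , _) → ⊥-elim (≡ᵇ-false e e′))

    checkAddress-sem : ∀ j q → j ≤ k → q < 2 ^ j → R (checkAddress′ j q) ⇔ ((bigEndian x 0 j ≡ q) × ⊤)
    checkAddress-sem = backwardTree x 0 k (λ j q → R (checkAddress′ j q)) ⊤ (mk⇔ (λ _ → tt) (λ _ → done)) advance
      where
      advance : ∀ j q → j < k → R (checkAddress′ (suc j) q) ⇔
                ((b2n (bitAt x j) ≡ q % 2) × R (checkAddress′ j (q / 2)))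
      advance j q j< =
        reaches-query x (checkAddress (suc j) q) (λ c → ifLastBit c q (checkAddress′ j (q / 2))) _ (λ ())
                      (λ c → refl) (varAt-bitAt nv>0 x j (address<nv j j<))
        ⟨⇔⟩ ifLastBit-sem _ q _

    checkLow-sem : ∀ α → α < 2 ^ k → ∀ j q → j ≤ h → q < 2 ^ j →
                   R (checkLow′ α j q) ⇔ ((bigEndian x (k + ℓ * α + h′) j ≡ q) × ((A ≡ α) × ⊤))
    checkLow-sem α α< =
      backwardTree x (k + ℓ * α + h′) h (λ j q → R (checkLow′ α j q)) ((A ≡ α) × ⊤)
                   (checkAddress-sem k α ≤-refl α<) advance
      where
      advance : ∀ j q → j < h → R (checkLow′ α (suc j) q) ⇔
                ((b2n (bitAt x (k + ℓ * α + h′ + j)) ≡ q % 2) × R (checkLow′ α j (q / 2)))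
      advance j q j< =
        reaches-query x (checkLow α (suc j) q) (λ c → ifLastBit c q (checkLow′ α j (q / 2))) _ (λ ())
                      (λ c → refl)
                      (varAt-bitAt nv>0 x _ (pointer<nv′ α h′ j α< (subst (h′ + j <_) h′+h (+-monoʳ-< h′ j<))))
        ⟨⇔⟩ ifLastBit-sem _ q _

    checkLow-address : ∀ α y → α < 2 ^ k → y < 2 ^ h → R (checkLow′ α h y) → A ≡ α
    checkLow-address α y α< y< r = proj₁ (proj₂ (Equivalence.to (checkLow-sem α α< h y ≤-refl y<) r))

    Y : ℕ
    Y = bigEndian x (pointerA + h′) h

    test-step : ∀ X y → R (test X y) ⇔
                ((x (label (test X y)) ≡ true) × (Σ ℕ λ α → α < 2 ^ k × R (checkLow′ α h y)))
    test-step X y = reaches-next x (test X y) (λ ()) ⟨⇔⟩ onValue (x (label (test X y)))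
      where
      onValue : ∀ c → Any R (if c then below (λ α → checkLow′ α h y) (2 ^ k) else []) ⇔
                ((c ≡ true) × (Σ ℕ λ α → α < 2 ^ k × R (checkLow′ α h y)))
      onValue true = any-below R (λ α → checkLow′ α h y) (2 ^ k) ⟨⇔⟩ mk⇔ (λ p → refl , p) proj₂
      onValue false = mk⇔ (λ ()) (λ { (() , _) })

    test-sem : ∀ X y → X < 2 ^ h′ → y < 2 ^ h →
               R (test X y) ⇔ ((bitAt x (k + ℓ * 2 ^ k + (X * 2 ^ h + y)) ≡ true) × (Y ≡ y))
    test-sem X y X< y< =
      test-step X y ⟨⇔⟩
      (≡⇒⇔ (cong (_≡ true) (varAt-bitAt nv>0 x _ (data<nv _ β<))) ×-⇔
       mk⇔ (λ (α , α< , r) → subst (λ z → bigEndian x (k + ℓ * z + h′) h ≡ y) (sym (checkLow-address α y α< y< r))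
                                   (proj₁ (Equivalence.to (checkLow-sem α α< h y ≤-refl y<) r)))
           (λ e → A , A< , Equivalence.from (checkLow-sem A A< h y ≤-refl y<) (e , refl , tt)))
      where
      β< : X * 2 ^ h + y < 2 ^ ℓ
      β< = subst (λ z → X * 2 ^ h + y < 2 ^ z) h′+h (digits< h′ h X y X< y<)

    test-low : ∀ X y → y < 2 ^ h → R (test X y) → Y ≡ y
    test-low X y y< r with Equivalence.to (test-step X y) r
    ... | _ , α , α< , rα with checkLow-address α y α< y< rα
    ...   | refl = proj₁ (Equivalence.to (checkLow-sem A A< h y ≤-refl y<) rα)

    X : ℕ
    X = bigEndian x pointerA h′

    tests-sem : Any R (afterHigh A h′ X) ⇔ (bitAt x (k + ℓ * 2 ^ k + (X * 2 ^ h + Y)) ≡ true)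
    tests-sem rewrite n<ᵇn h′ =
      any-below R (test X) (2 ^ h) ⟨⇔⟩
      mk⇔ (λ (y , y< , r) → let (b , e) = Equivalence.to (test-sem X y X< y<) r
                            in subst (λ z → bitAt x (k + ℓ * 2 ^ k + (X * 2 ^ h + z)) ≡ true) (sym e) b)
          (λ b → Y , Y< , Equivalence.from (test-sem X Y X< Y<) (b , refl))
      where
      X< = bigEndian< x pointerA h′
      Y< = bigEndian< x (pointerA + h′) h

    readHigh-sem : Any R (afterHigh A 0 0) ⇔ Any R (afterHigh A h′ X)
    readHigh-sem = forwardTree x pointerA h′ (λ j q → Any R (afterHigh A j q)) advance
      where
      advance : ∀ j q → j < h′ → Any R (afterHigh A j q) ⇔
                Any R (afterHigh A (suc j) (2 * q + b2n (bitAt x (pointerA + j))))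
      advance j q j< with j <ᵇ h′ in e
      ... | false = ⊥-elim (<⇒≱ j< (<ᵇ-false e))
      ... | true = any-singleton ⟨⇔⟩
        reaches-query x (readHigh A j q) (λ c → afterHigh A (suc j) (2 * q + b2n c)) _ (λ ())
                      (λ c → cong (λ b → if b then afterHigh A (suc j) (2 * q + b2n c) else []) e)
                      (varAt-bitAt nv>0 x _ (pointer<nv A j A< (≤-trans j< h′≤ℓ)))

    readAddress-sem : Any R (afterAddress 0 0) ⇔ Any R (afterAddress k A)
    readAddress-sem = forwardTree x 0 k (λ j q → Any R (afterAddress j q)) advance
      where
      advance : ∀ j q → j < k → Any R (afterAddress j q) ⇔ Any R (afterAddress (suc j) (2 * q + b2n (bitAt x j)))
      advance j q j< with j <ᵇ k in e
      ... | false = ⊥-elim (<⇒≱ j< (<ᵇ-false e))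
      ... | true = any-singleton ⟨⇔⟩
        reaches-query x (readAddress j q) (λ c → afterAddress (suc j) (2 * q + b2n c)) _ (λ ())
                      (λ c → cong (λ b → if b then afterAddress (suc j) (2 * q + b2n c) else []) e)
                      (varAt-bitAt nv>0 x j (address<nv j j<))

    start-sem : R start ⇔ (ISA k ℓ x ≡ true)
    start-sem =
      ⇔-sym any-singleton ⟨⇔⟩
      ≡⇒⇔ (cong (λ b → Any R (if b then start ∷ [] else afterHigh 0 0 0)) (sym (<⇒<ᵇ-true k>0))) ⟨⇔⟩
      readAddress-sem ⟨⇔⟩
      ≡⇒⇔ (cong (λ b → Any R (if b then readAddress k A ∷ [] else afterHigh A 0 0)) (n<ᵇn k)) ⟨⇔⟩
      readHigh-sem ⟨⇔⟩ tests-sem ⟨⇔⟩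
      ≡⇒⇔ (cong (λ z → bitAt x (k + ℓ * 2 ^ k + z) ≡ true) (sym pointer-split))
      where
      pointer-split : bigEndian x pointerA ℓ ≡ X * 2 ^ h + Y
      pointer-split = trans (cong (bigEndian x pointerA) (sym h′+h)) (bigEndian-split x pointerA h′ h)

    singleton-unique : ∀ {v w w′ : Vertex} → w ∈ v ∷ [] → w′ ∈ v ∷ [] → w ≡ w′
    singleton-unique w∈ w′∈ = trans (∈-singleton w∈) (sym (∈-singleton w′∈))

    tests-unique : ∀ X w w′ → w ∈ below (test X) (2 ^ h) → w′ ∈ below (test X) (2 ^ h) → R w → R w′ → w ≡ w′
    tests-unique X w w′ w∈ w′∈ r r′
      with below∈ {f = test X} {n = 2 ^ h} w∈ | below∈ {f = test X} {n = 2 ^ h} w′∈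
    ... | y , y< , refl | y′ , y′< , refl = cong (test X) (trans (sym (test-low X y y< r)) (test-low X y′ y′< r′))

    afterHigh-unique : ∀ α j q w w′ → w ∈ afterHigh α j q → w′ ∈ afterHigh α j q → R w → R w′ → w ≡ w′
    afterHigh-unique α j q w w′ w∈ w′∈ r r′ with j <ᵇ h′
    ... | true = singleton-unique w∈ w′∈
    ... | false = tests-unique q w w′ w∈ w′∈ r r′

    afterAddress-unique : ∀ j q w w′ → w ∈ afterAddress j q → w′ ∈ afterAddress j q → R w → R w′ → w ≡ w′
    afterAddress-unique j q w w′ w∈ w′∈ r r′ with j <ᵇ k
    ... | true = singleton-unique w∈ w′∈
    ... | false = afterHigh-unique q 0 0 w w′ w∈ w′∈ r r′

    -- Successors reaching acceptance: the guessed low part y and the guessed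
    -- address are determined by the input.
    next-unique : ∀ u c w w′ → Valid u → w ∈ next u c → w′ ∈ next u c → R w → R w′ → w ≡ w′
    next-unique _ c w w′ (valid-readAddress {j} {q} _ _) w∈ w′∈ r r′ with j <ᵇ k
    ... | true = afterAddress-unique (suc j) _ w w′ w∈ w′∈ r r′
    ... | false = ⊥-elim (∉-[] w∈)
    next-unique _ c w w′ (valid-readHigh {α} {j} {q} _ _ _) w∈ w′∈ r r′ with j <ᵇ h′
    ... | true = afterHigh-unique α (suc j) _ w w′ w∈ w′∈ r r′
    ... | false = ⊥-elim (∉-[] w∈)
    next-unique _ true w w′ (valid-test {_} {y} _ y<) w∈ w′∈ r r′
      with below∈ {f = λ α → checkLow′ α h y} {n = 2 ^ k} w∈ | below∈ {f = λ α → checkLow′ α h y} {n = 2 ^ k} w′∈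
    ... | α , α< , refl | α′ , α′< , refl =
      cong (λ z → checkLow′ z h y) (trans (sym (checkLow-address α y α< y< r)) (checkLow-address α′ y α′< y< r′))
    next-unique _ c w w′ (valid-checkLow {q = q} _ _ _) w∈ w′∈ r r′ =
      trans (ifLastBit∈ {c} {q} w∈) (sym (ifLastBit∈ {c} {q} w′∈))
    next-unique _ c w w′ (valid-checkAddress {q = q} _ _) w∈ w′∈ r r′ =
      trans (ifLastBit∈ {c} {q} w∈) (sym (ifLastBit∈ {c} {q} w′∈))

    unambiguous : ∀ u w w′ → u ∈ vertices → w ∈ next u (x (label u)) → w′ ∈ next u (x (label u)) →
                  R w → R w′ → w ≡ w′
    unambiguous u w w′ u∈ = next-unique u (x (label u)) w w′ (∈⇒valid u∈)

  -- Size: 2^k − 1 address vertices, 2^k (2^h′ − 1) high-part vertices, 2^ℓ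
  -- test vertices, 2^k (2^(h+1) − 2) low-part checks and 2^(k+1) − 2 address
  -- checks.
  length-body : length body + 3 ≡ 2 ^ ℓ + 2 ^ k * (2 ^ h′ + 2 ^ suc h)
  length-body = begin
    length body + 3
      ≡⟨ cong (_+ 3) (trans (length-++ readAddressList) (cong (a +_) (trans (length-++ readHighList)
           (cong (length readHighList +_) (trans (length-++ testList) (cong (length testList +_) (length-++ checkLowList))))))) ⟩
    a + (length readHighList + (length testList + (length checkLowList + c))) + 3
      ≡⟨ cong₃ (λ u t v → a + (u + (t + (v + c))) + 3) readHigh# test# checkLow# ⟩
    a + ((a + 1) * T + (2 ^ ℓ + ((a + 1) * B + c))) + 3
      ≡⟨ cong (λ z → a + ((a + 1) * T + (2 ^ ℓ + ((a + 1) * B + z))) + 3) checkAddress# ⟩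
    a + ((a + 1) * T + (2 ^ ℓ + ((a + 1) * B + 2 * a))) + 3
      ≡⟨ solve 4 (λ a T L B → a :+ ((a :+ con 1) :* T :+ (L :+ ((a :+ con 1) :* B :+ con 2 :* a))) :+ con 3
                            := L :+ (a :+ con 1) :* ((T :+ con 1) :+ (B :+ con 2))) refl a T (2 ^ ℓ) B ⟩
    2 ^ ℓ + (a + 1) * ((T + 1) + (B + 2))
      ≡⟨ cong₂ (λ u v → 2 ^ ℓ + u * v) address# (cong₂ _+_ (length-tree (readHigh 0) h′) (length-btree (checkLow 0) h)) ⟩
    2 ^ ℓ + 2 ^ k * (2 ^ h′ + 2 ^ suc h) ∎
    where
    open ≡-Reasoning
    open +-*-Solver
    cong₃ : ∀ (f : ℕ → ℕ → ℕ → ℕ) {u u′ t t′ v v′} → u ≡ u′ → t ≡ t′ → v ≡ v′ → f u t v ≡ f u′ t′ v′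
    cong₃ f refl refl refl = refl
    a = length readAddressList
    c = length checkAddressList
    T = length (tree (readHigh 0) h′)
    B = length (btree (checkLow 0) h)
    address# : a + 1 ≡ 2 ^ k
    address# = length-tree readAddress k
    readHigh# : length readHighList ≡ (a + 1) * T
    readHigh# = trans (length-concatBelow-const (λ α → tree (readHigh α) h′) (2 ^ k) T
                         (λ α → +-cancelʳ-≡ 1 _ _ (trans (length-tree (readHigh α) h′) (sym (length-tree (readHigh 0) h′)))))
                      (cong (_* T) (sym address#))
    test# : length testList ≡ 2 ^ ℓ
    test# = trans (length-concatBelow-const (λ X → below (test X) (2 ^ h)) (2 ^ h′) (2 ^ h) (λ X → length-below (test X) (2 ^ h)))
                  (trans (sym (^-distribˡ-+-* 2 h′ h)) (cong (2 ^_) h′+h))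
    checkLow# : length checkLowList ≡ (a + 1) * B
    checkLow# = trans (length-concatBelow-const (λ α → btree (checkLow α) h) (2 ^ k) B
                         (λ α → +-cancelʳ-≡ 2 _ _ (trans (length-btree (checkLow α) h) (sym (length-btree (checkLow 0) h)))))
                      (cong (_* B) (sym address#))
    checkAddress# : c ≡ 2 * a
    checkAddress# = +-cancelʳ-≡ 2 _ _ (trans (length-btree checkAddress k)
                      (trans (cong (2 *_) (sym address#)) (solve 1 (λ a → con 2 :* (a :+ con 1) := con 2 :* a :+ con 2) refl a)))

  h′≡h+ℓ%2 : h′ ≡ h + ℓ % 2
  h′≡h+ℓ%2 = begin
    ℓ ∸ h                  ≡⟨ cong (_∸ h) (m≡m%n+[m/n]*n ℓ 2) ⟩
    ℓ % 2 + h * 2 ∸ h      ≡⟨ cong (_∸ h) (solve 2 (λ r h → r :+ h :* con 2 := r :+ h :+ h) refl (ℓ % 2) h) ⟩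
    ℓ % 2 + h + h ∸ h      ≡⟨ m+n∸n≡m (ℓ % 2 + h) h ⟩
    ℓ % 2 + h              ≡⟨ +-comm (ℓ % 2) h ⟩
    h + ℓ % 2              ∎
    where
    open ≡-Reasoning
    open +-*-Solver

  -- (2^h′ + 2^(h+1))² ≤ 9 2^ℓ, i.e. 2^h′ + 2^(h+1) ≤ 3 2^(ℓ/2).
  stages² : (2 ^ h′ + 2 ^ suc h) ^ 2 ≤ 9 * 2 ^ ℓ
  stages² = subst₂ (λ u v → (u + 2 ^ suc h) ^ 2 ≤ 9 * 2 ^ v)
                   (sym (trans (cong (2 ^_) h′≡h+ℓ%2) (^-distribˡ-+-* 2 h (ℓ % 2))))
                   (trans (cong (_+ h) (sym h′≡h+ℓ%2)) (trans (+-comm h′ h) (trans (+-comm h h′) h′+h)))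
                   (byParity (ℓ % 2) (m<1+n⇒m≤n (m%n<n ℓ 2)))
    where
    open +-*-Solver
    u = 2 ^ h
    byParity : ∀ r → r ≤ 1 → (u * 2 ^ r + 2 ^ suc h) ^ 2 ≤ 9 * 2 ^ (h + r + h)
    byParity zero _ = ≤-reflexive (begin-equality
      (u * 1 + 2 * u) ^ 2     ≡⟨ solve 1 (λ u → (u :* con 1 :+ con 2 :* u) :^ 2 := con 9 :* (u :* u)) refl u ⟩
      9 * (u * u)             ≡⟨ cong (9 *_) (sym (^-distribˡ-+-* 2 h h)) ⟩
      9 * 2 ^ (h + h)         ≡⟨ cong (λ z → 9 * 2 ^ (z + h)) (sym (+-identityʳ h)) ⟩
      9 * 2 ^ (h + 0 + h)     ∎)
      where open ≤-Reasoning
    byParity (suc zero) _ = begin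
      (u * 2 + 2 * u) ^ 2     ≡⟨ solve 1 (λ u → (u :* con 2 :+ con 2 :* u) :^ 2 := con 16 :* (u :* u)) refl u ⟩
      16 * (u * u)            ≤⟨ *-monoˡ-≤ (u * u) (m≤m+n 16 2) ⟩
      18 * (u * u)            ≡⟨ solve 1 (λ u → con 18 :* (u :* u) := con 9 :* ((u :* con 2) :* u)) refl u ⟩
      9 * ((u * 2 ^ 1) * u)   ≡⟨ cong (λ z → 9 * (z * u)) (sym (^-distribˡ-+-* 2 h 1)) ⟩
      9 * (2 ^ (h + 1) * u)   ≡⟨ cong (9 *_) (sym (^-distribˡ-+-* 2 (h + 1) h)) ⟩
      9 * 2 ^ (h + 1 + h)     ∎
      where open ≤-Reasoning
    byParity (suc (suc _)) (s≤s ())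

  size-bound : (length body ∸ 2 ^ ℓ) ^ 2 ≤ 9 * 2 ^ (2 * k) * 2 ^ ℓ
  size-bound = begin
    (length body ∸ 2 ^ ℓ) ^ 2         ≤⟨ ^-monoˡ-≤ 2 excess ⟩
    (2 ^ k * F) ^ 2                   ≡⟨ solve 2 (λ K F → (K :* F) :^ 2 := (K :* K) :* F :^ 2) refl (2 ^ k) F ⟩
    (2 ^ k * 2 ^ k) * F ^ 2           ≤⟨ *-monoʳ-≤ (2 ^ k * 2 ^ k) stages² ⟩
    (2 ^ k * 2 ^ k) * (9 * 2 ^ ℓ)     ≡⟨ solve 2 (λ K L → K :* (con 9 :* L) := con 9 :* K :* L) refl (2 ^ k * 2 ^ k) (2 ^ ℓ) ⟩
    9 * (2 ^ k * 2 ^ k) * 2 ^ ℓ       ≡⟨ cong (λ z → 9 * z * 2 ^ ℓ) (trans (sym (^-distribˡ-+-* 2 k k)) (cong (λ z → 2 ^ (k + z)) (sym (+-identityʳ k)))) ⟩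
    9 * 2 ^ (2 * k) * 2 ^ ℓ           ∎
    where
    open ≤-Reasoning
    open +-*-Solver
    F = 2 ^ h′ + 2 ^ suc h
    excess : length body ∸ 2 ^ ℓ ≤ 2 ^ k * F
    excess = subst (length body ∸ 2 ^ ℓ ≤_) (m+n∸m≡n (2 ^ ℓ) (2 ^ k * F))
               (∸-monoˡ-≤ (2 ^ ℓ) (subst (length body ≤_) length-body (m≤m+n _ 3)))

  open Compiled machine using (program; accepts⇔; module Unambiguous)

  nbp : HasNBP (ISA k ℓ) (λ m → (m ∸ 2 ^ ℓ) ^ 2 ≤ 9 * 2 ^ (2 * k) * 2 ^ ℓ)
  nbp = program , (λ a → ⇔-sym (Semantics.start-sem a) ⟨⇔⟩ ⇔-sym (accepts⇔ a)) , size-bound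

  ⊕bp : Has⊕BP (ISA k ℓ) (λ m → (m ∸ 2 ^ ℓ) ^ 2 ≤ 9 * 2 ^ (2 * k) * 2 ^ ℓ)
  ⊕bp = program ,
        (λ a → ⇔-sym (Semantics.start-sem a) ⟨⇔⟩ ⇔-sym (Unambiguous.oddPaths⇔ a (Semantics.unambiguous a))) ,
        size-bound

-- With the pointer split into γ high bits and d = ℓ − γ low
-- bits and formulas g 0, …, g (γ-1) standing for the high bits,
--   Φ = Check ∧ Select,
--   Check  = mux over the address of "pointer α begins with g 0 … g (γ-1)",
--   Select = mux over the d low pointer bits (each itself a mux over the
--            address) of the mux over g of the data bits.
-- For δ guess bits, g i is guess variable i and γ = min(δ, ℓ); for a
-- deterministic formula γ = 0 and Φ is replaced by Select.
module Formulas (k ℓ : ℕ) (ℓ>0 : 0 < ℓ) where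

  open import Data.Nat using (z≤n)
  open import Data.Nat.Properties
  open import Data.Bool using (Bool; true; false; _∧_)
  open import Data.Fin using (Fin; toℕ)
  open import Data.Fin.Properties using (toℕ-fromℕ<)
  import Data.Vec.Functional as VF
  open import Data.Product using (Σ; _,_; proj₂)
  open import Data.Sum using (inj₁; inj₂)
  open import Relation.Binary.PropositionalEquality
  open import Function.Bundles using (_⇔_; mk⇔; Equivalence)
  open import Data.Nat.Solver using (module +-*-Solver)
  open Prelude
  open BigEndian
  open FormulaKit
  open Layout k ℓ

  module Build (n : ℕ) (nv≤n : nv ≤ n) (γ d : ℕ) (γ+d : γ + d ≡ ℓ)
               (g : ℕ → BF n) (size-g : ∀ i → sizeBF (g i) ≤ 1) where

    bit : ℕ → BF n
    bit p = pos (varAt (≤-trans nv>0 nv≤n) p)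

    agrees : ℕ → BF n
    agrees α = conj γ (λ i → equiv (bit (k + ℓ * α + i)) (g i))

    Check : BF n
    Check = mux bit k agrees

    lowBit : ℕ → BF n
    lowBit j = mux bit k (λ α → bit (k + ℓ * α + γ + j))

    dataBit : ℕ → BF n
    dataBit L = mux g γ (λ H → bit (k + ℓ * 2 ^ k + (H * 2 ^ d + L)))

    Select : BF n
    Select = mux lowBit d dataBit

    Φ : BF n
    Φ = node _∧_ Check Select

    γ≤ℓ : γ ≤ ℓ
    γ≤ℓ = subst (γ ≤_) γ+d (m≤m+n γ d)

    module Semantics (a : Fin nv → Bool) (x : Fin n → Bool) (extends : ∀ p → p < nv → bitAt x p ≡ bitAt a p) where

      eval-bit : ∀ p → p < nv → evalBF (bit p) x ≡ bitAt a p
      eval-bit p p< = trans (varAt-bitAt _ x p (≤-trans p< nv≤n)) (extends p p<)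

      A : ℕ
      A = bigEndian a 0 k

      A< : A < 2 ^ k
      A< = bigEndian< a 0 k

      pointerA : ℕ
      pointerA = k + ℓ * A

      selected-address : selected bit k x ≡ A
      selected-address =
        trans (selected-bigEndian bit k x 0 (λ i i< → cong b2n (varAt-bitAt _ x i (≤-trans (address<nv i i<) nv≤n))))
              (bigEndian-agree x a extends 0 k (≤-trans (m≤m+n k _) (m≤m+n _ _)))

      Low : ℕ
      Low = bigEndian a (pointerA + γ) d

      lowEnd : pointerA + γ + d ≤ nv
      lowEnd = subst (_≤ nv) (trans (cong (pointerA +_) (sym γ+d)) (sym (+-assoc pointerA γ d))) (pointerEnd A A<)

      selected-low : selected lowBit d x ≡ Low
      selected-low = trans (selected-bigEndian lowBit d x (pointerA + γ) reads)
                           (bigEndian-agree x a extends (pointerA + γ) d lowEnd)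
        where
        reads : ∀ j → j < d → b2n (evalBF (lowBit j) x) ≡ b2n (bitAt x (pointerA + γ + j))
        reads j j< = cong b2n (trans (eval-mux bit k (λ α → bit (k + ℓ * α + γ + j)) x)
                     (trans (cong (λ z → evalBF (bit (k + ℓ * z + γ + j)) x) selected-address)
                            (varAt-bitAt _ x _ (≤-trans (pointer<nv′ A γ j A< (subst (γ + j <_) γ+d (+-monoʳ-< γ j<))) nv≤n))))

      G : ℕ
      G = selected g γ x

      dataPosition : ℕ
      dataPosition = k + ℓ * 2 ^ k + (G * 2 ^ d + Low)

      eval-Select : evalBF Select x ≡ bitAt a dataPosition
      eval-Select =
        trans (eval-mux lowBit d dataBit x)
        (trans (cong (λ z → evalBF (dataBit z) x) selected-low)
        (trans (eval-mux g γ (λ H → bit (k + ℓ * 2 ^ k + (H * 2 ^ d + Low))) x)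
               (eval-bit _ (data<nv _ (subst (λ z → G * 2 ^ d + Low < 2 ^ z) γ+d
                                               (digits< γ d G Low (selected< g γ x) (bigEndian< a (pointerA + γ) d)))))))

      eval-Check : evalBF Check x ≡ evalBF (agrees A) x
      eval-Check = trans (eval-mux bit k agrees x) (cong (λ z → evalBF (agrees z) x) selected-address)

      Agree : Set
      Agree = ∀ i → i < γ → bitAt a (pointerA + i) ≡ evalBF (g i) x

      agrees-sem : (evalBF (agrees A) x ≡ true) ⇔ Agree
      agrees-sem =
        eval-conj γ (λ i → equiv (bit (pointerA + i)) (g i)) x ⟨⇔⟩
        mk⇔ (λ h i i< → trans (sym (eval-bit _ (high< i i<))) (Equivalence.to (eval-equiv (bit (pointerA + i)) (g i) x) (h i i<)))
            (λ h i i< → Equivalence.from (eval-equiv (bit (pointerA + i)) (g i) x) (trans (eval-bit _ (high< i i<)) (h i i<)))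
        where
        high< : ∀ i → i < γ → pointerA + i < nv
        high< i i< = pointer<nv A i A< (≤-trans i< γ≤ℓ)

      G-high : Agree → G ≡ bigEndian a pointerA γ
      G-high agree =
        trans (selected-bigEndian g γ x pointerA
                 (λ i i< → cong b2n (trans (sym (agree i i<)) (sym (extends (pointerA + i) (pointer<nv A i A< (≤-trans i< γ≤ℓ)))))))
              (bigEndian-agree x a extends pointerA γ (≤-trans (m≤m+n (pointerA + γ) d) lowEnd))

      dataPosition-ISA : G ≡ bigEndian a pointerA γ → bitAt a dataPosition ≡ ISA k ℓ a
      dataPosition-ISA e =
        cong (λ z → bitAt a (k + ℓ * 2 ^ k + z))
             (trans (cong (λ z → z * 2 ^ d + Low) e)
                    (trans (sym (bigEndian-split a pointerA γ d)) (cong (bigEndian a pointerA) γ+d)))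

      Φ-sem : (evalBF Φ x ≡ true) ⇔ (Agree × ISA k ℓ a ≡ true)
      Φ-sem = mk⇔ to from
        where
        to : evalBF Φ x ≡ true → Agree × ISA k ℓ a ≡ true
        to e with ∧-true {evalBF Check x} e
        ... | check , select =
          let agree = Equivalence.to agrees-sem (trans (sym eval-Check) check)
          in agree , trans (sym (dataPosition-ISA (G-high agree))) (trans (sym eval-Select) select)
        from : Agree × ISA k ℓ a ≡ true → evalBF Φ x ≡ true
        from (agree , e)
          rewrite eval-Check | Equivalence.from agrees-sem agree | eval-Select | dataPosition-ISA (G-high agree) = e

      Select-sem : γ ≡ 0 → evalBF Select x ≡ ISA k ℓ a
      Select-sem refl = trans eval-Select (dataPosition-ISA refl)

    size-agrees : ∀ α → sizeBF (agrees α) ≤ γ * 2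
    size-agrees α = size-conj γ _ 2 (λ i → +-monoʳ-≤ 1 (size-g i))

    size-Check : sizeBF Check + 2 * 1 ≤ (2 * 1 + γ * 2) * 2 ^ k
    size-Check = size-mux bit k agrees 1 (γ * 2) (λ i → ≤-refl) size-agrees

    size-lowBit : ∀ j → sizeBF (lowBit j) ≤ 3 * 2 ^ k
    size-lowBit j = ≤-trans (m≤m+n _ 2) (size-mux bit k _ 1 1 (λ i → ≤-refl) (λ c → ≤-refl))

    size-dataBit : ∀ L → sizeBF (dataBit L) ≤ 3 * 2 ^ γ ∸ 2
    size-dataBit L = subst (_≤ 3 * 2 ^ γ ∸ 2) (m+n∸n≡m _ 2) (∸-monoˡ-≤ 2 (size-mux g γ _ 1 1 size-g (λ c → ≤-refl)))

    size-Select : sizeBF Select ≤ (2 * (3 * 2 ^ k) + (3 * 2 ^ γ ∸ 2)) * 2 ^ d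
    size-Select = ≤-trans (m≤m+n _ _) (size-mux lowBit d dataBit (3 * 2 ^ k) (3 * 2 ^ γ ∸ 2) size-lowBit size-dataBit)

  bf : HasBF (ISA k ℓ) (λ m → m ≤ 7 * 2 ^ k * 2 ^ ℓ)
  bf = Select , (λ a → Semantics.Select-sem a a (λ _ _ → refl) refl) , bound
    where
    open Build nv ≤-refl 0 ℓ refl (λ _ → const false) (λ _ → z≤n)
    open +-*-Solver
    open ≤-Reasoning
    bound : sizeBF Select ≤ 7 * 2 ^ k * 2 ^ ℓ
    bound = ≤-trans size-Select (*-monoˡ-≤ (2 ^ ℓ) (begin
      2 * (3 * 2 ^ k) + 1        ≤⟨ +-monoʳ-≤ (2 * (3 * 2 ^ k)) (m^n>0 2 k) ⟩
      2 * (3 * 2 ^ k) + 2 ^ k    ≡⟨ solve 1 (λ K → con 2 :* (con 3 :* K) :+ K := con 7 :* K) refl (2 ^ k) ⟩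
      7 * 2 ^ k                  ∎))

  -- Part (4): the g's are the first γ = min(δ, ℓ) guess variables.
  lnbf : ∀ δ → HasLNBF δ (ISA k ℓ) (λ m → m ≤ 12 * 2 ^ k * (2 ^ (ℓ ∸ δ) ⊔ ℓ) + 3 * 2 ^ ℓ)
  lnbf δ = Φ , computes , bound
    where
    d = ℓ ∸ δ
    γ = ℓ ∸ d
    γ+d : γ + d ≡ ℓ
    γ+d = m∸n+n≡m (m∸n≤m ℓ δ)
    γ≤δ : γ ≤ δ
    γ≤δ with ≤-total δ ℓ
    ... | inj₁ δ≤ℓ = ≤-reflexive (m∸[m∸n]≡n δ≤ℓ)
    ... | inj₂ ℓ≤δ = ≤-trans (m∸n≤m ℓ d) ℓ≤δ
    guess : ℕ → BF (nv + δ)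
    guess i = pos (varAt (≤-trans nv>0 (m≤m+n nv δ)) (nv + i))
    open Build (nv + δ) (m≤m+n nv δ) γ d γ+d guess (λ _ → ≤-refl)
    computes : ∀ a → (ISA k ℓ a ≡ true) ⇔ (Σ (Fin δ → Bool) λ b → evalBF Φ (a VF.++ b) ≡ true)
    computes a = mk⇔ to from
      where
      from : (Σ (Fin δ → Bool) λ b → evalBF Φ (a VF.++ b) ≡ true) → ISA k ℓ a ≡ true
      from (b , e) = proj₂ (Equivalence.to (Semantics.Φ-sem a (a VF.++ b) (bitAt-++ˡ a b)) e)
      pointerA = k + ℓ * bigEndian a 0 k
      -- guess the pointer bits themselves
      b : Fin δ → Bool
      b i = bitAt a (pointerA + toℕ i)
      to : ISA k ℓ a ≡ true → Σ (Fin δ → Bool) λ b → evalBF Φ (a VF.++ b) ≡ true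
      to e = b , Equivalence.from (Semantics.Φ-sem a (a VF.++ b) (bitAt-++ˡ a b)) (agree , e)
        where
        agree : ∀ i → i < γ → bitAt a (pointerA + i) ≡ evalBF (guess i) (a VF.++ b)
        agree i i< = sym (trans (varAt-bitAt _ (a VF.++ b) (nv + i) (+-monoʳ-< nv i<δ))
                         (trans (bitAt-++ʳ a b i i<δ) (cong (λ z → bitAt a (pointerA + z)) (toℕ-fromℕ< i<δ))))
          where
          i<δ : i < δ
          i<δ = ≤-trans i< γ≤δ
    open +-*-Solver
    M = 2 ^ d ⊔ ℓ
    bound : sizeBF Φ ≤ 12 * 2 ^ k * M + 3 * 2 ^ ℓ
    bound = begin
      sizeBF Check + sizeBF Select
        ≤⟨ +-mono-≤ (≤-trans (m≤m+n _ 2) size-Check) size-Select ⟩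
      (2 * 1 + γ * 2) * 2 ^ k + (2 * (3 * 2 ^ k) + (3 * 2 ^ γ ∸ 2)) * 2 ^ d
        ≤⟨ +-monoʳ-≤ ((2 * 1 + γ * 2) * 2 ^ k) (*-monoˡ-≤ (2 ^ d) (+-monoʳ-≤ (2 * (3 * 2 ^ k)) (m∸n≤m (3 * 2 ^ γ) 2))) ⟩
      (2 * 1 + γ * 2) * 2 ^ k + (2 * (3 * 2 ^ k) + 3 * 2 ^ γ) * 2 ^ d
        ≡⟨ solve 4 (λ g K P Q → (con 2 :* con 1 :+ g :* con 2) :* K :+ (con 2 :* (con 3 :* K) :+ con 3 :* Q) :* P
                                := K :* (con 2 :+ con 2 :* g :+ con 6 :* P) :+ con 3 :* (Q :* P)) refl γ (2 ^ k) (2 ^ d) (2 ^ γ) ⟩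
      2 ^ k * (2 + 2 * γ + 6 * 2 ^ d) + 3 * (2 ^ γ * 2 ^ d)
        ≤⟨ +-mono-≤ (*-monoʳ-≤ (2 ^ k) perAddress) (≤-reflexive (cong (3 *_) (trans (sym (^-distribˡ-+-* 2 γ d)) (cong (2 ^_) γ+d)))) ⟩
      2 ^ k * (12 * M) + 3 * 2 ^ ℓ
        ≡⟨ cong (_+ 3 * 2 ^ ℓ) (solve 2 (λ K M → K :* (con 12 :* M) := con 12 :* K :* M) refl (2 ^ k) M) ⟩
      12 * 2 ^ k * M + 3 * 2 ^ ℓ ∎
      where
      open ≤-Reasoning
      ℓ≤M : ℓ ≤ M
      ℓ≤M = m≤n⊔m (2 ^ d) ℓ
      perAddress : 2 + 2 * γ + 6 * 2 ^ d ≤ 12 * M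
      perAddress = begin
        2 + 2 * γ + 6 * 2 ^ d
          ≤⟨ +-mono-≤ (+-mono-≤ (*-monoʳ-≤ 2 (≤-trans ℓ>0 ℓ≤M)) (*-monoʳ-≤ 2 (≤-trans (≤-trans (m≤m+n γ d) (≤-reflexive γ+d)) ℓ≤M)))
                      (*-monoʳ-≤ 6 (m≤m⊔n (2 ^ d) ℓ)) ⟩
        2 * M + 2 * M + 6 * M  ≡⟨ solve 1 (λ M → con 2 :* M :+ con 2 :* M :+ con 6 :* M := con 10 :* M) refl M ⟩
        10 * M                 ≤⟨ *-monoˡ-≤ M (m≤m+n 10 2) ⟩
        12 * M                 ∎

module Estimates where

  open import Data.Nat using (zero; suc; z≤n; s≤s; _≟_)
  open import Data.Nat.Properties
  open import Data.Product using (Σ; _,_)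
  open import Data.Empty using (⊥-elim)
  open import Relation.Binary.PropositionalEquality
  open import Relation.Nullary using (yes; no)
  open import Data.Nat.Solver using (module +-*-Solver)
  open +-*-Solver

  doubling : ∀ n → 2 ^ suc n ≡ 2 ^ n + 2 ^ n
  doubling n = cong (2 ^ n +_) (+-identityʳ (2 ^ n))

  n<2^n : ∀ n → n < 2 ^ n
  n<2^n zero = s≤s z≤n
  n<2^n (suc n) = ≤-trans (+-monoʳ-≤ 1 (n<2^n n))
                          (≤-trans (+-monoˡ-≤ (2 ^ n) (m^n>0 2 n)) (≤-reflexive (sym (doubling n))))

  2n≤2^n : ∀ n → 2 * n ≤ 2 ^ n
  2n≤2^n zero = z≤n
  2n≤2^n (suc zero) = ≤-refl
  2n≤2^n (suc (suc n)) = begin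
    2 * suc (suc n)          ≡⟨ solve 1 (λ n → con 2 :* (con 2 :+ n) := con 2 :* (con 1 :+ n) :+ con 2) refl n ⟩
    2 * suc n + 2            ≤⟨ +-mono-≤ (2n≤2^n (suc n)) (*-monoʳ-≤ 2 (m^n>0 2 n)) ⟩
    2 ^ suc n + 2 ^ suc n    ≡⟨ sym (doubling (suc n)) ⟩
    2 ^ suc (suc n)          ∎
    where open ≤-Reasoning

  8e≤5·2^e : ∀ e → 3 ≤ e → 8 * e ≤ 5 * 2 ^ e
  8e≤5·2^e e 3≤e = from3 (e ∸ 3) e (m∸n+n≡m 3≤e)
    where
    from3 : ∀ m e → m + 3 ≡ e → 8 * e ≤ 5 * 2 ^ e
    from3 zero .3 refl = +-monoʳ-≤ 24 z≤n
    from3 (suc m) .(suc m + 3) refl = begin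
      8 * (suc m + 3)                      ≡⟨ solve 1 (λ m → con 8 :* (con 1 :+ m :+ con 3) := con 8 :* (m :+ con 3) :+ con 8) refl m ⟩
      8 * (m + 3) + 8                      ≤⟨ +-mono-≤ (from3 m (m + 3) refl) (≤-trans eight (m≤m+n (2 ^ (m + 3)) (4 * 2 ^ (m + 3)))) ⟩
      5 * 2 ^ (m + 3) + 5 * 2 ^ (m + 3)    ≡⟨ solve 1 (λ X → con 5 :* X :+ con 5 :* X := con 5 :* (X :+ X)) refl (2 ^ (m + 3)) ⟩
      5 * (2 ^ (m + 3) + 2 ^ (m + 3))      ≡⟨ cong (5 *_) (sym (doubling (m + 3))) ⟩
      5 * 2 ^ (suc m + 3)                  ∎
      where
      open ≤-Reasoning
      eight : 8 ≤ 2 ^ (m + 3)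
      eight = subst (8 ≤_) (sym (^-distribˡ-+-* 2 m 3)) (subst (_≤ 2 ^ m * 8) (*-identityˡ 8) (*-monoˡ-≤ 8 (m^n>0 2 m)))

  4[1+X]≤X² : ∀ X → 5 ≤ X → 4 * (1 + X) ≤ X * X
  4[1+X]≤X² X 5≤X = begin
    4 * (1 + X)   ≡⟨ solve 1 (λ X → con 4 :* (con 1 :+ X) := con 4 :+ con 4 :* X) refl X ⟩
    4 + 4 * X     ≤⟨ +-monoˡ-≤ (4 * X) (≤-trans (n≤1+n 4) 5≤X) ⟩
    X + 4 * X     ≡⟨ solve 1 (λ X → X :+ con 4 :* X := con 5 :* X) refl X ⟩
    5 * X         ≤⟨ *-monoˡ-≤ X 5≤X ⟩
    X * X         ∎
    where open ≤-Reasoning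

  log₂ : ∀ d → 1 ≤ d → Σ ℕ λ s → 2 ^ s ≤ d × d < 2 ^ suc s
  log₂ (suc zero) _ = 0 , ≤-refl , s≤s (s≤s z≤n)
  log₂ (suc (suc d)) _ with log₂ (suc d) (s≤s z≤n)
  ... | s , lo , hi with suc (suc d) ≟ 2 ^ suc s
  ...   | yes e = suc s , ≤-reflexive (sym e) , subst (_< 2 ^ suc (suc s)) (sym e) power<
    where
    power< : 2 ^ suc s < 2 ^ suc (suc s)
    power< = ≤-trans (≤-reflexive (+-comm 1 (2 ^ suc s)))
                     (≤-trans (+-monoʳ-≤ (2 ^ suc s) (m^n>0 2 (suc s))) (≤-reflexive (sym (doubling (suc s)))))
  ...   | no ne = s , ≤-trans lo (n≤1+n _) , ≤∧≢⇒< hi ne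

  blockLength : ∀ d → 9 ≤ d → Σ ℕ λ t′ → 2 * 2 ^ suc t′ ≤ d × d < 4 * 2 ^ suc t′
  blockLength d 9≤d with log₂ d (≤-trans (s≤s z≤n) 9≤d)
  ... | zero , lo , hi = ⊥-elim (<⇒≱ hi (≤-trans (s≤s (s≤s z≤n)) 9≤d))
  ... | suc zero , lo , hi = ⊥-elim (<⇒≱ hi (≤-trans (s≤s (s≤s (s≤s (s≤s z≤n)))) 9≤d))
  ... | suc (suc t′) , lo , hi =
    t′ , lo , subst (d <_) (solve 1 (λ X → con 2 :* (con 2 :* X) := con 4 :* X) refl (2 ^ suc t′)) hi

-- A deterministic program on the input followed by γ extra
-- variables (the guess, which should equal the first γ bits of the selected
-- pointer); the remaining pointer bits are split into mid = ℓ − γ − t middle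
-- bits and t final bits.  Stages:
--   read the address α;
--   compare the first γ bits of pointer α with the guess (reject if they differ);
--   read the middle bits m of pointer α;
--   read the guess G (shared by all α), so p = G 2^mid + m is the pointer
--     without its last t bits;
--   read the whole block g of r = 2^t data bits starting at p r;
--   if t > 0, read α again and select the bit of g given by the last t bits of
--     pointer α by t halvings of g.
module DeterministicProgram (k ℓ : ℕ) (k>0 : 0 < k) (nvv γ t : ℕ) (nv+γ≤nvv : isaN k ℓ + γ ≤ nvv)
                            (γ+t≤ℓ : γ + t ≤ ℓ) where

  open import Data.Nat using (zero; suc; z≤n; s≤s; _<ᵇ_; _≡ᵇ_; _/_; _%_)
  open import Data.Nat.Properties
  open import Data.Nat.DivMod using (m<n*o⇒m/o<n; m%n<n)
  open import Data.Bool using (Bool; true; false; if_then_else_)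
  open import Data.Fin using (Fin)
  open import Data.Maybe using (Maybe; just; nothing)
  open import Data.List using (List; []; _∷_; _++_; length)
  open import Data.List.Properties using (length-++)
  open import Data.List.Membership.Propositional using (_∈_)
  open import Data.List.Membership.Propositional.Properties using (∈-++⁺ˡ; ∈-++⁺ʳ; ∈-++⁻)
  open import Data.List.Relation.Unary.Any using (Any; here; there)
  open import Data.Product using (Σ; _,_; proj₂)
  open import Data.Sum using (inj₁; inj₂)
  open import Data.Empty using (⊥; ⊥-elim)
  open import Data.Unit using (⊤; tt)
  open import Relation.Binary.PropositionalEquality
  open import Function.Bundles using (_⇔_; mk⇔)
  open import Data.Nat.Solver using (module +-*-Solver)
  open Prelude
  open Enumeration
  open BigEndian
  open Compile
  open Layout k ℓ

  mid r : ℕ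
  mid = ℓ ∸ (γ + t)
  r = 2 ^ t

  -- number of copies of the address tree after the block (one per block value)
  rereads : ℕ
  rereads = if t ≡ᵇ 0 then 0 else 2 ^ r

  dataStart : ℕ
  dataStart = k + ℓ * 2 ^ k

  data Vertex : Set where
    reject accept : Vertex
    -- j address bits read, with value q
    readAddress : (j q : ℕ) → Vertex
    -- query bit i of pointer α
    comparePointer : (α i : ℕ) → Vertex
    -- bit i of pointer α was c; query guess bit i
    compareGuess : (α i c : ℕ) → Vertex
    -- j middle bits of pointer α read, with value q
    readMiddle : (α j q : ℕ) → Vertex
    -- j guess bits read, with value q, after middle part m
    readGuess : (m j q : ℕ) → Vertex
    -- j bits of data block p read, with value q
    readBlock : (p j q : ℕ) → Vertex
    -- j address bits read, with value q, after block value g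
    rereadAddress : (g j q : ℕ) → Vertex
    -- (i ≥ 1) select from the 2^i-bit number g by the last i bits of pointer α
    select : (α i g : ℕ) → Vertex

  code : Vertex → Code
  code reject = 0 , 0 , 0 , 0
  code accept = 1 , 0 , 0 , 0
  code (readAddress j q) = 2 , 0 , j , q
  code (comparePointer α i) = 3 , α , i , 0
  code (compareGuess α i c) = 4 , α , i , c
  code (readMiddle α j q) = 5 , α , j , q
  code (readGuess m j q) = 6 , m , j , q
  code (readBlock p j q) = 7 , p , j , q
  code (rereadAddress g j q) = 8 , g , j , q
  code (select α i g) = 9 , α , i , g

  uncode : Code → Maybe Vertex
  uncode (0 , _) = just reject
  uncode (1 , _) = just accept
  uncode (2 , _ , j , q) = just (readAddress j q)
  uncode (3 , α , i , _) = just (comparePointer α i)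
  uncode (4 , α , i , c) = just (compareGuess α i c)
  uncode (5 , α , j , q) = just (readMiddle α j q)
  uncode (6 , m , j , q) = just (readGuess m j q)
  uncode (7 , p , j , q) = just (readBlock p j q)
  uncode (8 , g , j , q) = just (rereadAddress g j q)
  uncode (9 , α , i , g) = just (select α i g)
  uncode _ = nothing

  uncode-code : ∀ v → uncode (code v) ≡ just v
  uncode-code reject = refl
  uncode-code accept = refl
  uncode-code (readAddress j q) = refl
  uncode-code (comparePointer α i) = refl
  uncode-code (compareGuess α i c) = refl
  uncode-code (readMiddle α j q) = refl
  uncode-code (readGuess m j q) = refl
  uncode-code (readBlock p j q) = refl
  uncode-code (rereadAddress g j q) = refl
  uncode-code (select α i g) = refl

  sink : ℕ → Vertex
  sink zero = reject
  sink (suc _) = accept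

  select′ : ℕ → ℕ → ℕ → Vertex
  select′ α zero g = sink g
  select′ α (suc i) g = select α (suc i) g

  reread′ : ℕ → ℕ → ℕ → Vertex
  reread′ g j q = if j <ᵇ k then rereadAddress g j q else select′ q t g

  blockRead : ℕ → Vertex
  blockRead g = if t ≡ᵇ 0 then sink g else reread′ g 0 0

  readBlock′ : ℕ → ℕ → ℕ → Vertex
  readBlock′ p j q = if j <ᵇ r then readBlock p j q else blockRead q

  readGuess′ : ℕ → ℕ → ℕ → Vertex
  readGuess′ m j q = if j <ᵇ γ then readGuess m j q else readBlock′ (q * 2 ^ mid + m) 0 0

  readMiddle′ : ℕ → ℕ → ℕ → Vertex
  readMiddle′ α j q = if j <ᵇ mid then readMiddle α j q else readGuess′ q 0 0

  compare′ : ℕ → ℕ → Vertex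
  compare′ α i = if i <ᵇ γ then comparePointer α i else readMiddle′ α 0 0

  readAddress′ : ℕ → ℕ → Vertex
  readAddress′ j q = if j <ᵇ k then readAddress j q else compare′ q 0

  -- the high (c = false) or low (c = true) half of a 2^(i+1)-bit number
  halfOf : Bool → ℕ → ℕ → ℕ
  halfOf false i g = _/_ g (2 ^ (2 ^ i)) {{m^n≢0 2 (2 ^ i)}}
  halfOf true i g = _%_ g (2 ^ (2 ^ i)) {{m^n≢0 2 (2 ^ i)}}

  next : Vertex → Bool → List Vertex
  next (readAddress j q) c = if j <ᵇ k then readAddress′ (suc j) (2 * q + b2n c) ∷ [] else []
  next (comparePointer α i) c = if i <ᵇ γ then compareGuess α i (b2n c) ∷ [] else []
  next (compareGuess α i c′) c = if b2n c ≡ᵇ c′ then compare′ α (suc i) ∷ [] else reject ∷ []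
  next (readMiddle α j q) c = if j <ᵇ mid then readMiddle′ α (suc j) (2 * q + b2n c) ∷ [] else []
  next (readGuess m j q) c = if j <ᵇ γ then readGuess′ m (suc j) (2 * q + b2n c) ∷ [] else []
  next (readBlock p j q) c = if j <ᵇ r then readBlock′ p (suc j) (2 * q + b2n c) ∷ [] else []
  next (rereadAddress g j q) c = if j <ᵇ k then reread′ g (suc j) (2 * q + b2n c) ∷ [] else []
  next (select α (suc i) g) c = select′ α i (halfOf c i g) ∷ []
  next _ c = []

  position : Vertex → ℕ
  position (readAddress j _) = j
  position (comparePointer α i) = k + ℓ * α + i
  position (compareGuess α i _) = nv + i
  position (readMiddle α j _) = k + ℓ * α + γ + j
  position (readGuess m j _) = nv + j
  position (readBlock p j _) = dataStart + p * r + j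
  position (rereadAddress g j _) = j
  position (select α i _) = k + ℓ * α + (ℓ ∸ i)
  position _ = 0

  nvv>0 : 0 < nvv
  nvv>0 = ≤-trans nv>0 (≤-trans (m≤m+n nv γ) nv+γ≤nvv)

  label : Vertex → Fin nvv
  label v = varAt nvv>0 (position v)

  rankReread rankBlock rankGuess rankMiddle rankCompare rankAddress : ℕ
  rankReread = t + 1
  rankBlock = rankReread + k + 1
  rankGuess = rankBlock + r + 1
  rankMiddle = rankGuess + γ + 1
  rankCompare = rankMiddle + mid + 1
  rankAddress = rankCompare + 2 * γ + 1

  rank : Vertex → ℕ
  rank (readAddress j _) = rankAddress + (k ∸ j)
  rank (comparePointer α i) = rankCompare + 2 * (γ ∸ i)
  rank (compareGuess α i _) = rankCompare + 2 * (γ ∸ suc i) + 1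
  rank (readMiddle α j _) = rankMiddle + (mid ∸ j)
  rank (readGuess m j _) = rankGuess + (γ ∸ j)
  rank (readBlock p j _) = rankBlock + (r ∸ j)
  rank (rereadAddress g j _) = rankReread + (k ∸ j)
  rank (select α i _) = i
  rank _ = 0

  rank-sink : ∀ g → rank (sink g) ≡ 0
  rank-sink zero = refl
  rank-sink (suc g) = refl

  rank-select′ : ∀ α i g → rank (select′ α i g) ≤ i
  rank-select′ α zero g = ≤-reflexive (rank-sink g)
  rank-select′ α (suc i) g = ≤-refl

  rank-reread′ : ∀ g j q → rank (reread′ g j q) ≤ rankReread + (k ∸ j)
  rank-reread′ g j q with j <ᵇ k
  ... | true = ≤-refl
  ... | false = ≤-trans (rank-select′ q t g) (≤-trans (m≤m+n t 1) (m≤m+n rankReread _))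

  rank-blockRead : ∀ g → rank (blockRead g) ≤ rankReread + k
  rank-blockRead g with t ≡ᵇ 0
  ... | true = subst (_≤ rankReread + k) (sym (rank-sink g)) z≤n
  ... | false = rank-reread′ g 0 0

  rank-readBlock′ : ∀ p j q → rank (readBlock′ p j q) ≤ rankBlock + (r ∸ j)
  rank-readBlock′ p j q with j <ᵇ r
  ... | true = ≤-refl
  ... | false = ≤-trans (rank-blockRead q) (≤-trans (m≤m+n (rankReread + k) 1) (m≤m+n rankBlock _))

  rank-readGuess′ : ∀ m j q → rank (readGuess′ m j q) ≤ rankGuess + (γ ∸ j)
  rank-readGuess′ m j q with j <ᵇ γ
  ... | true = ≤-refl
  ... | false = ≤-trans (rank-readBlock′ _ 0 0) (≤-trans (m≤m+n (rankBlock + r) 1) (m≤m+n rankGuess _))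

  rank-readMiddle′ : ∀ α j q → rank (readMiddle′ α j q) ≤ rankMiddle + (mid ∸ j)
  rank-readMiddle′ α j q with j <ᵇ mid
  ... | true = ≤-refl
  ... | false = ≤-trans (rank-readGuess′ q 0 0) (≤-trans (m≤m+n (rankGuess + γ) 1) (m≤m+n rankMiddle _))

  rank-compare′ : ∀ α i → rank (compare′ α i) ≤ rankCompare + 2 * (γ ∸ i)
  rank-compare′ α i with i <ᵇ γ
  ... | true = ≤-refl
  ... | false = ≤-trans (rank-readMiddle′ α 0 0) (≤-trans (m≤m+n (rankMiddle + mid) 1) (m≤m+n rankCompare _))

  rank-readAddress′ : ∀ j q → rank (readAddress′ j q) ≤ rankAddress + (k ∸ j)
  rank-readAddress′ j q with j <ᵇ k
  ... | true = ≤-refl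
  ... | false = ≤-trans (rank-compare′ q 0) (≤-trans (m≤m+n (rankCompare + 2 * γ) 1) (m≤m+n rankAddress _))

  countdown : ∀ B n j → j < n → B + (n ∸ suc j) < B + (n ∸ j)
  countdown B n j j<n = +-monoʳ-< B (∸-monoʳ-< {n} {suc j} {j} ≤-refl j<n)

  ∸-suc : ∀ n i → i < n → n ∸ i ≡ suc (n ∸ suc i)
  ∸-suc (suc n) zero _ = refl
  ∸-suc (suc n) (suc i) (s≤s i<n) = ∸-suc n i i<n

  -- a comparison of one bit takes two vertices
  half-countdown : ∀ B n → B + 2 * n + 1 < B + 2 * suc n
  half-countdown B n = subst (B + 2 * n + 1 <_)
    (solve 2 (λ B n → B :+ con 2 :* n :+ con 2 := B :+ con 2 :* (con 1 :+ n)) refl B n)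
    (+-monoʳ-< (B + 2 * n) (s≤s (s≤s z≤n)))
    where open +-*-Solver

  rank-next : ∀ u c w → w ∈ next u c → rank w < rank u
  rank-next (readAddress j q) c w w∈ with j <ᵇ k in e
  ... | true rewrite ∈-singleton w∈ = ≤-<-trans (rank-readAddress′ (suc j) _) (countdown rankAddress k j (<ᵇ-true e))
  ... | false = ⊥-elim (∉-[] w∈)
  rank-next (comparePointer α i) c w w∈ with i <ᵇ γ in e
  ... | true rewrite ∈-singleton w∈ | ∸-suc γ i (<ᵇ-true e) = half-countdown rankCompare (γ ∸ suc i)
  ... | false = ⊥-elim (∉-[] w∈)
  rank-next (compareGuess α i c′) c w w∈ with b2n c ≡ᵇ c′
  ... | true rewrite ∈-singleton w∈ = ≤-<-trans (rank-compare′ α (suc i)) (m<m+n _ (s≤s z≤n))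
  ... | false rewrite ∈-singleton w∈ = ≤-trans (s≤s z≤n) (≤-reflexive (+-comm 1 _))
  rank-next (readMiddle α j q) c w w∈ with j <ᵇ mid in e
  ... | true rewrite ∈-singleton w∈ = ≤-<-trans (rank-readMiddle′ α (suc j) _) (countdown rankMiddle mid j (<ᵇ-true e))
  ... | false = ⊥-elim (∉-[] w∈)
  rank-next (readGuess m j q) c w w∈ with j <ᵇ γ in e
  ... | true rewrite ∈-singleton w∈ = ≤-<-trans (rank-readGuess′ m (suc j) _) (countdown rankGuess γ j (<ᵇ-true e))
  ... | false = ⊥-elim (∉-[] w∈)
  rank-next (readBlock p j q) c w w∈ with j <ᵇ r in e
  ... | true rewrite ∈-singleton w∈ = ≤-<-trans (rank-readBlock′ p (suc j) _) (countdown rankBlock r j (<ᵇ-true e))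
  ... | false = ⊥-elim (∉-[] w∈)
  rank-next (rereadAddress g j q) c w w∈ with j <ᵇ k in e
  ... | true rewrite ∈-singleton w∈ = ≤-<-trans (rank-reread′ g (suc j) _) (countdown rankReread k j (<ᵇ-true e))
  ... | false = ⊥-elim (∉-[] w∈)
  rank-next (select α (suc i) g) c w w∈ rewrite ∈-singleton w∈ = s≤s (rank-select′ α i _)

  data Valid : Vertex → Set where
    valid-reject : Valid reject
    valid-accept : Valid accept
    valid-readAddress : ∀ {j q} → j < k → q < 2 ^ j → Valid (readAddress j q)
    valid-comparePointer : ∀ {α i} → α < 2 ^ k → i < γ → Valid (comparePointer α i)
    valid-compareGuess : ∀ {α i c} → α < 2 ^ k → i < γ → c < 2 → Valid (compareGuess α i c)
    valid-readMiddle : ∀ {α j q} → α < 2 ^ k → j < mid → q < 2 ^ j → Valid (readMiddle α j q)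
    valid-readGuess : ∀ {m j q} → m < 2 ^ mid → j < γ → q < 2 ^ j → Valid (readGuess m j q)
    valid-readBlock : ∀ {p j q} → p < 2 ^ (γ + mid) → j < r → q < 2 ^ j → Valid (readBlock p j q)
    valid-rereadAddress : ∀ {g j q} → g < rereads → j < k → q < 2 ^ j → Valid (rereadAddress g j q)
    valid-select : ∀ {α i g} → α < 2 ^ k → i < t → g < 2 ^ (2 ^ suc i) → Valid (select α (suc i) g)

  comparison : ℕ → ℕ → List Vertex
  comparison α i = comparePointer α i ∷ compareGuess α i 0 ∷ compareGuess α i 1 ∷ []

  addressList compareList middleList guessList blockList rereadList selectList : List Vertex
  addressList = tree readAddress k
  compareList = concatBelow (λ α → concatBelow (comparison α) γ) (2 ^ k)
  middleList = concatBelow (λ α → tree (readMiddle α) mid) (2 ^ k)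
  guessList = concatBelow (λ m → tree (readGuess m) γ) (2 ^ mid)
  blockList = concatBelow (λ p → tree (readBlock p) r) (2 ^ (γ + mid))
  rereadList = concatBelow (λ g → tree (rereadAddress g) k) rereads
  selectList = concatBelow (λ α → concatBelow (λ i → below (select α (suc i)) (2 ^ (2 ^ suc i))) t) (2 ^ k)

  body : List Vertex
  body = addressList ++ (compareList ++ (middleList ++ (guessList ++ (blockList ++ (rereadList ++ selectList)))))

  vertices : List Vertex
  vertices = reject ∷ accept ∷ body

  inBody : ∀ {v} → v ∈ body → v ∈ vertices
  inBody v∈ = there (there v∈)

  valid⇒∈ : ∀ {v} → Valid v → v ∈ vertices
  valid⇒∈ valid-reject = here refl
  valid⇒∈ valid-accept = there (here refl)
  valid⇒∈ (valid-readAddress j< q<) = inBody (∈-++⁺ˡ (∈tree j< q<))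
  valid⇒∈ (valid-comparePointer α< i<) =
    inBody (∈-++⁺ʳ addressList (∈-++⁺ˡ (∈concatBelow α< (∈concatBelow i< (here refl)))))
  valid⇒∈ (valid-compareGuess {c = 0} α< i< _) =
    inBody (∈-++⁺ʳ addressList (∈-++⁺ˡ (∈concatBelow α< (∈concatBelow i< (there (here refl))))))
  valid⇒∈ (valid-compareGuess {c = 1} α< i< _) =
    inBody (∈-++⁺ʳ addressList (∈-++⁺ˡ (∈concatBelow α< (∈concatBelow i< (there (there (here refl)))))))
  valid⇒∈ (valid-compareGuess {c = suc (suc _)} _ _ (s≤s (s≤s ())))
  valid⇒∈ (valid-readMiddle α< j< q<) =
    inBody (∈-++⁺ʳ addressList (∈-++⁺ʳ compareList (∈-++⁺ˡ (∈concatBelow α< (∈tree {f = readMiddle _} j< q<)))))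
  valid⇒∈ (valid-readGuess m< j< q<) =
    inBody (∈-++⁺ʳ addressList (∈-++⁺ʳ compareList (∈-++⁺ʳ middleList
      (∈-++⁺ˡ (∈concatBelow m< (∈tree {f = readGuess _} j< q<))))))
  valid⇒∈ (valid-readBlock p< j< q<) =
    inBody (∈-++⁺ʳ addressList (∈-++⁺ʳ compareList (∈-++⁺ʳ middleList (∈-++⁺ʳ guessList
      (∈-++⁺ˡ (∈concatBelow p< (∈tree {f = readBlock _} j< q<)))))))
  valid⇒∈ (valid-rereadAddress g< j< q<) =
    inBody (∈-++⁺ʳ addressList (∈-++⁺ʳ compareList (∈-++⁺ʳ middleList (∈-++⁺ʳ guessList (∈-++⁺ʳ blockList
      (∈-++⁺ˡ (∈concatBelow g< (∈tree {f = rereadAddress _} j< q<))))))))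
  valid⇒∈ (valid-select α< i< g<) =
    inBody (∈-++⁺ʳ addressList (∈-++⁺ʳ compareList (∈-++⁺ʳ middleList (∈-++⁺ʳ guessList (∈-++⁺ʳ blockList
      (∈-++⁺ʳ rereadList (∈concatBelow α< (∈concatBelow i< (∈below g<)))))))))

  ∈⇒valid : ∀ {v} → v ∈ vertices → Valid v
  ∈⇒valid (here refl) = valid-reject
  ∈⇒valid (there (here refl)) = valid-accept
  ∈⇒valid (there (there v∈)) = inAddress v∈
    where
    inSelect : ∀ {v} → v ∈ selectList → Valid v
    inSelect v∈ with concatBelow∈ {f = λ α → concatBelow (λ i → below (select α (suc i)) (2 ^ (2 ^ suc i))) t} {n = 2 ^ k} v∈
    ... | α , α< , v∈′ with concatBelow∈ {f = λ i → below (select α (suc i)) (2 ^ (2 ^ suc i))} {n = t} v∈′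
    ...   | i , i< , v∈″ with below∈ {f = select α (suc i)} {n = 2 ^ (2 ^ suc i)} v∈″
    ...     | g , g< , refl = valid-select α< i< g<
    inReread : ∀ {v} → v ∈ rereadList ++ selectList → Valid v
    inReread v∈ with ∈-++⁻ rereadList v∈
    ... | inj₂ v∈′ = inSelect v∈′
    ... | inj₁ v∈′ with concatBelow∈ {f = λ g → tree (rereadAddress g) k} {n = rereads} v∈′
    ...   | g , g< , v∈″ with tree∈ {f = rereadAddress g} {D = k} v∈″
    ...     | j , q , j< , q< , refl = valid-rereadAddress g< j< q<
    inBlock : ∀ {v} → v ∈ blockList ++ (rereadList ++ selectList) → Valid v
    inBlock v∈ with ∈-++⁻ blockList v∈
    ... | inj₂ v∈′ = inReread v∈′
    ... | inj₁ v∈′ with concatBelow∈ {f = λ p → tree (readBlock p) r} {n = 2 ^ (γ + mid)} v∈′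
    ...   | p , p< , v∈″ with tree∈ {f = readBlock p} {D = r} v∈″
    ...     | j , q , j< , q< , refl = valid-readBlock p< j< q<
    inGuess : ∀ {v} → v ∈ guessList ++ (blockList ++ (rereadList ++ selectList)) → Valid v
    inGuess v∈ with ∈-++⁻ guessList v∈
    ... | inj₂ v∈′ = inBlock v∈′
    ... | inj₁ v∈′ with concatBelow∈ {f = λ m → tree (readGuess m) γ} {n = 2 ^ mid} v∈′
    ...   | m , m< , v∈″ with tree∈ {f = readGuess m} {D = γ} v∈″
    ...     | j , q , j< , q< , refl = valid-readGuess m< j< q<
    inMiddle : ∀ {v} → v ∈ middleList ++ (guessList ++ (blockList ++ (rereadList ++ selectList))) → Valid v
    inMiddle v∈ with ∈-++⁻ middleList v∈
    ... | inj₂ v∈′ = inGuess v∈′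
    ... | inj₁ v∈′ with concatBelow∈ {f = λ α → tree (readMiddle α) mid} {n = 2 ^ k} v∈′
    ...   | α , α< , v∈″ with tree∈ {f = readMiddle α} {D = mid} v∈″
    ...     | j , q , j< , q< , refl = valid-readMiddle α< j< q<
    inCompare : ∀ {v} → v ∈ compareList ++ (middleList ++ (guessList ++ (blockList ++ (rereadList ++ selectList)))) → Valid v
    inCompare v∈ with ∈-++⁻ compareList v∈
    ... | inj₂ v∈′ = inMiddle v∈′
    ... | inj₁ v∈′ with concatBelow∈ {f = λ α → concatBelow (comparison α) γ} {n = 2 ^ k} v∈′
    ...   | α , α< , v∈″ with concatBelow∈ {f = comparison α} {n = γ} v∈″
    ...     | i , i< , here refl = valid-comparePointer α< i<
    ...     | i , i< , there (here refl) = valid-compareGuess α< i< (s≤s z≤n)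
    ...     | i , i< , there (there (here refl)) = valid-compareGuess α< i< (s≤s (s≤s z≤n))
    inAddress : ∀ {v} → v ∈ body → Valid v
    inAddress v∈ with ∈-++⁻ addressList v∈
    ... | inj₂ v∈′ = inCompare v∈′
    ... | inj₁ v∈′ with tree∈ {f = readAddress} {D = k} v∈′
    ...   | j , q , j< , q< , refl = valid-readAddress j< q<

  -- 2^(2^(i+1)) = (2^(2^i))²: a 2^(i+1)-bit number has two 2^i-bit halves.
  squared : ∀ i → 2 ^ (2 ^ suc i) ≡ 2 ^ (2 ^ i) * 2 ^ (2 ^ i)
  squared i = trans (cong (2 ^_) (cong (2 ^ i +_) (+-identityʳ (2 ^ i)))) (^-distribˡ-+-* 2 (2 ^ i) (2 ^ i))

  halfOf< : ∀ c i g → g < 2 ^ (2 ^ suc i) → halfOf c i g < 2 ^ (2 ^ i)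
  halfOf< false i g g< = m<n*o⇒m/o<n {{m^n≢0 2 (2 ^ i)}} (subst (g <_) (squared i) g<)
  halfOf< true i g g< = m%n<n g (2 ^ (2 ^ i)) {{m^n≢0 2 (2 ^ i)}}

  rereads≤ : rereads ≤ 2 ^ r
  rereads≤ with t ≡ᵇ 0
  ... | true = z≤n
  ... | false = ≤-refl

  finished : ∀ {n j q} → j ≤ n → (j <ᵇ n) ≡ false → q < 2 ^ j → q < 2 ^ n
  finished {n} {j} {q} j≤n e q< = subst (λ z → q < 2 ^ z) (≤-antisym j≤n (<ᵇ-false e)) q<

  valid-sink : ∀ g → Valid (sink g)
  valid-sink zero = valid-reject
  valid-sink (suc g) = valid-accept

  valid-select′ : ∀ α i g → α < 2 ^ k → i ≤ t → g < 2 ^ (2 ^ i) → Valid (select′ α i g)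
  valid-select′ α zero g _ _ _ = valid-sink g
  valid-select′ α (suc i) g α< i< g< = valid-select α< i< g<

  valid-reread′ : ∀ g j q → g < rereads → j ≤ k → q < 2 ^ j → Valid (reread′ g j q)
  valid-reread′ g j q g< j≤ q< with j <ᵇ k in e
  ... | true = valid-rereadAddress g< (<ᵇ-true e) q<
  ... | false = valid-select′ q t g (finished j≤ e q<) ≤-refl (≤-trans g< rereads≤)

  valid-blockRead : ∀ g → g < 2 ^ r → Valid (blockRead g)
  valid-blockRead g g< with t ≡ᵇ 0 in e
  ... | true = valid-sink g
  ... | false = valid-reread′ g 0 0 (subst (g <_) (sym (cong (λ b → if b then 0 else 2 ^ r) e)) g<) z≤n (s≤s z≤n)

  valid-readBlock′ : ∀ p j q → p < 2 ^ (γ + mid) → j ≤ r → q < 2 ^ j → Valid (readBlock′ p j q)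
  valid-readBlock′ p j q p< j≤ q< with j <ᵇ r in e
  ... | true = valid-readBlock p< (<ᵇ-true e) q<
  ... | false = valid-blockRead q (finished j≤ e q<)

  valid-readGuess′ : ∀ m j q → m < 2 ^ mid → j ≤ γ → q < 2 ^ j → Valid (readGuess′ m j q)
  valid-readGuess′ m j q m< j≤ q< with j <ᵇ γ in e
  ... | true = valid-readGuess m< (<ᵇ-true e) q<
  ... | false = valid-readBlock′ _ 0 0 (digits< γ mid q m (finished j≤ e q<) m<) z≤n (s≤s z≤n)

  valid-readMiddle′ : ∀ α j q → α < 2 ^ k → j ≤ mid → q < 2 ^ j → Valid (readMiddle′ α j q)
  valid-readMiddle′ α j q α< j≤ q< with j <ᵇ mid in e
  ... | true = valid-readMiddle α< (<ᵇ-true e) q<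
  ... | false = valid-readGuess′ q 0 0 (finished j≤ e q<) z≤n (s≤s z≤n)

  valid-compare′ : ∀ α i → α < 2 ^ k → i ≤ γ → Valid (compare′ α i)
  valid-compare′ α i α< i≤ with i <ᵇ γ in e
  ... | true = valid-comparePointer α< (<ᵇ-true e)
  ... | false = valid-readMiddle′ α 0 0 α< z≤n (s≤s z≤n)

  valid-readAddress′ : ∀ j q → j ≤ k → q < 2 ^ j → Valid (readAddress′ j q)
  valid-readAddress′ j q j≤ q< with j <ᵇ k in e
  ... | true = valid-readAddress (<ᵇ-true e) q<
  ... | false = valid-compare′ q 0 (finished j≤ e q<) z≤n

  valid-next : ∀ u c w → Valid u → w ∈ next u c → Valid w
  valid-next _ c w (valid-readAddress {j} {q} j< q<) w∈ rewrite <⇒<ᵇ-true j< | ∈-singleton w∈ =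
    valid-readAddress′ (suc j) _ j< (shiftIn< j q c q<)
  valid-next _ c w (valid-comparePointer {α} {i} α< i<) w∈ rewrite <⇒<ᵇ-true i< | ∈-singleton w∈ =
    valid-compareGuess α< i< (s≤s (b2n≤1 c))
  valid-next _ c w (valid-compareGuess {α} {i} {c′} α< i< _) w∈ with b2n c ≡ᵇ c′
  ... | true rewrite ∈-singleton w∈ = valid-compare′ α (suc i) α< i<
  ... | false rewrite ∈-singleton w∈ = valid-reject
  valid-next _ c w (valid-readMiddle {α} {j} {q} α< j< q<) w∈ rewrite <⇒<ᵇ-true j< | ∈-singleton w∈ =
    valid-readMiddle′ α (suc j) _ α< j< (shiftIn< j q c q<)
  valid-next _ c w (valid-readGuess {m} {j} {q} m< j< q<) w∈ rewrite <⇒<ᵇ-true j< | ∈-singleton w∈ =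
    valid-readGuess′ m (suc j) _ m< j< (shiftIn< j q c q<)
  valid-next _ c w (valid-readBlock {p} {j} {q} p< j< q<) w∈ rewrite <⇒<ᵇ-true j< | ∈-singleton w∈ =
    valid-readBlock′ p (suc j) _ p< j< (shiftIn< j q c q<)
  valid-next _ c w (valid-rereadAddress {g} {j} {q} g< j< q<) w∈ rewrite <⇒<ᵇ-true j< | ∈-singleton w∈ =
    valid-reread′ g (suc j) _ g< j< (shiftIn< j q c q<)
  valid-next _ c w (valid-select {α} {i} {g} α< i< g<) w∈ rewrite ∈-singleton w∈ =
    valid-select′ α i _ α< (<⇒≤ i<) (halfOf< c i g g<)

  next-closed : ∀ u c w → u ∈ vertices → w ∈ next u c → w ∈ vertices
  next-closed u c w u∈ w∈ = valid⇒∈ (valid-next u c w (∈⇒valid u∈) w∈)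

  single-next : ∀ u → u ∈ vertices → u ≢ reject → u ≢ accept → ∀ c → Σ Vertex λ w → next u c ≡ w ∷ []
  single-next u u∈ u≢reject u≢accept c = bySort (∈⇒valid u∈)
    where
    bySort : Valid u → Σ Vertex λ w → next u c ≡ w ∷ []
    bySort valid-reject = ⊥-elim (u≢reject refl)
    bySort valid-accept = ⊥-elim (u≢accept refl)
    bySort (valid-readAddress j< _) rewrite <⇒<ᵇ-true j< = _ , refl
    bySort (valid-comparePointer _ i<) rewrite <⇒<ᵇ-true i< = _ , refl
    bySort (valid-compareGuess {c = c′} _ _ _) with b2n c ≡ᵇ c′
    ... | true = _ , refl
    ... | false = _ , refl
    bySort (valid-readMiddle _ j< _) rewrite <⇒<ᵇ-true j< = _ , refl
    bySort (valid-readGuess _ j< _) rewrite <⇒<ᵇ-true j< = _ , refl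
    bySort (valid-readBlock _ j< _) rewrite <⇒<ᵇ-true j< = _ , refl
    bySort (valid-rereadAddress _ j< _) rewrite <⇒<ᵇ-true j< = _ , refl
    bySort (valid-select _ _ _) = _ , refl

  -- No move enters the start vertex readAddress 0 0: all stage entries other
  -- than the address tree are different vertex kinds.
  start : Vertex
  start = readAddress 0 0

  NotReadAddress : Vertex → Set
  NotReadAddress (readAddress _ _) = ⊥
  NotReadAddress _ = ⊤

  notStart : ∀ {w} → NotReadAddress w → w ≢ start
  notStart nr refl = nr

  sink-nr : ∀ g → NotReadAddress (sink g)
  sink-nr zero = tt
  sink-nr (suc g) = tt

  select′-nr : ∀ α i g → NotReadAddress (select′ α i g)
  select′-nr α zero g = sink-nr g
  select′-nr α (suc i) g = tt

  reread′-nr : ∀ g j q → NotReadAddress (reread′ g j q)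
  reread′-nr g j q with j <ᵇ k
  ... | true = tt
  ... | false = select′-nr q t g

  blockRead-nr : ∀ g → NotReadAddress (blockRead g)
  blockRead-nr g with t ≡ᵇ 0
  ... | true = sink-nr g
  ... | false = reread′-nr g 0 0

  readBlock′-nr : ∀ p j q → NotReadAddress (readBlock′ p j q)
  readBlock′-nr p j q with j <ᵇ r
  ... | true = tt
  ... | false = blockRead-nr q

  readGuess′-nr : ∀ m j q → NotReadAddress (readGuess′ m j q)
  readGuess′-nr m j q with j <ᵇ γ
  ... | true = tt
  ... | false = readBlock′-nr _ 0 0

  readMiddle′-nr : ∀ α j q → NotReadAddress (readMiddle′ α j q)
  readMiddle′-nr α j q with j <ᵇ mid
  ... | true = tt
  ... | false = readGuess′-nr q 0 0

  compare′-nr : ∀ α i → NotReadAddress (compare′ α i)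
  compare′-nr α i with i <ᵇ γ
  ... | true = tt
  ... | false = readMiddle′-nr α 0 0

  readAddress′≢start : ∀ j q → readAddress′ (suc j) q ≢ start
  readAddress′≢start j q with suc j <ᵇ k
  ... | true = λ ()
  ... | false = notStart (compare′-nr q 0)

  next≢start : ∀ u c w → w ∈ next u c → w ≢ start
  next≢start (readAddress j q) c w w∈ with j <ᵇ k
  ... | true rewrite ∈-singleton w∈ = readAddress′≢start j _
  ... | false = ⊥-elim (∉-[] w∈)
  next≢start (comparePointer α i) c w w∈ with i <ᵇ γ
  ... | true rewrite ∈-singleton w∈ = λ ()
  ... | false = ⊥-elim (∉-[] w∈)
  next≢start (compareGuess α i c′) c w w∈ with b2n c ≡ᵇ c′
  ... | true rewrite ∈-singleton w∈ = notStart (compare′-nr α (suc i))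
  ... | false rewrite ∈-singleton w∈ = λ ()
  next≢start (readMiddle α j q) c w w∈ with j <ᵇ mid
  ... | true rewrite ∈-singleton w∈ = notStart (readMiddle′-nr α (suc j) _)
  ... | false = ⊥-elim (∉-[] w∈)
  next≢start (readGuess m j q) c w w∈ with j <ᵇ γ
  ... | true rewrite ∈-singleton w∈ = notStart (readGuess′-nr m (suc j) _)
  ... | false = ⊥-elim (∉-[] w∈)
  next≢start (readBlock p j q) c w w∈ with j <ᵇ r
  ... | true rewrite ∈-singleton w∈ = notStart (readBlock′-nr p (suc j) _)
  ... | false = ⊥-elim (∉-[] w∈)
  next≢start (rereadAddress g j q) c w w∈ with j <ᵇ k
  ... | true rewrite ∈-singleton w∈ = notStart (reread′-nr g (suc j) _)
  ... | false = ⊥-elim (∉-[] w∈)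
  next≢start (select α (suc i) g) c w w∈ rewrite ∈-singleton w∈ = notStart (select′-nr α i _)

  machine : Machine nvv
  machine = record
    { Vertex = Vertex
    ; _≟V_ = decEq-via-code code uncode uncode-code
    ; vertices = vertices
    ; start = start ; reject = reject ; accept = accept
    ; reject≢accept = λ ()
    ; start≢reject = λ ()
    ; label = label
    ; next = next
    ; next-reject = λ c → refl
    ; next-accept = λ c → refl
    ; rank = rank
    ; rank-next = rank-next
    ; start∈ = valid⇒∈ (valid-readAddress k>0 (s≤s z≤n))
    ; reject∈ = here refl
    ; accept∈ = there (here refl)
    ; next-closed = next-closed
    ; next≢start = next≢start }

  γ+mid+t : γ + mid + t ≡ ℓ
  γ+mid+t = trans (+-assoc γ mid t) (trans (cong (γ +_) (+-comm mid t))
                  (trans (sym (+-assoc γ t mid)) (m+[n∸m]≡n γ+t≤ℓ)))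

  γ≤ℓ : γ ≤ ℓ
  γ≤ℓ = ≤-trans (m≤m+n γ t) γ+t≤ℓ

  t≤ℓ : t ≤ ℓ
  t≤ℓ = ≤-trans (m≤n+m t γ) γ+t≤ℓ

  module Semantics (a : Fin nv → Bool) (x : Fin nvv → Bool) (extends : ∀ p → p < nv → bitAt x p ≡ bitAt a p) where
    open ReachesProperties machine

    R : Vertex → Set
    R = Reaches machine x

    query : ∀ p → p < nv → x (varAt nvv>0 p) ≡ bitAt x p
    query p p< = varAt-bitAt nvv>0 x p (≤-trans p< (≤-trans (m≤m+n nv γ) nv+γ≤nvv))

    queryGuess : ∀ j → j < γ → x (varAt nvv>0 (nv + j)) ≡ bitAt x (nv + j)
    queryGuess j j< = varAt-bitAt nvv>0 x _ (≤-trans (+-monoʳ-< nv j<) nv+γ≤nvv)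

    A : ℕ
    A = bigEndian a 0 k

    A< : A < 2 ^ k
    A< = bigEndian< a 0 k

    pointerA : ℕ
    pointerA = k + ℓ * A

    address-agrees : bigEndian x 0 k ≡ A
    address-agrees = bigEndian-agree x a extends 0 k (≤-trans (m≤m+n k _) (m≤m+n _ _))

    sink-sem : ∀ b → R (sink (b2n b)) ⇔ (b ≡ true)
    sink-sem true = mk⇔ (λ _ → refl) (λ _ → done)
    sink-sem false = mk⇔ (λ r → ⊥-elim (reject-fails x r)) (λ ())

    select-sem : ∀ i st → i ≤ t →
                 R (select′ A i (bigEndian x st (2 ^ i))) ⇔ (bitAt x (st + bigEndian x (pointerA + (ℓ ∸ i)) i) ≡ true)
    select-sem zero st _ = sink-sem (bitAt x (st + 0))
    select-sem (suc i) st i< =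
      reaches-move x (select A (suc i) g) (λ c → select′ A i (halfOf c i g)) c (λ ()) (λ _ → refl)
                   (query P (pointer<nv A (ℓ ∸ suc i) A< (∸-monoʳ-< {ℓ} {suc i} {0} (s≤s z≤n) (≤-trans i< t≤ℓ)))) ⟨⇔⟩
      ≡⇒⇔ (cong (λ z → R (select′ A i z)) (halves c)) ⟨⇔⟩
      select-sem i (st + b2n c * 2 ^ i) (<⇒≤ i<) ⟨⇔⟩
      ≡⇒⇔ (cong (λ z → bitAt x z ≡ true) position-of-bit)
      where
      g = bigEndian x st (2 ^ suc i)
      P = pointerA + (ℓ ∸ suc i)
      c = bitAt x P
      H = bigEndian x st (2 ^ i)
      L = bigEndian x (st + 2 ^ i) (2 ^ i)
      split : g ≡ H * 2 ^ (2 ^ i) + L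
      split = trans (cong (bigEndian x st) (cong (2 ^ i +_) (+-identityʳ (2 ^ i))))
                    (bigEndian-split x st (2 ^ i) (2 ^ i))
      halves : ∀ c → halfOf c i g ≡ bigEndian x (st + b2n c * 2 ^ i) (2 ^ i)
      halves false = trans (cong (λ z → _/_ z (2 ^ (2 ^ i)) {{m^n≢0 2 (2 ^ i)}}) split)
                           (trans (div-digits H L (2 ^ (2 ^ i)) {{m^n≢0 2 (2 ^ i)}} (bigEndian< x (st + 2 ^ i) (2 ^ i)))
                                  (cong (λ z → bigEndian x z (2 ^ i)) (sym (+-identityʳ st))))
      halves true = trans (cong (λ z → _%_ z (2 ^ (2 ^ i)) {{m^n≢0 2 (2 ^ i)}}) split)
                          (trans (mod-digits H L (2 ^ (2 ^ i)) {{m^n≢0 2 (2 ^ i)}} (bigEndian< x (st + 2 ^ i) (2 ^ i)))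
                                 (cong (λ z → bigEndian x (st + z) (2 ^ i)) (sym (*-identityˡ (2 ^ i)))))
      position-of-bit : st + b2n c * 2 ^ i + bigEndian x (pointerA + (ℓ ∸ i)) i ≡ st + bigEndian x P (suc i)
      position-of-bit =
        trans (+-assoc st _ _) (cong (st +_)
          (trans (cong (λ z → b2n c * 2 ^ i + bigEndian x (pointerA + z) i) (∸-suc ℓ i (≤-trans i< t≤ℓ)))
          (trans (cong (λ z → b2n c * 2 ^ i + bigEndian x z i) (+-suc pointerA (ℓ ∸ suc i)))
                 (sym (bigEndian-head x P i)))))

    S : ℕ
    S = bigEndian x (pointerA + (ℓ ∸ t)) t

    reread-sem : ∀ g → R (reread′ g 0 0) ⇔ R (select′ A t g)
    reread-sem g =
      forwardTree x 0 k (λ j q → R (reread′ g j q)) advance ⟨⇔⟩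
      ≡⇒⇔ (cong (λ z → R (reread′ g k z)) address-agrees) ⟨⇔⟩
      ≡⇒⇔ (cong (λ b → R (if b then rereadAddress g k A else select′ A t g)) (n<ᵇn k))
      where
      advance : ∀ j q → j < k → R (reread′ g j q) ⇔ R (reread′ g (suc j) (2 * q + b2n (bitAt x j)))
      advance j q j< with j <ᵇ k in e
      ... | false = ⊥-elim (<⇒≱ j< (<ᵇ-false e))
      ... | true = reaches-move x (rereadAddress g j q) (λ c → reread′ g (suc j) (2 * q + b2n c)) _ (λ ())
                     (λ c → cong (λ b → if b then reread′ g (suc j) (2 * q + b2n c) ∷ [] else []) e)
                     (query j (address<nv j j<))

    blockRead-sem : ∀ st → R (blockRead (bigEndian x st r)) ⇔ (bitAt x (st + S) ≡ true)
    blockRead-sem st = byT (t ≡ᵇ 0) refl ⟨⇔⟩ select-sem t st ≤-refl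
      where
      g = bigEndian x st r
      sink-select : ∀ t′ → t′ ≡ 0 → sink g ≡ select′ A t′ g
      sink-select .0 refl = refl
      byT : ∀ b → (t ≡ᵇ 0) ≡ b → R (blockRead g) ⇔ R (select′ A t g)
      byT true e rewrite e = ≡⇒⇔ (cong R (sink-select t (≡ᵇ-true e)))
      byT false e rewrite e = reread-sem g

    readBlock-sem : ∀ p → p < 2 ^ (γ + mid) → R (readBlock′ p 0 0) ⇔ R (blockRead (bigEndian x (dataStart + p * r) r))
    readBlock-sem p p< =
      forwardTree x (dataStart + p * r) r (λ j q → R (readBlock′ p j q)) advance ⟨⇔⟩
      ≡⇒⇔ (cong (λ b → R (if b then readBlock p r g else blockRead g)) (n<ᵇn r))
      where
      g = bigEndian x (dataStart + p * r) r
      advance : ∀ j q → j < r → R (readBlock′ p j q) ⇔ R (readBlock′ p (suc j) (2 * q + b2n (bitAt x (dataStart + p * r + j))))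
      advance j q j< with j <ᵇ r in e
      ... | false = ⊥-elim (<⇒≱ j< (<ᵇ-false e))
      ... | true = reaches-move x (readBlock p j q) (λ c → readBlock′ p (suc j) (2 * q + b2n c)) _ (λ ())
                     (λ c → cong (λ b → if b then readBlock′ p (suc j) (2 * q + b2n c) ∷ [] else []) e)
                     (query _ (subst (_< nv) (sym (+-assoc dataStart (p * r) j))
                                     (data<nv _ (subst (p * r + j <_) (cong (2 ^_) γ+mid+t) (digits< (γ + mid) t p j p< j<)))))

    G : ℕ
    G = bigEndian x nv γ

    readGuess-sem : ∀ m → m < 2 ^ mid → R (readGuess′ m 0 0) ⇔ R (readBlock′ (G * 2 ^ mid + m) 0 0)
    readGuess-sem m m< =
      forwardTree x nv γ (λ j q → R (readGuess′ m j q)) advance ⟨⇔⟩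
      ≡⇒⇔ (cong (λ b → R (if b then readGuess m γ G else readBlock′ (G * 2 ^ mid + m) 0 0)) (n<ᵇn γ))
      where
      advance : ∀ j q → j < γ → R (readGuess′ m j q) ⇔ R (readGuess′ m (suc j) (2 * q + b2n (bitAt x (nv + j))))
      advance j q j< with j <ᵇ γ in e
      ... | false = ⊥-elim (<⇒≱ j< (<ᵇ-false e))
      ... | true = reaches-move x (readGuess m j q) (λ c → readGuess′ m (suc j) (2 * q + b2n c)) _ (λ ())
                     (λ c → cong (λ b → if b then readGuess′ m (suc j) (2 * q + b2n c) ∷ [] else []) e)
                     (queryGuess j j<)

    M : ℕ
    M = bigEndian x (pointerA + γ) mid

    readMiddle-sem : R (readMiddle′ A 0 0) ⇔ R (readGuess′ M 0 0)
    readMiddle-sem =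
      forwardTree x (pointerA + γ) mid (λ j q → R (readMiddle′ A j q)) advance ⟨⇔⟩
      ≡⇒⇔ (cong (λ b → R (if b then readMiddle A mid M else readGuess′ M 0 0)) (n<ᵇn mid))
      where
      γ+mid≤ℓ : γ + mid ≤ ℓ
      γ+mid≤ℓ = subst (γ + mid ≤_) γ+mid+t (m≤m+n (γ + mid) t)
      advance : ∀ j q → j < mid → R (readMiddle′ A j q) ⇔ R (readMiddle′ A (suc j) (2 * q + b2n (bitAt x (pointerA + γ + j))))
      advance j q j< with j <ᵇ mid in e
      ... | false = ⊥-elim (<⇒≱ j< (<ᵇ-false e))
      ... | true = reaches-move x (readMiddle A j q) (λ c → readMiddle′ A (suc j) (2 * q + b2n c)) _ (λ ())
                     (λ c → cong (λ b → if b then readMiddle′ A (suc j) (2 * q + b2n c) ∷ [] else []) e)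
                     (query _ (pointer<nv′ A γ j A< (≤-trans (+-monoʳ-< γ j<) γ+mid≤ℓ)))

    AgreeFrom : ℕ → Set
    AgreeFrom i = ∀ j → i ≤ j → j < γ → bitAt x (pointerA + j) ≡ bitAt x (nv + j)

    compareGuess-sem : ∀ i c → i < γ → R (compareGuess A i (b2n c)) ⇔ ((bitAt x (nv + i) ≡ c) × R (compare′ A (suc i)))
    compareGuess-sem i c i< =
      reaches-next x (compareGuess A i (b2n c)) (λ ()) ⟨⇔⟩ byValue (x (label (compareGuess A i (b2n c)))) ⟨⇔⟩
      (≡⇒⇔ (cong (_≡ c) (queryGuess i i<)) ×-⇔ ⇔-refl)
      where
      byValue : ∀ c′ → Any R (if b2n c′ ≡ᵇ b2n c then compare′ A (suc i) ∷ [] else reject ∷ []) ⇔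
                ((c′ ≡ c) × R (compare′ A (suc i)))
      byValue c′ with b2n c′ ≡ᵇ b2n c in e
      ... | true = any-singleton ⟨⇔⟩ mk⇔ (λ r → b2n-injective _ _ (≡ᵇ-true e) , r) proj₂
      ... | false = any-singleton ⟨⇔⟩ mk⇔ (λ r → ⊥-elim (reject-fails x r)) (λ (e′ , _) → ⊥-elim (≡ᵇ-false e (cong b2n e′)))

    compare-sem : ∀ n i → i + n ≡ γ → R (compare′ A i) ⇔ (AgreeFrom i × R (readMiddle′ A 0 0))
    compare-sem zero i i+0≡γ =
      ≡⇒⇔ (cong R finished-compare) ⟨⇔⟩
      mk⇔ (λ r → (λ j i≤j j<γ → ⊥-elim (<⇒≱ j<γ (≤-trans (≤-reflexive (trans (sym i+0≡γ) (+-identityʳ i))) i≤j))) , r) proj₂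
      where
      finished-compare : compare′ A i ≡ readMiddle′ A 0 0
      finished-compare = cong (λ b → if b then comparePointer A i else readMiddle′ A 0 0)
                              (subst (λ z → (i <ᵇ z) ≡ false) (trans (sym (+-identityʳ i)) i+0≡γ) (n<ᵇn i))
    compare-sem (suc n) i i+n≡γ =
      ≡⇒⇔ (cong (λ b → R (if b then comparePointer A i else readMiddle′ A 0 0)) (<⇒<ᵇ-true i<γ)) ⟨⇔⟩
      reaches-move x (comparePointer A i) (λ c → compareGuess A i (b2n c)) _ (λ ())
                   (λ c → cong (λ b → if b then compareGuess A i (b2n c) ∷ [] else []) (<⇒<ᵇ-true i<γ))
                   (query (pointerA + i) (pointer<nv A i A< (≤-trans i<γ γ≤ℓ))) ⟨⇔⟩
      compareGuess-sem i (bitAt x (pointerA + i)) i<γ ⟨⇔⟩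
      (⇔-refl ×-⇔ compare-sem n (suc i) (trans (sym (+-suc i n)) i+n≡γ)) ⟨⇔⟩
      mk⇔ (λ (bit-i , rest , r) → (λ j i≤j j<γ → extend j i≤j j<γ bit-i rest) , r)
          (λ (agree , r) → sym (agree i ≤-refl i<γ) , (λ j i<j j<γ → agree j (≤-trans (n≤1+n i) i<j) j<γ) , r)
      where
      i<γ : i < γ
      i<γ = subst (i <_) i+n≡γ (subst (_≤ i + suc n) (+-comm i 1) (+-monoʳ-≤ i (s≤s z≤n)))
      extend : ∀ j → i ≤ j → j < γ → bitAt x (nv + i) ≡ bitAt x (pointerA + i) → AgreeFrom (suc i) →
               bitAt x (pointerA + j) ≡ bitAt x (nv + j)
      extend j i≤j j<γ bit-i rest with m≤n⇒m<n∨m≡n i≤j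
      ... | inj₁ i<j = rest j i<j j<γ
      ... | inj₂ refl = sym bit-i

    readAddress-sem : R start ⇔ R (compare′ A 0)
    readAddress-sem =
      ≡⇒⇔ (cong R (sym first)) ⟨⇔⟩
      forwardTree x 0 k (λ j q → R (readAddress′ j q)) advance ⟨⇔⟩
      ≡⇒⇔ (cong (λ z → R (readAddress′ k z)) address-agrees) ⟨⇔⟩
      ≡⇒⇔ (cong (λ b → R (if b then readAddress k A else compare′ A 0)) (n<ᵇn k))
      where
      first : readAddress′ 0 0 ≡ start
      first = cong (λ b → if b then readAddress 0 0 else compare′ 0 0) (<⇒<ᵇ-true k>0)
      advance : ∀ j q → j < k → R (readAddress′ j q) ⇔ R (readAddress′ (suc j) (2 * q + b2n (bitAt x j)))
      advance j q j< with j <ᵇ k in e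
      ... | false = ⊥-elim (<⇒≱ j< (<ᵇ-false e))
      ... | true = reaches-move x (readAddress j q) (λ c → readAddress′ (suc j) (2 * q + b2n c)) _ (λ ())
                     (λ c → cong (λ b → if b then readAddress′ (suc j) (2 * q + b2n c) ∷ [] else []) e)
                     (query j (address<nv j j<))

    p₀ : ℕ
    p₀ = G * 2 ^ mid + M

    p₀< : p₀ < 2 ^ (γ + mid)
    p₀< = digits< γ mid G M (bigEndian< x nv γ) (bigEndian< x (pointerA + γ) mid)

    stages : R start ⇔ (AgreeFrom 0 × (bitAt x (dataStart + p₀ * r + S) ≡ true))
    stages = readAddress-sem ⟨⇔⟩ compare-sem γ 0 refl ⟨⇔⟩
             (⇔-refl ×-⇔ (readMiddle-sem ⟨⇔⟩ readGuess-sem M (bigEndian< x (pointerA + γ) mid) ⟨⇔⟩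
                          readBlock-sem p₀ p₀< ⟨⇔⟩ blockRead-sem (dataStart + p₀ * r)))

    pointer-value : AgreeFrom 0 → p₀ * r + S ≡ bigEndian a pointerA ℓ
    pointer-value agree = begin
      (G * 2 ^ mid + M) * 2 ^ t + S
        ≡⟨ cong (λ z → (z * 2 ^ mid + M) * 2 ^ t + S) (bigEndian-ext x nv pointerA γ (λ j j< → sym (agree j z≤n j<))) ⟩
      (bigEndian x pointerA γ * 2 ^ mid + M) * 2 ^ t + S
        ≡⟨ cong (λ z → z * 2 ^ t + S) (sym (bigEndian-split x pointerA γ mid)) ⟩
      bigEndian x pointerA (γ + mid) * 2 ^ t + S
        ≡⟨ cong (λ z → bigEndian x pointerA (γ + mid) * 2 ^ t + bigEndian x (pointerA + z) t) ℓ∸t ⟩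
      bigEndian x pointerA (γ + mid) * 2 ^ t + bigEndian x (pointerA + (γ + mid)) t
        ≡⟨ sym (bigEndian-split x pointerA (γ + mid) t) ⟩
      bigEndian x pointerA (γ + mid + t)  ≡⟨ cong (bigEndian x pointerA) γ+mid+t ⟩
      bigEndian x pointerA ℓ              ≡⟨ bigEndian-agree x a extends pointerA ℓ (pointerEnd A A<) ⟩
      bigEndian a pointerA ℓ              ∎
      where
      open ≡-Reasoning
      ℓ∸t : ℓ ∸ t ≡ γ + mid
      ℓ∸t = trans (cong (_∸ t) (sym γ+mid+t)) (m+n∸n≡m (γ + mid) t)

    GuessCorrect : Set
    GuessCorrect = ∀ j → j < γ → bitAt a (pointerA + j) ≡ bitAt x (nv + j)

    start-sem : R start ⇔ (GuessCorrect × ISA k ℓ a ≡ true)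
    start-sem = stages ⟨⇔⟩ mk⇔ to from
      where
      input-bit : ∀ j → j < γ → bitAt x (pointerA + j) ≡ bitAt a (pointerA + j)
      input-bit j j< = extends (pointerA + j) (pointer<nv A j A< (≤-trans j< γ≤ℓ))
      data-bit : AgreeFrom 0 → bitAt x (dataStart + p₀ * r + S) ≡ ISA k ℓ a
      data-bit agree =
        trans (extends _ (subst (_< nv) (sym (+-assoc dataStart (p₀ * r) S))
                                (data<nv _ (subst (p₀ * r + S <_) (cong (2 ^_) γ+mid+t)
                                                  (digits< (γ + mid) t p₀ S p₀< (bigEndian< x _ t))))))
              (cong (bitAt a) (trans (+-assoc dataStart (p₀ * r) S) (cong (dataStart +_) (pointer-value agree))))
      to : AgreeFrom 0 × (bitAt x (dataStart + p₀ * r + S) ≡ true) → GuessCorrect × ISA k ℓ a ≡ true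
      to (agree , e) = (λ j j< → trans (sym (input-bit j j<)) (agree j z≤n j<)) , trans (sym (data-bit agree)) e
      from : GuessCorrect × ISA k ℓ a ≡ true → AgreeFrom 0 × (bitAt x (dataStart + p₀ * r + S) ≡ true)
      from (correct , e) = agree , trans (data-bit agree) e
        where
        agree : AgreeFrom 0
        agree j _ j< = trans (input-bit j j<) (correct j j<)

  -- Size: the vertex lists have lengths 2^k − 1, 3γ 2^k, 2^k (2^mid − 1),
  -- 2^mid (2^γ − 1), 2^(γ+mid) (2^r − 1), rereads (2^k − 1) and
  -- 2^k Σ_{i<t} 2^(2^(i+1)).
  module Size where
    open +-*-Solver

    middleTree guessTree blockTree rereadTree selectCount : ℕ
    middleTree = length (tree (readMiddle 0) mid)
    guessTree = length (tree (readGuess 0) γ)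
    blockTree = length (tree (readBlock 0) r)
    rereadTree = length (tree (rereadAddress 0) k)
    selectCount = sumBelow (λ i → 2 ^ (2 ^ suc i)) t

    length-tree-any : ∀ (f g : ℕ → ℕ → Vertex) D → length (tree f D) ≡ length (tree g D)
    length-tree-any f g D = +-cancelʳ-≡ 1 _ _ (trans (length-tree f D) (sym (length-tree g D)))

    length-body : length body ≡ length addressList + (2 ^ k * (γ * 3) + (2 ^ k * middleTree + (2 ^ mid * guessTree
                    + (2 ^ (γ + mid) * blockTree + (rereads * rereadTree + 2 ^ k * selectCount)))))
    length-body =
      trans (length-++ addressList) (cong (length addressList +_)
      (trans (length-++ compareList) (cong₂ _+_ compare# (trans (length-++ middleList) (cong₂ _+_ middle#
      (trans (length-++ guessList) (cong₂ _+_ guess# (trans (length-++ blockList) (cong₂ _+_ block#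
      (trans (length-++ rereadList) (cong₂ _+_ reread# select#)))))))))))
      where
      compare# : length compareList ≡ 2 ^ k * (γ * 3)
      compare# = length-concatBelow-const _ (2 ^ k) (γ * 3) (λ α → length-concatBelow-const (comparison α) γ 3 (λ i → refl))
      middle# : length middleList ≡ 2 ^ k * middleTree
      middle# = length-concatBelow-const _ (2 ^ k) middleTree (λ α → length-tree-any (readMiddle α) (readMiddle 0) mid)
      guess# : length guessList ≡ 2 ^ mid * guessTree
      guess# = length-concatBelow-const _ (2 ^ mid) guessTree (λ m → length-tree-any (readGuess m) (readGuess 0) γ)
      block# : length blockList ≡ 2 ^ (γ + mid) * blockTree
      block# = length-concatBelow-const _ (2 ^ (γ + mid)) blockTree (λ p → length-tree-any (readBlock p) (readBlock 0) r)
      reread# : length rereadList ≡ rereads * rereadTree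
      reread# = length-concatBelow-const _ rereads rereadTree (λ g → length-tree-any (rereadAddress g) (rereadAddress 0) k)
      select# : length selectList ≡ 2 ^ k * selectCount
      select# = length-concatBelow-const _ (2 ^ k) selectCount
                  (λ α → trans (length-concatBelow _ t) (sumBelow-cong _ _ t (λ i → length-below (select α (suc i)) _)))

    tree≡ : ∀ {T} D → T + 1 ≡ 2 ^ D → T ≡ 2 ^ D ∸ 1
    tree≡ {T} D e = trans (sym (m+n∸n≡m T 1)) (cong (_∸ 1) e)

    tree≤ : ∀ {T} D → T + 1 ≡ 2 ^ D → T ≤ 2 ^ D
    tree≤ {T} D e = ≤-trans (m≤m+n T 1) (≤-reflexive e)

    length-body≤ : length body ≤ 2 ^ k * (1 + γ * 3 + (2 ^ mid ∸ 1))
                                 + (2 ^ mid * 2 ^ γ + (2 ^ (γ + mid) * blockTree + (rereads * 2 ^ k + 2 ^ k * selectCount)))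
    length-body≤ = begin
      length body
        ≡⟨ length-body ⟩
      a₀ + (2 ^ k * (γ * 3) + (2 ^ k * middleTree + (2 ^ mid * guessTree + (Z + (rereads * rereadTree + E)))))
        ≡⟨ cong (λ z → a₀ + (2 ^ k * (γ * 3) + (2 ^ k * z + (2 ^ mid * guessTree + (Z + (rereads * rereadTree + E))))))
                (tree≡ mid (length-tree (readMiddle 0) mid)) ⟩
      a₀ + (2 ^ k * (γ * 3) + (2 ^ k * (2 ^ mid ∸ 1) + (2 ^ mid * guessTree + (Z + (rereads * rereadTree + E)))))
        ≤⟨ +-mono-≤ (tree≤ k (length-tree readAddress k))
             (+-monoʳ-≤ (2 ^ k * (γ * 3)) (+-monoʳ-≤ (2 ^ k * (2 ^ mid ∸ 1))
               (+-mono-≤ (*-monoʳ-≤ (2 ^ mid) (tree≤ γ (length-tree (readGuess 0) γ)))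
                         (+-monoʳ-≤ Z (+-monoˡ-≤ E (*-monoʳ-≤ rereads (tree≤ k (length-tree (rereadAddress 0) k)))))))) ⟩
      2 ^ k + (2 ^ k * (γ * 3) + (2 ^ k * (2 ^ mid ∸ 1) + (2 ^ mid * 2 ^ γ + (Z + (rereads * 2 ^ k + E)))))
        ≡⟨ solve 7 (λ K g D W X Y Z → K :+ (K :* (g :* con 3) :+ (K :* D :+ (W :+ (X :+ (Y :+ Z)))))
                                   := K :* (con 1 :+ g :* con 3 :+ D) :+ (W :+ (X :+ (Y :+ Z)))) refl
                  (2 ^ k) γ (2 ^ mid ∸ 1) (2 ^ mid * 2 ^ γ) Z (rereads * 2 ^ k) E ⟩
      2 ^ k * (1 + γ * 3 + (2 ^ mid ∸ 1)) + (2 ^ mid * 2 ^ γ + (Z + (rereads * 2 ^ k + E))) ∎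
      where
      open ≤-Reasoning
      a₀ = length addressList
      Z = 2 ^ (γ + mid) * blockTree
      E = 2 ^ k * selectCount

    -- The selection trees are dominated by their last level.
    selectCount≤ : ∀ s → sumBelow (λ i → 2 ^ (2 ^ suc i)) s ≤ 2 * 2 ^ (2 ^ s)
    selectCount≤ zero = z≤n
    selectCount≤ (suc s) = begin
      2 ^ (2 ^ suc s) + sumBelow (λ i → 2 ^ (2 ^ suc i)) s ≤⟨ +-monoʳ-≤ (2 ^ (2 ^ suc s)) (selectCount≤ s) ⟩
      2 ^ (2 ^ suc s) + 2 * 2 ^ (2 ^ s)   ≤⟨ +-monoʳ-≤ (2 ^ (2 ^ suc s)) (≤-trans (*-monoˡ-≤ (2 ^ (2 ^ s)) two≤) (≤-reflexive (sym (squared s)))) ⟩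
      2 ^ (2 ^ suc s) + 2 ^ (2 ^ suc s)   ≡⟨ cong (2 ^ (2 ^ suc s) +_) (sym (+-identityʳ _)) ⟩
      2 * 2 ^ (2 ^ suc s)                 ∎
      where
      open ≤-Reasoning
      two≤ : 2 ≤ 2 ^ (2 ^ s)
      two≤ = ^-monoʳ-≤ 2 (m^n>0 2 s)

module DeterministicBounds (k ℓ : ℕ) (k>0 : 0 < k) (ℓ>0 : 0 < ℓ) where

  open import Data.Nat using (zero; suc; z≤n; s≤s; _≤?_)
  open import Data.Nat.Properties
  open import Data.Bool using (Bool; true)
  open import Data.Fin using (Fin; toℕ)
  open import Data.Fin.Properties using (toℕ-fromℕ<)
  import Data.Vec.Functional as VF
  open import Data.List using (length)
  open import Data.Product using (Σ; _,_; proj₂)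
  open import Relation.Binary.PropositionalEquality
  open import Relation.Nullary using (yes; no)
  open import Function.Bundles using (mk⇔; Equivalence)
  open import Data.Nat.Solver using (module +-*-Solver)
  open +-*-Solver
  open Prelude
  open BigEndian
  open Estimates
  open Enumeration using (length-tree)
  open Compile using (module Compiled)
  open Layout k ℓ

  detProgram : ∀ nvv γ t → nv + γ ≤ nvv → γ + t ≤ ℓ → BP nvv
  detProgram nvv γ t nv+γ≤nvv γ+t≤ℓ = Compiled.program (DeterministicProgram.machine k ℓ k>0 nvv γ t nv+γ≤nvv γ+t≤ℓ)

  Small : ℕ → ℕ → Set
  Small γ m = m * (ℓ ∸ γ) ≤ 2 ^ k * (γ * (ℓ ∸ γ) * 3 + 9 * 2 ^ (ℓ ∸ γ)) + 2 ^ ℓ * 2 ^ (ℓ ∸ γ)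

  -- t = 0: blocks are single data bits.
  module WithoutBlocks (nvv γ : ℕ) (nv+γ≤nvv : nv + γ ≤ nvv) (γ+0≤ℓ : γ + 0 ≤ ℓ) where
    open DeterministicProgram k ℓ k>0 nvv γ 0 nv+γ≤nvv γ+0≤ℓ
    open Size

    d : ℕ
    d = ℓ ∸ γ

    γ+d : γ + d ≡ ℓ
    γ+d = m+[n∸m]≡n γ≤ℓ

    size≤ : length body ≤ 2 ^ k * (1 + γ * 3 + (2 ^ d ∸ 1)) + 2 * 2 ^ ℓ
    size≤ = begin
      length body
        ≤⟨ length-body≤ ⟩
      2 ^ k * (1 + γ * 3 + (2 ^ mid ∸ 1)) + (2 ^ mid * 2 ^ γ + (2 ^ (γ + mid) * blockTree + (rereads * 2 ^ k + 2 ^ k * selectCount)))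
        ≡⟨ cong (λ z → 2 ^ k * (1 + γ * 3 + (2 ^ z ∸ 1)) + (2 ^ z * 2 ^ γ + (2 ^ (γ + z) * blockTree + (rereads * 2 ^ k + 2 ^ k * selectCount))))
                (cong (ℓ ∸_) (+-identityʳ γ)) ⟩
      2 ^ k * (1 + γ * 3 + (2 ^ d ∸ 1)) + (2 ^ d * 2 ^ γ + (2 ^ (γ + d) * 1 + (0 * 2 ^ k + 2 ^ k * 0)))
        ≡⟨ cong (2 ^ k * (1 + γ * 3 + (2 ^ d ∸ 1)) +_)
                (trans (cong₂ (λ u v → u + (v * 1 + (0 * 2 ^ k + 2 ^ k * 0))) data# (cong (2 ^_) γ+d))
                       (solve 2 (λ L K → L :+ (L :* con 1 :+ (con 0 :* K :+ K :* con 0)) := con 2 :* L) refl (2 ^ ℓ) (2 ^ k))) ⟩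
      2 ^ k * (1 + γ * 3 + (2 ^ d ∸ 1)) + 2 * 2 ^ ℓ ∎
      where
      open ≤-Reasoning
      data# : 2 ^ d * 2 ^ γ ≡ 2 ^ ℓ
      data# = trans (sym (^-distribˡ-+-* 2 d γ)) (cong (2 ^_) (trans (+-comm d γ) γ+d))

    small : d ≤ 8 → Small γ (length body)
    small d≤8 = begin
      length body * d
        ≤⟨ *-monoˡ-≤ d size≤ ⟩
      (2 ^ k * (1 + γ * 3 + (W ∸ 1)) + 2 * 2 ^ ℓ) * d
        ≡⟨ solve 5 (λ K g V L d → (K :* (con 1 :+ g :* con 3 :+ V) :+ con 2 :* L) :* d
                                 := K :* (g :* d :* con 3 :+ (con 1 :+ V) :* d) :+ L :* (con 2 :* d)) refl (2 ^ k) γ (W ∸ 1) (2 ^ ℓ) d ⟩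
      2 ^ k * (γ * d * 3 + (1 + (W ∸ 1)) * d) + 2 ^ ℓ * (2 * d)
        ≤⟨ +-mono-≤ (*-monoʳ-≤ (2 ^ k) (+-monoʳ-≤ (γ * d * 3) dataPart)) (*-monoʳ-≤ (2 ^ ℓ) (2n≤2^n d)) ⟩
      2 ^ k * (γ * d * 3 + 9 * W) + 2 ^ ℓ * W ∎
      where
      open ≤-Reasoning
      W = 2 ^ d
      dataPart : (1 + (W ∸ 1)) * d ≤ 9 * W
      dataPart = begin
        (1 + (W ∸ 1)) * d   ≡⟨ cong (_* d) (m+[n∸m]≡n (m^n>0 2 d)) ⟩
        W * d               ≤⟨ *-monoʳ-≤ W (≤-trans d≤8 (n≤1+n 8)) ⟩
        W * 9               ≡⟨ *-comm W 9 ⟩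
        9 * W               ∎

  module WithBlocks (nvv γ t′ : ℕ) (nv+γ≤nvv : nv + γ ≤ nvv) (γ+t≤ℓ : γ + suc t′ ≤ ℓ) where
    open DeterministicProgram k ℓ k>0 nvv γ (suc t′) nv+γ≤nvv γ+t≤ℓ
    open Size

    d : ℕ
    d = ℓ ∸ γ

    γ+d : γ + d ≡ ℓ
    γ+d = m+[n∸m]≡n (≤-trans (m≤m+n γ (suc t′)) γ+t≤ℓ)

    mid+t : mid + suc t′ ≡ d
    mid+t = trans (cong (λ z → z ∸ (γ + suc t′) + suc t′) (sym γ+d))
              (trans (cong (_+ suc t′) (cancel γ d (suc t′)))
                     (m∸n+n≡m (+-cancelˡ-≤ γ (suc t′) d (subst (γ + suc t′ ≤_) (sym γ+d) γ+t≤ℓ))))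
      where
      cancel : ∀ a b c → a + b ∸ (a + c) ≡ b ∸ c
      cancel zero b c = refl
      cancel (suc a) b c = cancel a b c

    size≤ : length body ≤ 2 ^ k * (1 + γ * 3 + 2 ^ mid + 3 * 2 ^ r) + 2 ^ γ * 2 ^ mid * (1 + 2 ^ r)
    size≤ = begin
      length body
        ≤⟨ length-body≤ ⟩
      2 ^ k * (1 + γ * 3 + (2 ^ mid ∸ 1)) + (2 ^ mid * 2 ^ γ + (2 ^ (γ + mid) * blockTree + (rereads * 2 ^ k + 2 ^ k * selectCount)))
        ≤⟨ +-mono-≤ (*-monoʳ-≤ (2 ^ k) (+-monoʳ-≤ (1 + γ * 3) (m∸n≤m (2 ^ mid) 1)))
                    (+-monoʳ-≤ (2 ^ mid * 2 ^ γ) (+-mono-≤ (*-monoʳ-≤ (2 ^ (γ + mid)) (tree≤ r (length-tree (readBlock 0) r)))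
                                                          (+-monoʳ-≤ (rereads * 2 ^ k) (*-monoʳ-≤ (2 ^ k) (selectCount≤ (suc t′)))))) ⟩
      2 ^ k * (1 + γ * 3 + 2 ^ mid) + (2 ^ mid * 2 ^ γ + (2 ^ (γ + mid) * 2 ^ r + (2 ^ r * 2 ^ k + 2 ^ k * (2 * 2 ^ r))))
        ≡⟨ cong (λ z → 2 ^ k * (1 + γ * 3 + 2 ^ mid) + (2 ^ mid * 2 ^ γ + (z * 2 ^ r + (2 ^ r * 2 ^ k + 2 ^ k * (2 * 2 ^ r)))))
                (^-distribˡ-+-* 2 γ mid) ⟩
      2 ^ k * (1 + γ * 3 + 2 ^ mid) + (2 ^ mid * 2 ^ γ + (2 ^ γ * 2 ^ mid * 2 ^ r + (2 ^ r * 2 ^ k + 2 ^ k * (2 * 2 ^ r))))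
        ≡⟨ solve 5 (λ K g P Q R → K :* (con 1 :+ g :* con 3 :+ P) :+ (P :* Q :+ (Q :* P :* R :+ (R :* K :+ K :* (con 2 :* R))))
                                 := K :* (con 1 :+ g :* con 3 :+ P :+ con 3 :* R) :+ Q :* P :* (con 1 :+ R))
                 refl (2 ^ k) γ (2 ^ mid) (2 ^ γ) (2 ^ r) ⟩
      2 ^ k * (1 + γ * 3 + 2 ^ mid + 3 * 2 ^ r) + 2 ^ γ * 2 ^ mid * (1 + 2 ^ r) ∎
      where open ≤-Reasoning

    module Balanced (2r≤d : 2 * r ≤ d) (d<4r : d < 4 * r) (9≤d : 9 ≤ d) where
      W P Rr : ℕ
      W = 2 ^ d
      P = 2 ^ mid
      Rr = 2 ^ r

      W≡P*r : W ≡ P * r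
      W≡P*r = trans (cong (2 ^_) (sym mid+t)) (^-distribˡ-+-* 2 mid (suc t′))

      r≤d : r ≤ d
      r≤d = ≤-trans (m≤m+n r (r + 0)) 2r≤d

      e : ℕ
      e = d ∸ r

      W≡Rr*2^e : W ≡ Rr * 2 ^ e
      W≡Rr*2^e = trans (cong (2 ^_) (sym (m+[n∸m]≡n r≤d))) (^-distribˡ-+-* 2 r e)

      d≤2e : d ≤ 2 * e
      d≤2e = begin
        d       ≡⟨ sym (m+[n∸m]≡n r≤d) ⟩
        r + e   ≤⟨ +-monoˡ-≤ e r≤e ⟩
        e + e   ≡⟨ cong (e +_) (sym (+-identityʳ e)) ⟩
        2 * e   ∎
        where
        open ≤-Reasoning
        r≤e : r ≤ e
        r≤e = ≤-trans (≤-reflexive (sym (m+n∸m≡n r r))) (∸-monoˡ-≤ r (subst (_≤ d) (cong (r +_) (+-identityʳ r)) 2r≤d))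

      3≤e : 3 ≤ e
      3≤e = *-cancelˡ-≤ 2 (≤-trans (+-monoʳ-≤ 6 z≤n) (≤-trans 9≤d d≤2e))

      -- the cost 4 d 2^r of the selection stage is at most 5 2^d
      selectPart : 4 * d * Rr ≤ 5 * W
      selectPart = begin
        4 * d * Rr         ≤⟨ *-monoˡ-≤ Rr (*-monoʳ-≤ 4 d≤2e) ⟩
        4 * (2 * e) * Rr   ≡⟨ cong (_* Rr) (sym (*-assoc 4 2 e)) ⟩
        8 * e * Rr         ≤⟨ *-monoˡ-≤ Rr (8e≤5·2^e e 3≤e) ⟩
        5 * 2 ^ e * Rr     ≡⟨ solve 2 (λ E R → con 5 :* E :* R := con 5 :* (R :* E)) refl (2 ^ e) Rr ⟩
        5 * (Rr * 2 ^ e)   ≡⟨ cong (5 *_) (sym W≡Rr*2^e) ⟩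
        5 * W              ∎
        where open ≤-Reasoning

      perAddress : (1 + γ * 3 + P + 3 * Rr) * d ≤ γ * d * 3 + 9 * W
      perAddress = begin
        (1 + γ * 3 + P + 3 * Rr) * d
          ≡⟨ solve 4 (λ g P R d → (con 1 :+ g :* con 3 :+ P :+ con 3 :* R) :* d := g :* d :* con 3 :+ (P :* d :+ (d :+ con 3 :* d :* R))) refl γ P Rr d ⟩
        γ * d * 3 + (P * d + (d + 3 * d * Rr))
          ≤⟨ +-monoʳ-≤ (γ * d * 3) (+-mono-≤ middlePart (+-monoˡ-≤ (3 * d * Rr) (≤-trans (≤-reflexive (sym (*-identityʳ d))) (*-monoʳ-≤ d (m^n>0 2 r))))) ⟩
        γ * d * 3 + (4 * W + (d * Rr + 3 * d * Rr))
          ≡⟨ cong (λ z → γ * d * 3 + (4 * W + z)) (solve 2 (λ d R → d :* R :+ con 3 :* d :* R := con 4 :* d :* R) refl d Rr) ⟩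
        γ * d * 3 + (4 * W + 4 * d * Rr)
          ≤⟨ +-monoʳ-≤ (γ * d * 3) (+-monoʳ-≤ (4 * W) selectPart) ⟩
        γ * d * 3 + (4 * W + 5 * W)
          ≡⟨ cong (γ * d * 3 +_) (solve 1 (λ W → con 4 :* W :+ con 5 :* W := con 9 :* W) refl W) ⟩
        γ * d * 3 + 9 * W ∎
        where
        open ≤-Reasoning
        middlePart : P * d ≤ 4 * W
        middlePart = begin
          P * d         ≤⟨ *-monoʳ-≤ P (<⇒≤ d<4r) ⟩
          P * (4 * r)   ≡⟨ solve 2 (λ P r → P :* (con 4 :* r) := con 4 :* (P :* r)) refl P r ⟩
          4 * (P * r)   ≡⟨ cong (4 *_) (sym W≡P*r) ⟩
          4 * W         ∎

      3≤r : 3 ≤ r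
      3≤r = ≮⇒≥ λ r<3 → <⇒≱ (≤-trans (s≤s 9≤d) d<4r) (≤-trans (*-monoʳ-≤ 4 (≤-pred r<3)) (n≤1+n 8))

      5≤Rr : 5 ≤ Rr
      5≤Rr = ≤-trans (+-monoʳ-≤ 5 z≤n) (≤-trans (≤-reflexive (sym (*-identityʳ 8)))
               (≤-trans (*-monoʳ-≤ 8 (m^n>0 2 (r ∸ 3)))
                        (≤-reflexive (trans (sym (^-distribˡ-+-* 2 3 (r ∸ 3))) (cong (2 ^_) (m+[n∸m]≡n 3≤r))))))

      -- the blocks and their 2^r continuations cost at most r 2^d per value of p
      blockPart : d * (1 + Rr) ≤ r * W
      blockPart = begin
        d * (1 + Rr)          ≤⟨ *-monoˡ-≤ (1 + Rr) (<⇒≤ d<4r) ⟩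
        4 * r * (1 + Rr)      ≡⟨ solve 2 (λ r R → con 4 :* r :* (con 1 :+ R) := r :* (con 4 :* (con 1 :+ R))) refl r Rr ⟩
        r * (4 * (1 + Rr))    ≤⟨ *-monoʳ-≤ r (4[1+X]≤X² Rr 5≤Rr) ⟩
        r * (Rr * Rr)         ≤⟨ *-monoʳ-≤ r Rr²≤W ⟩
        r * W                 ∎
        where
        open ≤-Reasoning
        Rr²≤W : Rr * Rr ≤ W
        Rr²≤W = subst (_≤ W) (^-distribˡ-+-* 2 r r) (^-monoʳ-≤ 2 (≤-trans (≤-reflexive (cong (r +_) (sym (+-identityʳ r)))) 2r≤d))

      small : Small γ (length body)
      small = begin
        length body * d
          ≤⟨ *-monoˡ-≤ d size≤ ⟩
        (2 ^ k * (1 + γ * 3 + P + 3 * Rr) + 2 ^ γ * P * (1 + Rr)) * d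
          ≡⟨ solve 6 (λ K X Q P R d → (K :* X :+ Q :* P :* (con 1 :+ R)) :* d := K :* (X :* d) :+ Q :* P :* (d :* (con 1 :+ R)))
                   refl (2 ^ k) (1 + γ * 3 + P + 3 * Rr) (2 ^ γ) P Rr d ⟩
        2 ^ k * ((1 + γ * 3 + P + 3 * Rr) * d) + 2 ^ γ * P * (d * (1 + Rr))
          ≤⟨ +-mono-≤ (*-monoʳ-≤ (2 ^ k) perAddress) (*-monoʳ-≤ (2 ^ γ * P) blockPart) ⟩
        2 ^ k * (γ * d * 3 + 9 * W) + 2 ^ γ * P * (r * W)
          ≡⟨ cong (2 ^ k * (γ * d * 3 + 9 * W) +_) (solve 4 (λ Q P r W → Q :* P :* (r :* W) := Q :* (P :* r) :* W) refl (2 ^ γ) P r W) ⟩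
        2 ^ k * (γ * d * 3 + 9 * W) + 2 ^ γ * (P * r) * W
          ≡⟨ cong (λ z → 2 ^ k * (γ * d * 3 + 9 * W) + 2 ^ γ * z * W) (sym W≡P*r) ⟩
        2 ^ k * (γ * d * 3 + 9 * W) + 2 ^ γ * W * W
          ≡⟨ cong (λ z → 2 ^ k * (γ * d * 3 + 9 * W) + z * W) (trans (sym (^-distribˡ-+-* 2 γ d)) (cong (2 ^_) γ+d)) ⟩
        2 ^ k * (γ * d * 3 + 9 * W) + 2 ^ ℓ * W ∎
        where open ≤-Reasoning

  -- For every γ < ℓ some block exponent t makes the program small: t = 0 if
  -- d = ℓ − γ ≤ 8, and otherwise t with 2 2^t ≤ d < 4 2^t.
  tuned : ∀ nvv γ (nv+γ≤nvv : nv + γ ≤ nvv) → γ < ℓ →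
          Σ ℕ λ t → Σ (γ + t ≤ ℓ) λ γ+t≤ℓ → Small γ (size (detProgram nvv γ t nv+γ≤nvv γ+t≤ℓ))
  tuned nvv γ nv+γ≤nvv γ<ℓ with (ℓ ∸ γ) ≤? 8
  ... | yes d≤8 = 0 , γ+0≤ℓ , WithoutBlocks.small nvv γ nv+γ≤nvv γ+0≤ℓ d≤8
    where
    γ+0≤ℓ : γ + 0 ≤ ℓ
    γ+0≤ℓ = ≤-trans (≤-reflexive (+-identityʳ γ)) (<⇒≤ γ<ℓ)
  ... | no d≰8 with blockLength (ℓ ∸ γ) (≰⇒> d≰8)
  ...   | t′ , 2r≤d , d<4r = suc t′ , γ+t≤ℓ , WithBlocks.Balanced.small nvv γ t′ nv+γ≤nvv γ+t≤ℓ 2r≤d d<4r (≰⇒> d≰8)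
    where
    γ+t≤ℓ : γ + suc t′ ≤ ℓ
    γ+t≤ℓ = ≤-trans (+-monoʳ-≤ γ (≤-trans (n<2^n t′) (≤-trans (m≤m+n (2 ^ t′) _) (≤-trans (m≤m+n (2 ^ suc t′) _) 2r≤d))))
                    (≤-reflexive (m+[n∸m]≡n (<⇒≤ γ<ℓ)))

  -- With δ extra variables and γ ≤ δ, the program is a δ-LNBP for ISA:
  -- the accepting choice of the extra variables starts with the pointer bits.
  module Guessing (δ γ t : ℕ) (γ≤δ : γ ≤ δ) (γ+t≤ℓ : γ + t ≤ ℓ) where
    open DeterministicProgram k ℓ k>0 (nv + δ) γ t (+-monoʳ-≤ nv γ≤δ) γ+t≤ℓ
    open Compiled machine using (program; accepts⇔; module Functional)

    computes : LNBPComputes δ program (ISA k ℓ)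
    computes = Functional.deterministic single-next , λ a → mk⇔ (to a) (from a)
      where
      from : ∀ a → (Σ (Fin δ → Bool) λ b → Accepts program (a VF.++ b)) → ISA k ℓ a ≡ true
      from a (b , acc) = proj₂ (Equivalence.to (Semantics.start-sem a (a VF.++ b) (bitAt-++ˡ a b))
                                               (Equivalence.to (accepts⇔ (a VF.++ b)) acc))
      to : ∀ a → ISA k ℓ a ≡ true → Σ (Fin δ → Bool) λ b → Accepts program (a VF.++ b)
      to a e = b , Equivalence.from (accepts⇔ (a VF.++ b))
                                    (Equivalence.from (Semantics.start-sem a (a VF.++ b) (bitAt-++ˡ a b)) (guessed , e))
        where
        pointerA = k + ℓ * bigEndian a 0 k
        b : Fin δ → Bool
        b i = bitAt a (pointerA + toℕ i)
        guessed : ∀ j → j < γ → bitAt a (pointerA + j) ≡ bitAt (a VF.++ b) (nv + j)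
        guessed j j< = sym (trans (bitAt-++ʳ a b j j<δ) (cong (λ z → bitAt a (pointerA + z)) (toℕ-fromℕ< j<δ)))
          where
          j<δ : j < δ
          j<δ = ≤-trans j< γ≤δ

  nv+0≤nv : nv + 0 ≤ nv
  nv+0≤nv = ≤-reflexive (+-identityʳ nv)

  module Deterministic (t : ℕ) (0+t≤ℓ : 0 + t ≤ ℓ) where
    open DeterministicProgram k ℓ k>0 nv 0 t nv+0≤nv 0+t≤ℓ
    open Compiled machine using (program; accepts⇔; module Functional)

    computes : DetComputes program (ISA k ℓ)
    computes =
      Functional.deterministic single-next ,
      λ a → mk⇔ (λ e → Equivalence.from (accepts⇔ a) (Equivalence.from (Semantics.start-sem a a (λ _ _ → refl)) ((λ j ()) , e)))
                (λ acc → proj₂ (Equivalence.to (Semantics.start-sem a a (λ _ _ → refl)) (Equivalence.to (accepts⇔ a) acc)))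

  -- Part (2), ℓ ≤ δ: guess the whole pointer, t = 0.
  lnbp-long-guess : ∀ δ → ℓ ≤ δ → HasLNBP δ (ISA k ℓ) (λ m → m ≤ 2 ^ k * (3 * ℓ + 1) + 2 * 2 ^ ℓ)
  lnbp-long-guess δ ℓ≤δ =
    detProgram (nv + δ) ℓ 0 (+-monoʳ-≤ nv ℓ≤δ) ℓ+0≤ℓ , Guessing.computes δ ℓ 0 ℓ≤δ ℓ+0≤ℓ ,
    subst (size (detProgram (nv + δ) ℓ 0 (+-monoʳ-≤ nv ℓ≤δ) ℓ+0≤ℓ) ≤_) closed-form
          (WithoutBlocks.size≤ (nv + δ) ℓ (+-monoʳ-≤ nv ℓ≤δ) ℓ+0≤ℓ)
    where
    ℓ+0≤ℓ : ℓ + 0 ≤ ℓ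
    ℓ+0≤ℓ = ≤-reflexive (+-identityʳ ℓ)
    closed-form : 2 ^ k * (1 + ℓ * 3 + (2 ^ (ℓ ∸ ℓ) ∸ 1)) + 2 * 2 ^ ℓ ≡ 2 ^ k * (3 * ℓ + 1) + 2 * 2 ^ ℓ
    closed-form = cong (λ z → 2 ^ k * z + 2 * 2 ^ ℓ)
      (trans (cong (λ z → 1 + ℓ * 3 + (2 ^ z ∸ 1)) (n∸n≡0 ℓ)) (solve 1 (λ l → con 1 :+ l :* con 3 :+ con 0 := con 3 :* l :+ con 1) refl ℓ))

  lnbp-short-guess : ∀ δ → δ < ℓ →
                     HasLNBP δ (ISA k ℓ) (λ m → m * (ℓ ∸ δ) ≤ 12 * 2 ^ k * (2 ^ (ℓ ∸ δ) ⊔ ℓ * (ℓ ∸ δ)) + 2 ^ (2 * ℓ ∸ δ))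
  lnbp-short-guess δ δ<ℓ with tuned (nv + δ) δ (+-monoʳ-≤ nv ≤-refl) δ<ℓ
  ... | t , δ+t≤ℓ , small =
    detProgram (nv + δ) δ t (+-monoʳ-≤ nv ≤-refl) δ+t≤ℓ , Guessing.computes δ δ t ≤-refl δ+t≤ℓ ,
    ≤-trans small (+-mono-≤ perAddress (≤-reflexive data#))
    where
    d = ℓ ∸ δ
    M = 2 ^ d ⊔ ℓ * d
    open ≤-Reasoning
    perAddress : 2 ^ k * (δ * d * 3 + 9 * 2 ^ d) ≤ 12 * 2 ^ k * M
    perAddress = begin
      2 ^ k * (δ * d * 3 + 9 * 2 ^ d)
        ≤⟨ *-monoʳ-≤ (2 ^ k) (+-mono-≤ (*-monoˡ-≤ 3 (≤-trans (*-monoˡ-≤ d (<⇒≤ δ<ℓ)) (m≤n⊔m (2 ^ d) (ℓ * d))))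
                                        (*-monoʳ-≤ 9 (m≤m⊔n (2 ^ d) (ℓ * d)))) ⟩
      2 ^ k * (M * 3 + 9 * M)   ≡⟨ solve 2 (λ K M → K :* (M :* con 3 :+ con 9 :* M) := con 12 :* K :* M) refl (2 ^ k) M ⟩
      12 * 2 ^ k * M            ∎
    data# : 2 ^ ℓ * 2 ^ d ≡ 2 ^ (2 * ℓ ∸ δ)
    data# = trans (sym (^-distribˡ-+-* 2 ℓ d))
                  (cong (2 ^_) (sym (trans (cong (_∸ δ) (cong (ℓ +_) (+-identityʳ ℓ))) (+-∸-assoc ℓ (<⇒≤ δ<ℓ)))))

  bp : HasBP (ISA k ℓ) (λ m → m * ℓ ≤ 9 * 2 ^ (k + ℓ) + 2 ^ (2 * ℓ))
  bp with tuned nv 0 nv+0≤nv ℓ>0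
  ... | t , 0+t≤ℓ , small =
    detProgram nv 0 t nv+0≤nv 0+t≤ℓ , Deterministic.computes t 0+t≤ℓ ,
    subst (size (detProgram nv 0 t nv+0≤nv 0+t≤ℓ) * ℓ ≤_) closed-form small
    where
    closed-form : 2 ^ k * (0 * ℓ * 3 + 9 * 2 ^ ℓ) + 2 ^ ℓ * 2 ^ ℓ ≡ 9 * 2 ^ (k + ℓ) + 2 ^ (2 * ℓ)
    closed-form = cong₂ _+_ (trans (solve 2 (λ K L → K :* (con 9 :* L) := con 9 :* (K :* L)) refl (2 ^ k) (2 ^ ℓ))
                                   (cong (9 *_) (sym (^-distribˡ-+-* 2 k ℓ))))
                            (trans (sym (^-distribˡ-+-* 2 ℓ ℓ)) (cong (λ z → 2 ^ (ℓ + z)) (sym (+-identityʳ ℓ))))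

theorem5p1 : (δ k ℓ : ℕ) → 0 < k → 0 < ℓ →
    (HasNBP (ISA k ℓ) (λ m → (m ∸ 2 ^ ℓ) ^ 2 ≤ 9 * 2 ^ (2 * k) * 2 ^ ℓ)
      × Has⊕BP (ISA k ℓ) (λ m → (m ∸ 2 ^ ℓ) ^ 2 ≤ 9 * 2 ^ (2 * k) * 2 ^ ℓ))
    × (δ < ℓ → HasLNBP δ (ISA k ℓ) (λ m →
          m * (ℓ ∸ δ) ≤ 12 * 2 ^ k * (2 ^ (ℓ ∸ δ) ⊔ ℓ * (ℓ ∸ δ)) + 2 ^ (2 * ℓ ∸ δ)))
    × (ℓ ≤ δ → HasLNBP δ (ISA k ℓ) (λ m → m ≤ 2 ^ k * (3 * ℓ + 1) + 2 * 2 ^ ℓ))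
    × HasBP (ISA k ℓ) (λ m → m * ℓ ≤ 9 * 2 ^ (k + ℓ) + 2 ^ (2 * ℓ))
    × HasLNBF δ (ISA k ℓ) (λ m → m ≤ 12 * 2 ^ k * (2 ^ (ℓ ∸ δ) ⊔ ℓ) + 3 * 2 ^ ℓ)
    × HasBF (ISA k ℓ) (λ m → m ≤ 7 * 2 ^ k * 2 ^ ℓ)
theorem5p1 δ k ℓ k>0 ℓ>0 =
  (nbp , ⊕bp) , lnbp-short-guess δ , lnbp-long-guess δ , bp , lnbf δ , bf
  where
  open NondeterministicProgram k ℓ k>0 using (nbp; ⊕bp)
  open DeterministicBounds k ℓ k>0 ℓ>0 using (lnbp-short-guess; lnbp-long-guess; bp)
  open Formulas k ℓ ℓ>0 using (lnbf; bf)
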